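{- Let $k\geq 5$ and $t\geq 1$ be integers. There exists $n_0=n_0(k,t)$ such that for all $n\geq n_0$: (1) $\mathrm{ex}_k(n,\mathbb{C}^{(k)}_{2t+1})=\binom{n}{k}-\binom{n-t}{k}$, and the only extremal family consists of all the $k$-subsets of $[n]$ that meet some fixed $t$-set $S\subseteq[n]$; (2) $\mathrm{ex}_k(n,\mathbb{C}^{(k)}_{2t+2})=\binom{n}{k}-\binom{n-t}{k}+\binom{n-t-2}{k-2}$, and the only extremal family consists of all the $k$-subsets of $[n]$ that intersect some fixed $t$-set $S\subseteq[n]$ together with all the $k$-subsets of $[n]\setminus S$ that contain some two fixed elements of $[n]\setminus S$.
   Context: A $k$-graph on $[n]=\{1,\dots,n\}$ is a family of $k$-element subsets of $[n]$. For $\ell\geq 3$, the $k$-uniform linear cycle $\mathbb{C}^{(k)}_\ell$ is the $k$-graph consisting of $k$-sets $F_1,\dots,F_\ell$ together with $\ell$ distinct vertices $v_1,\dots,v_\ell$ such that $F_i\cap\{v_1,\dots,v_\ell\}=\{v_i,v_{i+1}\}$ (indices mod $\ell$, $v_{\ell+1}=v_1$) and the sets $F_i\setminus\{v_1,\dots,v_\ell\}$ are pairwise disjoint; equivalently, a cyclic list of $k$-sets in which consecutive sets intersect in exactly one element and nonconsecutive sets are disjoint. A $k$-graph contains $H$ if it has a subfamily isomorphic to $H$. $\mathrm{ex}_k(n,H)$ denotes the maximum number of edges of a $k$-graph on $[n]$ that does not contain $H$; an extremal family is one attaining this maximum. -}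

module Defs where

open import Data.Nat using (ℕ; zero; suc; _+_; _*_; _∸_; _≤_)
open import Data.Nat.DivMod using (_mod_)
open import Data.Fin using (Fin; toℕ)
open import Data.Fin.Subset using (Subset; _∈_; _∉_; ∣_∣)
open import Data.List using (List; length)
open import Data.List.Relation.Unary.All using (All)
open import Data.List.Relation.Unary.Unique.Propositional using (Unique)
import Data.List.Membership.Propositional as LM
open import Data.Product using (Σ; ∃; _×_)
open import Data.Sum using (_⊎_)
open import Relation.Binary.PropositionalEquality using (_≡_; _≢_)
open import Relation.Nullary using (¬_)
open import Function.Bundles using (_⇔_)
open import Function.Definitions using (Injective)

record KGraph (k n : ℕ) : Set where
  field
    edges   : List (Subset n)
    unique  : Unique edges
    uniform : All (λ e → ∣ e ∣ ≡ k) edges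
open KGraph public

_∈E_ : ∀ {k n} → Subset n → KGraph k n → Set
e ∈E G = e LM.∈ edges G

next : ∀ {ℓ} → Fin ℓ → Fin ℓ
next {suc m} i = suc (toℕ i) mod suc m

-- G contains the k-uniform linear cycle of length ℓ:
-- edges F_0..F_{ℓ-1} of G and distinct vertices v_0..v_{ℓ-1} with
-- F_i ∩ {v_0..v_{ℓ-1}} = {v_i, v_{i+1}} and the sets F_i ∖ {v_0..v_{ℓ-1}}
-- pairwise disjoint.
ContainsCycle : ∀ {k n} → ℕ → KGraph k n → Set
ContainsCycle {k} {n} ℓ G =
  Σ (Fin ℓ → Subset n) λ F → Σ (Fin ℓ → Fin n) λ v →
    (∀ i → F i ∈E G) ×
    Injective _≡_ _≡_ v ×
    (∀ i j → (v j ∈ F i) ⇔ (j ≡ i ⊎ j ≡ next i)) ×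
    (∀ i j → i ≢ j → ∀ x → x ∈ F i → x ∈ F j → ∃ λ m → x ≡ v m)

IsEx : ℕ → ℕ → ℕ → ℕ → Set
IsEx k n ℓ N =
  (∀ (G : KGraph k n) → ¬ ContainsCycle ℓ G → length (edges G) ≤ N) ×
  Σ (KGraph k n) (λ G → ¬ ContainsCycle ℓ G × length (edges G) ≡ N)

-- G is extremal for C_ℓ with N = ex_k(n, C_ℓ)
Extremal : ∀ {k n} → ℕ → ℕ → KGraph k n → Set
Extremal ℓ N G = ¬ ContainsCycle ℓ G × length (edges G) ≡ N

Meets : ∀ {n} → Subset n → Subset n → Set
Meets e S = ∃ λ x → x ∈ e × x ∈ S

HasEdgeSet : ∀ {k n} → KGraph k n → (Subset n → Set) → Set
HasEdgeSet {k} G P = ∀ e → (e ∈E G) ⇔ (∣ e ∣ ≡ k × P e)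

Family1 : ∀ {n} → Subset n → Subset n → Set
Family1 S e = Meets e S

Family2 : ∀ {n} → Subset n → Fin n → Fin n → Subset n → Set
Family2 S a b e = Meets e S ⊎ (¬ Meets e S × a ∈ e × b ∈ e)

{-# OPTIONS --safe #-}
-- A set D of vertices is a kernel if edges through D can avoid any bounded set of vertices outside D. A cycle
-- of kernels yields a linear cycle by a greedy choice of edges. Reading the edges as tuples, any family of more
-- than C nʳ edges contains a nonempty homogeneous subfamily, whose kernels sit at the same positions in all its
-- edges, are closed under intersection, and cover every r-set of positions.
--
-- With r = k − 2 the pattern either contains a triangle of kernel pairs, hence all cycles, or all sets through
-- one position. So all but O(n^(k−2)) edges have a centre x such that every {x, y, y′} in the edge is a kernel.
-- Deleting edges with small codegree at their centre costs o(n^(k−1)) edges and leaves boundedly many centres.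
-- No more than t centres can be joined to almost all (k − 1)-sets; since there are about t C(n, k−1) edges, a
-- single t-set S is joined to almost all vertices. Then a vertex that is not joined to S costs order n^(k−2) edges
-- meeting S, more than can be gained by edges that miss S and have at most one joined vertex. For the odd cycle an
-- edge missing S with two joined vertices closes a cycle. For the even cycle two such edges meeting in one vertex
-- do, and Frankl's theorem on families without singleton intersections applies; it is proved by the same method
-- with r = k − 3, where the pattern consists of all sets containing a fixed pair of positions.
module Submission where

open import Defs
open import Data.Bool using (if_then_else_; true; false)
open import Data.Bool.Properties using () renaming (_≟_ to _≟B_)
open import Data.Empty using (⊥; ⊥-elim)
open import Data.Fin using (Fin; zero; suc; toℕ; fromℕ<)
open import Data.Fin.Induction using (spo-wellFounded)
import Data.Fin.Properties as FinP
open import Data.Fin.Subset using (Subset; _∈_; _∉_; ∣_∣; ⁅_⁆; _∪_; inside; outside) renaming (⊥ to ∅; _⊆_ to _⊆ₛ_)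
open import Data.Fin.Subset.Properties using (_∈?_; _⊆?_; ∉⊥; ∈⊤; x∈⁅x⁆; x∈⁅y⁆⇒x≡y; x∈p∪q⁺; x∈p∪q⁻; p⊆p∪q; q⊆p∪q; p⊂q⇒∣p∣<∣q∣; ⊆-antisym; ∣p∣≤n; ∣⊥∣≡0; ∣p∣≡n⇒p≡⊤)
open import Data.List using (List; []; _∷_; length; map; filter; _++_; allFin; cartesianProductWith; cartesianProduct; lookup; take)
open import Data.List.Membership.Propositional using (find; lose) renaming (_∈_ to _∈ₗ_; _∉_ to _∉ₗ_)
open import Data.List.Membership.Propositional.Properties
import Data.List.Membership.DecPropositional as DecM
open import Data.List.Properties using (length-map; length-filter; length-take; filter-++; length-++; ++-identityʳ; length-tabulate; filter-notAll)
import Data.List.Properties as ListP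
open import Data.List.Relation.Unary.All as All using (All; []; _∷_; all?)
import Data.List.Relation.Unary.All.Properties as AllP
open import Data.List.Relation.Unary.AllPairs using ([]; _∷_)
open import Data.List.Relation.Unary.Any using (Any; here; there; any?)
open import Data.List.Relation.Unary.Unique.DecPropositional using () renaming (unique? to uniqueBy?)
open import Data.List.Relation.Unary.Unique.Propositional using (Unique)
import Data.List.Relation.Unary.Unique.Propositional.Properties as UniqueP
open import Data.Nat using (ℕ; zero; suc; _+_; _*_; _∸_; _^_; _≤_; _<_; z≤n; s≤s; _≤?_; _<?_)
open import Data.Nat.Combinatorics using (_C_; nCk+nC[k+1]≡[n+1]C[k+1])
open import Data.Nat.DivMod using (_/_; _%_; m<n⇒m%n≡m; n%n≡0; m%n<n; m/n*n≤m; m≡m%n+[m/n]*n)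
open import Data.Nat.Properties
open import Data.Nat.Tactic.RingSolver using (solve-∀)
open import Data.Product using (Σ; ∃; _×_; _,_; proj₁; proj₂)
open import Data.Product.Properties using () renaming (≡-dec to ×-≡-dec)
open import Data.Sum using (_⊎_; inj₁; inj₂; [_,_]′)
open import Data.Unit using (⊤; tt)
open import Data.Vec using ([]; _∷_; here; there)
import Data.Vec.Properties as VecP
open import Function using (_∘_; id; case_of_)
open import Function.Bundles using (Equivalence; mk⇔)
open import Induction.WellFounded using (Acc; acc)
open import Relation.Binary using (DecidableEquality)
import Relation.Binary.PropositionalEquality as ≡
open import Relation.Binary.PropositionalEquality using (_≡_; _≢_; refl; sym; trans; cong; cong₂; subst; subst₂)
open import Relation.Binary.Structures using (IsStrictPartialOrder)
open import Relation.Nullary using (¬_; Dec; yes; no; does)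
open import Relation.Nullary.Decidable using (¬?; _×-dec_; _⊎-dec_; _→-dec_; decidable-stable)
open import Relation.Unary using (Decidable)

-- Counting

-- Three constants are fixed in turn. The q of all kernels depends on k and t only and covers one
-- whole greedy cycle. Then a ratio M is chosen and codegrees up to dd = ⌊n/M⌋ are deleted. A
-- deletion reason is a centre with k - 2 vertices; a priori there are n^(k - 1) of these, but each
-- contains a triad (three kernels through the centre), and there are only O(n³) triads instead of
-- n⁴. So the cleaning loses O(n^(k - 1)/M) edges, and since every surviving centre carries more
-- than dd³ triads, the number of centres is bounded in terms of q and M. Only then is n taken
-- large. The obstacle is that homogeneity is one-sided: it certifies that the sets in J are kernels
-- and says nothing about the others. Every conclusion is therefore drawn from the covering property
-- of J. No colouring of the vertices is needed, because the position in the sorted edge plays that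
-- role. Exactness rests on powers: b vertices not joined to S cost order b·n^(k - 2) sets, while
-- edges with at most one joined vertex number O(n·b^(k - 2)), and b/n = O(1/M).

private
  variable
    A B : Set

∑ : (A → ℕ) → List A → ℕ
∑ f []       = 0
∑ f (x ∷ xs) = f x + ∑ f xs

∑-mono : ∀ {f g : A → ℕ} xs → (∀ {x} → x ∈ₗ xs → f x ≤ g x) → ∑ f xs ≤ ∑ g xs
∑-mono []       h = z≤n
∑-mono (x ∷ xs) h = +-mono-≤ (h (here refl)) (∑-mono xs (h ∘ there))

∑-const : ∀ c (xs : List A) → ∑ (λ _ → c) xs ≡ length xs * c
∑-const c []       = refl
∑-const c (x ∷ xs) = cong (c +_) (∑-const c xs)

∑-≤ : ∀ {f : A → ℕ} c xs → (∀ {x} → x ∈ₗ xs → f x ≤ c) → ∑ f xs ≤ length xs * c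
∑-≤ c xs h = ≤-trans (∑-mono xs h) (≤-reflexive (∑-const c xs))

∑-≥ : ∀ {f : A → ℕ} c xs → (∀ {x} → x ∈ₗ xs → c ≤ f x) → length xs * c ≤ ∑ f xs
∑-≥ c xs h = ≤-trans (≤-reflexive (sym (∑-const c xs))) (∑-mono xs h)

+-swap : ∀ a b c d → (a + b) + (c + d) ≡ (a + c) + (b + d)
+-swap a b c d = trans (+-assoc a b (c + d)) (trans (cong (a +_) (trans (sym (+-assoc b c d))
  (trans (cong (_+ d) (+-comm b c)) (+-assoc c b d)))) (sym (+-assoc a c (b + d))))

∑-+ : ∀ (f g : A → ℕ) xs → ∑ (λ x → f x + g x) xs ≡ ∑ f xs + ∑ g xs
∑-+ f g []       = refl
∑-+ f g (x ∷ xs) = trans (cong (f x + g x +_) (∑-+ f g xs)) (+-swap (f x) (g x) _ _)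

∑-* : ∀ c (f : A → ℕ) xs → ∑ (λ x → c * f x) xs ≡ c * ∑ f xs
∑-* c f []       = sym (*-zeroʳ c)
∑-* c f (x ∷ xs) = trans (cong (c * f x +_) (∑-* c f xs)) (sym (*-distribˡ-+ c (f x) _))

∑-swap : ∀ (f : A → B → ℕ) xs ys → ∑ (λ x → ∑ (f x) ys) xs ≡ ∑ (λ y → ∑ (λ x → f x y) xs) ys
∑-swap f []       ys = sym (trans (∑-const 0 ys) (*-zeroʳ (length ys)))
∑-swap f (x ∷ xs) ys = trans (cong (∑ (f x) ys +_) (∑-swap f xs ys)) (sym (∑-+ (f x) _ ys))

# : {P : A → Set} → Decidable P → List A → ℕ
# P? xs = length (filter P? xs)

ind : {P : Set} → Dec P → ℕ
ind d = if does d then 1 else 0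

#≡∑ : ∀ {P : A → Set} (P? : Decidable P) xs → # P? xs ≡ ∑ (λ x → ind (P? x)) xs
#≡∑ P? []       = refl
#≡∑ P? (x ∷ xs) with does (P? x)
... | true  = cong suc (#≡∑ P? xs)
... | false = #≡∑ P? xs

∑-ext : ∀ {f g : A → ℕ} xs → (∀ x → f x ≡ g x) → ∑ f xs ≡ ∑ g xs
∑-ext []       h = refl
∑-ext (x ∷ xs) h = cong₂ _+_ (h x) (∑-ext xs h)

#-swap : ∀ {Q : B → A → Set} (Q? : ∀ i x → Dec (Q i x)) xs is →
  ∑ (λ i → # (Q? i) xs) is ≡ ∑ (λ x → # (λ i → Q? i x) is) xs
#-swap Q? xs is = trans (∑-ext is (λ i → #≡∑ (Q? i) xs))
  (trans (∑-swap (λ i x → ind (Q? i x)) is xs) (∑-ext xs (λ x → sym (#≡∑ (λ i → Q? i x) is))))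

#-pos : ∀ {P : A → Set} (P? : Decidable P) {xs x} → x ∈ₗ xs → P x → 1 ≤ # P? xs
#-pos P? {xs} x∈ px with filter P? xs | ∈-filter⁺ P? x∈ px
... | _ ∷ _ | _ = s≤s z≤n

#-¬ : ∀ {P : A → Set} (P? : Decidable P) xs → length xs ≡ # P? xs + # (¬? ∘ P?) xs
#-¬ P? []       = refl
#-¬ P? (x ∷ xs) with does (P? x)
... | true  = cong suc (#-¬ P? xs)
... | false = trans (cong suc (#-¬ P? xs)) (sym (+-suc _ _))

union-bound : ∀ {Q : B → A → Set} (Q? : ∀ i x → Dec (Q i x)) xs is →
  (∀ {x} → x ∈ₗ xs → ∃ λ i → i ∈ₗ is × Q i x) → length xs ≤ ∑ (λ i → # (Q? i) xs) is
union-bound Q? xs is h = subst₂ _≤_ (*-identityʳ _) (sym (#-swap Q? xs is))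
  (∑-≥ 1 xs (λ x∈ → let (i , i∈ , q) = h x∈ in #-pos (λ i → Q? i _) i∈ q))

union-bound-const : ∀ {Q : B → A → Set} (Q? : ∀ i x → Dec (Q i x)) c xs is →
  (∀ {x} → x ∈ₗ xs → ∃ λ i → i ∈ₗ is × Q i x) →
  (∀ {i} → i ∈ₗ is → # (Q? i) xs ≤ c) → length xs ≤ length is * c
union-bound-const Q? c xs is h b = ≤-trans (union-bound Q? xs is h) (∑-≤ c is b)

all-equal⇒length≤1 : ∀ {xs : List A} → Unique xs → (∀ {x y} → x ∈ₗ xs → y ∈ₗ xs → x ≡ y) → length xs ≤ 1
all-equal⇒length≤1 {xs = []}         u h = z≤n
all-equal⇒length≤1 {xs = x ∷ []}     u h = s≤s z≤n
all-equal⇒length≤1 {xs = x ∷ y ∷ xs} ((x≢y ∷ _) ∷ _) h = ⊥-elim (x≢y (h (here refl) (there (here refl))))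

inj-length : DecidableEquality B → ∀ {xs : List A} {ys : List B} (f : A → B) → Unique xs →
  (∀ {x} → x ∈ₗ xs → f x ∈ₗ ys) →
  (∀ {x y} → x ∈ₗ xs → y ∈ₗ xs → f x ≡ f y → x ≡ y) → length xs ≤ length ys
inj-length _≟_ {xs} {ys} f u h inj = subst (length xs ≤_) (*-identityʳ _)
  (union-bound-const (λ y x → f x ≟ y) 1 xs ys (λ {x} x∈ → f x , h x∈ , refl)
    (λ {y} _ → all-equal⇒length≤1 (UniqueP.filter⁺ (λ x → f x ≟ y) u) (λ p q →
      let (p∈ , ep) = ∈-filter⁻ (λ x → f x ≟ y) p ; (q∈ , eq) = ∈-filter⁻ (λ x → f x ≟ y) q
      in inj p∈ q∈ (trans ep (sym eq)))))

unique-⊆-length : DecidableEquality A → ∀ {xs ys : List A} → Unique xs →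
  (∀ {x} → x ∈ₗ xs → x ∈ₗ ys) → length xs ≤ length ys
unique-⊆-length _≟_ u h = inj-length _≟_ id u h (λ _ _ → id)

-- Pigeonhole in the form used for picking new vertices: the injective image of a list longer than
-- `Z` cannot lie inside `Z`.
fresh-pick : DecidableEquality B → ∀ {xs : List A} (Z : List B) (f : A → B) → Unique xs →
  (∀ {x y} → x ∈ₗ xs → y ∈ₗ xs → f x ≡ f y → x ≡ y) →
  length Z < length xs → ∃ λ x → x ∈ₗ xs × f x ∉ₗ Z
fresh-pick _≟_ {xs} Z f u inj lt with any? (λ x → ¬? (DecM._∈?_ _≟_ (f x) Z)) xs
... | yes p = let (x , x∈ , q) = find p in x , x∈ , q
... | no ¬p = ⊥-elim (<⇒≱ lt (inj-length _≟_ f u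
      (λ {x} x∈ → decidable-stable (DecM._∈?_ _≟_ (f x) Z) (λ q → ¬p (lose x∈ q))) inj))

#-mono : ∀ {P Q : A → Set} (P? : Decidable P) (Q? : Decidable Q) xs →
  (∀ {x} → x ∈ₗ xs → P x → Q x) → # P? xs ≤ # Q? xs
#-mono P? Q? []       h = z≤n
#-mono P? Q? (x ∷ xs) h with P? x | Q? x | #-mono P? Q? xs (h ∘ there)
... | yes p | yes q | r = s≤s r
... | yes p | no ¬q | r = ⊥-elim (¬q (h (here refl) p))
... | no ¬p | yes q | r = m≤n⇒m≤1+n r
... | no ¬p | no ¬q | r = r

#-∪ : ∀ {P Q R : A → Set} (P? : Decidable P) (Q? : Decidable Q) (R? : Decidable R) xs →
  (∀ {x} → x ∈ₗ xs → P x → Q x ⊎ R x) → # P? xs ≤ # Q? xs + # R? xs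
#-∪ P? Q? R? [] h = z≤n
#-∪ P? Q? R? (x ∷ xs) h with P? x | Q? x | R? x | #-∪ P? Q? R? xs (h ∘ there)
... | yes p | yes q | yes r | s = s≤s (≤-trans s (+-monoʳ-≤ _ (n≤1+n _)))
... | yes p | yes q | no  r | s = s≤s s
... | yes p | no  q | yes r | s = ≤-trans (s≤s s) (≤-reflexive (sym (+-suc _ _)))
... | yes p | no  q | no  r | s = ⊥-elim ([ q , r ]′ (h (here refl) p))
... | no  p | yes q | yes r | s = m≤n⇒m≤1+n (≤-trans s (+-monoʳ-≤ _ (n≤1+n _)))
... | no  p | yes q | no  r | s = m≤n⇒m≤1+n s
... | no  p | no  q | yes r | s = ≤-trans s (+-monoʳ-≤ _ (n≤1+n _))
... | no  p | no  q | no  r | s = s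

#-map : ∀ {P : B → Set} (P? : Decidable P) (f : A → B) xs → # P? (map f xs) ≡ # (P? ∘ f) xs
#-map P? f []       = refl
#-map P? f (x ∷ xs) with does (P? (f x))
... | true  = cong suc (#-map P? f xs)
... | false = #-map P? f xs

#-++ : ∀ {P : A → Set} (P? : Decidable P) xs ys → # P? (xs ++ ys) ≡ # P? xs + # P? ys
#-++ P? xs ys = trans (cong length (filter-++ P? xs ys)) (length-++ (filter P? xs))

#-filter-≤ : ∀ {P Q : A → Set} (P? : Decidable P) (Q? : Decidable Q) L → # P? (filter Q? L) ≤ # P? L
#-filter-≤ P? Q? [] = z≤n
#-filter-≤ P? Q? (x ∷ L) with does (Q? x)
... | true  with does (P? x)
...   | true  = s≤s (#-filter-≤ P? Q? L)
...   | false = #-filter-≤ P? Q? L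
#-filter-≤ P? Q? (x ∷ L) | false with does (P? x)
...   | true  = m≤n⇒m≤1+n (#-filter-≤ P? Q? L)
...   | false = #-filter-≤ P? Q? L

average : ∀ (f : A → ℕ) x xs → ∃ λ y → y ∈ₗ (x ∷ xs) × length (x ∷ xs) * f y ≤ ∑ f (x ∷ xs)
average f x [] = x , here refl , ≤-refl
average f x (x′ ∷ xs) with average f x′ xs
... | y , y∈ , h with ≤-total (f x) (f y)
... | inj₁ le = x , here refl , +-monoʳ-≤ (f x) (≤-trans (*-monoʳ-≤ (length (x′ ∷ xs)) le) h)
... | inj₂ le = y , there y∈ , +-mono-≤ le h

-- Tuples over a finite list

length-cpw : ∀ {C : Set} (f : A → B → C) xs ys → length (cartesianProductWith f xs ys) ≡ length xs * length ys
length-cpw f []       ys = refl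
length-cpw f (x ∷ xs) ys = trans (length-++ (map (f x) ys))
  (cong₂ _+_ (length-map (f x) ys) (length-cpw f xs ys))

#-cpw : ∀ {C : Set} {P : C → Set} (P? : Decidable P) (f : A → B → C) xs ys →
  # P? (cartesianProductWith f xs ys) ≡ ∑ (λ x → # (λ y → P? (f x y)) ys) xs
#-cpw P? f []       ys = refl
#-cpw P? f (x ∷ xs) ys = trans (#-++ P? (map (f x) ys) _) (cong₂ _+_ (#-map P? (f x) ys) (#-cpw P? f xs ys))

tuples : List A → ℕ → List (List A)
tuples xs zero    = [] ∷ []
tuples xs (suc m) = cartesianProductWith _∷_ xs (tuples xs m)

length-tuples : ∀ (xs : List A) m → length (tuples xs m) ≡ length xs ^ m
length-tuples xs zero    = refl
length-tuples xs (suc m) = trans (length-cpw _∷_ xs (tuples xs m)) (cong (length xs *_) (length-tuples xs m))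

∈-tuples : ∀ {xs : List A} w → (∀ {x} → x ∈ₗ w → x ∈ₗ xs) → w ∈ₗ tuples xs (length w)
∈-tuples []      h = here refl
∈-tuples (x ∷ w) h = ∈-cartesianProductWith⁺ _∷_ (h (here refl)) (∈-tuples w (h ∘ there))

tuples-length : ∀ {xs : List A} m {w} → w ∈ₗ tuples xs m → length w ≡ m
tuples-length zero (here refl) = refl
tuples-length {xs = xs} (suc m) w∈
  with _ , _ , _ , w∈′ , refl ← ∈-cartesianProductWith⁻ _∷_ xs (tuples xs m) w∈ = cong suc (tuples-length m w∈′)

tuples-⊆ : ∀ {xs : List A} m {w} → w ∈ₗ tuples xs m → ∀ {x} → x ∈ₗ w → x ∈ₗ xs
tuples-⊆ zero (here refl) ()
tuples-⊆ {xs = xs} (suc m) w∈ x∈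
  with _ , _ , y∈ , w∈′ , refl ← ∈-cartesianProductWith⁻ _∷_ xs (tuples xs m) w∈ | x∈
... | here refl = y∈
... | there x∈′ = tuples-⊆ m w∈′ x∈′

∷-injective′ : ∀ {w x : A} {y z : List A} → w ∷ y ≡ x ∷ z → w ≡ x × y ≡ z
∷-injective′ refl = refl , refl

tuples-unique : ∀ {xs : List A} m → Unique xs → Unique (tuples xs m)
tuples-unique zero    u = [] ∷ []
tuples-unique (suc m) u = UniqueP.cartesianProductWith⁺ _∷_ ∷-injective′ u (tuples-unique m u)

length-allFin : ∀ n → length (allFin n) ≡ n
length-allFin n = length-tabulate id

-- Repeatedly deleting all items that carry a reason shared by at most d of the remaining items
-- loses at most d items per reason.
module Cleaning {I R : Set} {Rsn : R → I → Set} (Rsn? : ∀ r x → Dec (Rsn r x)) (d : ℕ) where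

  Full : List R → List I → Set
  Full rs F = ∀ {x r} → x ∈ₗ F → r ∈ₗ rs → Rsn r x → d < # (Rsn? r) F

  private
    live? : ∀ L r → Dec (1 ≤ # (Rsn? r) L)
    live? L r = 1 ≤? # (Rsn? r) L

    #-strict : ∀ {P Q : R → Set} (P? : Decidable P) (Q? : Decidable Q) rs → (∀ {x} → P x → Q x) →
      ∀ {r} → r ∈ₗ rs → ¬ P r → Q r → # P? rs < # Q? rs
    #-strict P? Q? (x ∷ rs) h (here refl) ¬p q with P? x | Q? x
    ... | yes p | _     = ⊥-elim (¬p p)
    ... | no _  | no ¬q = ⊥-elim (¬q q)
    ... | no _  | yes _ = s≤s (#-mono P? Q? rs (λ _ → h))
    #-strict P? Q? (x ∷ rs) h (there r∈) ¬p q with P? x | Q? x | #-strict P? Q? rs h r∈ ¬p q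
    ... | yes p | yes _ | s = s≤s s
    ... | yes p | no ¬q | s = ⊥-elim (¬q (h p))
    ... | no _  | yes _ | s = m≤n⇒m≤1+n s
    ... | no _  | no _  | s = s

    -- `m` bounds the number of reasons still carried by some item. Deleting the items with reason
    -- `r` kills `r` and revives no other reason, so each reason is charged once.
    go : ∀ m rs L → # (live? L) rs ≤ m → Unique L →
      ∃ λ F → (∀ {x} → x ∈ₗ F → x ∈ₗ L) × Unique F × Full rs F × length L ≤ m * d + length F
    go m rs L b u with any? (λ r → (1 ≤? # (Rsn? r) L) ×-dec (# (Rsn? r) L ≤? d)) rs
    ... | no ¬p = L , id , u , (λ {x} {r} x∈ r∈ ρ → ≰⇒> (λ le → ¬p (lose r∈ (#-pos (Rsn? r) x∈ ρ , le)))) , m≤n+m _ _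
    ... | yes p with find p
    ... | r , r∈ , lv , le = step m b
      where
      L′ = filter (¬? ∘ Rsn? r) L
      empty : ¬ (1 ≤ # (Rsn? r) L′)
      empty h with filter (Rsn? r) L′ | (λ {x} → ∈-filter⁻ (Rsn? r) {x} {L′})
      empty () | [] | _
      empty h  | x ∷ _ | f = let (x∈ , ρ) = f (here refl) in proj₂ (∈-filter⁻ (¬? ∘ Rsn? r) {x} {L} x∈) ρ
      dec : # (live? L′) rs < # (live? L) rs
      dec = #-strict (live? L′) (live? L) rs (λ {s} h → ≤-trans h (#-filter-≤ (Rsn? s) (¬? ∘ Rsn? r) L)) r∈ empty lv
      step : ∀ m → # (live? L) rs ≤ m →
        ∃ λ F → (∀ {x} → x ∈ₗ F → x ∈ₗ L) × Unique F × Full rs F × length L ≤ m * d + length F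
      step zero    b = ⊥-elim (<⇒≱ dec (≤-trans b z≤n))
      step (suc m) b with go m rs L′ (≤-pred (≤-trans dec b)) (UniqueP.filter⁺ (¬? ∘ Rsn? r) u)
      ... | F , sub , uF , full , len = F , (λ x∈ → proj₁ (∈-filter⁻ (¬? ∘ Rsn? r) {xs = L} (sub x∈))) , uF , full ,
        ≤-trans (≤-reflexive (#-¬ (Rsn? r) L)) (≤-trans (+-mono-≤ le len) (≤-reflexive (sym (+-assoc d (m * d) (length F)))))

  clean : ∀ rs L → Unique L →
    ∃ λ F → (∀ {x} → x ∈ₗ F → x ∈ₗ L) × Unique F × Full rs F × length L ≤ length rs * d + length F
  clean rs L u = go (length rs) rs L (length-filter (live? L) rs) u

-- Finite sets of vertices

_≟S_ : ∀ {n} → DecidableEquality (Subset n)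
_≟S_ = VecP.≡-dec _≟B_

elems : ∀ {n} → Subset n → List (Fin n)
elems []            = []
elems (inside ∷ e)  = zero ∷ map suc (elems e)
elems (outside ∷ e) = map suc (elems e)

∈-elems⁺ : ∀ {n} {x : Fin n} {e} → x ∈ e → x ∈ₗ elems e
∈-elems⁺ {e = inside ∷ e}  here       = here refl
∈-elems⁺ {e = inside ∷ e}  (there x∈) = there (∈-map⁺ suc (∈-elems⁺ x∈))
∈-elems⁺ {e = outside ∷ e} (there x∈) = ∈-map⁺ suc (∈-elems⁺ x∈)

∈-elems⁻ : ∀ {n} {x : Fin n} {e} → x ∈ₗ elems e → x ∈ e
∈-elems⁻ {e = inside ∷ e} (here refl) = here
∈-elems⁻ {e = inside ∷ e} (there x∈) with _ , y∈ , refl ← ∈-map⁻ suc x∈ = there (∈-elems⁻ y∈)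
∈-elems⁻ {e = outside ∷ e} x∈ with _ , y∈ , refl ← ∈-map⁻ suc x∈ = there (∈-elems⁻ y∈)

elems-unique : ∀ {n} (e : Subset n) → Unique (elems e)
elems-unique [] = []
elems-unique (inside ∷ e) = All.tabulate (λ { x∈ refl → case ∈-map⁻ suc x∈ of λ () }) ∷ UniqueP.map⁺ FinP.suc-injective (elems-unique e)
elems-unique (outside ∷ e) = UniqueP.map⁺ FinP.suc-injective (elems-unique e)

length-elems : ∀ {n} (e : Subset n) → length (elems e) ≡ ∣ e ∣
length-elems [] = refl
length-elems (inside ∷ e)  = cong suc (trans (length-map suc (elems e)) (length-elems e))
length-elems (outside ∷ e) = trans (length-map suc (elems e)) (length-elems e)

elems-injective : ∀ {n} {f g : Subset n} → elems f ≡ elems g → f ≡ g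
elems-injective {f = f} {g} eq = ⊆-antisym (λ x∈ → ∈-elems⁻ (subst (_ ∈ₗ_) eq (∈-elems⁺ x∈)))
  (λ x∈ → ∈-elems⁻ (subst (_ ∈ₗ_) (sym eq) (∈-elems⁺ x∈)))

fromList : ∀ {n} → List (Fin n) → Subset n
fromList []      = ∅
fromList (x ∷ w) = ⁅ x ⁆ ∪ fromList w

∈-fromList⁺ : ∀ {n} {x : Fin n} {w} → x ∈ₗ w → x ∈ fromList w
∈-fromList⁺ {w = y ∷ w} (here refl) = x∈p∪q⁺ (inj₁ (x∈⁅x⁆ y))
∈-fromList⁺ (there x∈)  = x∈p∪q⁺ (inj₂ (∈-fromList⁺ x∈))

∈-fromList⁻ : ∀ {n} {x : Fin n} w → x ∈ fromList w → x ∈ₗ w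
∈-fromList⁻ []      x∈ = ⊥-elim (∉⊥ x∈)
∈-fromList⁻ (y ∷ w) x∈ with x∈p∪q⁻ ⁅ y ⁆ (fromList w) x∈
... | inj₁ h = here (x∈⁅y⁆⇒x≡y y h)
... | inj₂ h = there (∈-fromList⁻ w h)

∣fromList∣ : ∀ {n} {w : List (Fin n)} → Unique w → ∣ fromList w ∣ ≡ length w
∣fromList∣ {w = w} u = trans (sym (length-elems (fromList w))) (≤-antisym
  (unique-⊆-length FinP._≟_ (elems-unique (fromList w)) (∈-fromList⁻ w ∘ ∈-elems⁻ {e = fromList w}))
  (unique-⊆-length FinP._≟_ u (∈-elems⁺ ∘ ∈-fromList⁺)))

⊆∧∣∣⇒≡ : ∀ {n} {e f : Subset n} → (∀ {x} → x ∈ e → x ∈ f) → ∣ f ∣ ≤ ∣ e ∣ → e ≡ f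
⊆∧∣∣⇒≡ {e = e} {f} sub le = ⊆-antisym sub (λ {x} x∈ → decidable-stable (x ∈? e)
  (λ x∉ → <⇒≱ (p⊂q⇒∣p∣<∣q∣ (sub , x , x∈ , x∉)) le))

Unique-⊆-elems : ∀ {n} {w : List (Fin n)} {e} → Unique w → (∀ {x} → x ∈ₗ w → x ∈ e) → length w ≤ ∣ e ∣
Unique-⊆-elems {e = e} u sub = subst (_ ≤_) (length-elems e) (unique-⊆-length FinP._≟_ u (∈-elems⁺ ∘ sub))

Unique-⊇-elems : ∀ {n} {w : List (Fin n)} {e} → Unique w → (∀ {x} → x ∈ₗ w → x ∈ e) → ∣ e ∣ ≤ length w →
  ∀ {x} → x ∈ e → x ∈ₗ w
Unique-⊇-elems {w = w} {e} u sub le x∈ = ∈-fromList⁻ w (subst (_ ∈_)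
  (sym (⊆∧∣∣⇒≡ (sub ∘ ∈-fromList⁻ w) (subst (∣ e ∣ ≤_) (sym (∣fromList∣ u)) le))) x∈)

Meets? : ∀ {n} (e S : Subset n) → Dec (Meets e S)
Meets? e S = FinP.any? (λ x → (x ∈? e) ×-dec (x ∈? S))

ksubsets : ∀ n → ℕ → List (Subset n)
ksubsets n       zero    = ∅ ∷ []
ksubsets zero    (suc k) = []
ksubsets (suc n) (suc k) = map (inside ∷_) (ksubsets n k) ++ map (outside ∷_) (ksubsets n (suc k))

∣∣≡0⇒∅ : ∀ {n} (e : Subset n) → ∣ e ∣ ≡ 0 → e ≡ ∅
∣∣≡0⇒∅ []            _ = refl
∣∣≡0⇒∅ (outside ∷ e) h = cong (outside ∷_) (∣∣≡0⇒∅ e h)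

∈-ksubsets⁺ : ∀ {n} k {e : Subset n} → ∣ e ∣ ≡ k → e ∈ₗ ksubsets n k
∈-ksubsets⁺ zero {e} h = here (∣∣≡0⇒∅ e h)
∈-ksubsets⁺ (suc k) {inside ∷ e}  h = ∈-++⁺ˡ (∈-map⁺ _ (∈-ksubsets⁺ k (suc-injective h)))
∈-ksubsets⁺ {suc n} (suc k) {outside ∷ e} h = ∈-++⁺ʳ (map (inside ∷_) (ksubsets n k)) (∈-map⁺ _ (∈-ksubsets⁺ (suc k) h))

∈-ksubsets⁻ : ∀ {n} k {e : Subset n} → e ∈ₗ ksubsets n k → ∣ e ∣ ≡ k
∈-ksubsets⁻ {n} zero (here refl) = ∣⊥∣≡0 n
∈-ksubsets⁻ {suc n} (suc k) e∈ with ∈-++⁻ (map (inside ∷_) (ksubsets n k)) e∈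
... | inj₁ h with _ , f∈ , refl ← ∈-map⁻ (inside ∷_) h = cong suc (∈-ksubsets⁻ k f∈)
... | inj₂ h with _ , f∈ , refl ← ∈-map⁻ (outside ∷_) h = ∈-ksubsets⁻ (suc k) f∈

ksubsets-unique : ∀ n k → Unique (ksubsets n k)
ksubsets-unique n       zero    = [] ∷ []
ksubsets-unique zero    (suc k) = []
ksubsets-unique (suc n) (suc k) = UniqueP.++⁺
  (UniqueP.map⁺ VecP.∷-injectiveʳ (ksubsets-unique n k))
  (UniqueP.map⁺ VecP.∷-injectiveʳ (ksubsets-unique n (suc k)))
  (λ (p , q) → case ∈-map⁻ (inside ∷_) p of λ { (_ , _ , refl) → case ∈-map⁻ (outside ∷_) q of λ () })

length-ksubsets : ∀ n k → length (ksubsets n k) ≡ n C k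
length-ksubsets n       zero    = refl
length-ksubsets zero    (suc k) = refl
length-ksubsets (suc n) (suc k) = trans (length-++ (map (inside ∷_) (ksubsets n k)))
  (trans (cong₂ _+_ (trans (length-map _ (ksubsets n k)) (length-ksubsets n k))
                    (trans (length-map _ (ksubsets n (suc k))) (length-ksubsets n (suc k))))
         (nCk+nC[k+1]≡[n+1]C[k+1] n k))

#-cong : ∀ {A : Set} {P Q : A → Set} (P? : Decidable P) (Q? : Decidable Q) xs →
  (∀ {x} → P x → Q x) → (∀ {x} → Q x → P x) → # P? xs ≡ # Q? xs
#-cong P? Q? xs f g = ≤-antisym (#-mono P? Q? xs (λ _ → f)) (#-mono Q? P? xs (λ _ → g))

#-none : ∀ {A : Set} {P : A → Set} (P? : Decidable P) xs → (∀ {x} → x ∈ₗ xs → ¬ P x) → # P? xs ≡ 0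
#-none P? []       h = refl
#-none P? (x ∷ xs) h with P? x
... | yes p = ⊥-elim (h (here refl) p)
... | no _  = #-none P? xs (h ∘ there)

#-avoiding : ∀ {n} k (S : Subset n) → # (λ e → ¬? (Meets? e S)) (ksubsets n k) ≡ (n ∸ ∣ S ∣) C k
#-avoiding zero S with Meets? ∅ S
... | yes (x , x∈ , _) = ⊥-elim (∉⊥ x∈)
... | no _ = refl
#-avoiding {zero} (suc k) [] = refl
#-avoiding {suc n} (suc k) (s ∷ S) =
  trans (#-++ _ (map (inside ∷_) (ksubsets n k)) _)
  (trans (cong₂ _+_ (#-map _ (inside ∷_) (ksubsets n k)) (#-map _ (outside ∷_) (ksubsets n (suc k)))) (go s))
  where
  out : ∀ s → # (λ e → ¬? (Meets? (outside ∷ e) (s ∷ S))) (ksubsets n (suc k)) ≡ (n ∸ ∣ S ∣) C suc k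
  out s = trans (#-cong _ (λ e → ¬? (Meets? e S)) (ksubsets n (suc k))
    (λ h (x , p , q) → h (suc x , there p , there q))
    (λ { h (suc x , there p , there q) → h (x , p , q) })) (#-avoiding (suc k) S)
  go : ∀ s → # (λ e → ¬? (Meets? (inside ∷ e) (s ∷ S))) (ksubsets n k)
    + # (λ e → ¬? (Meets? (outside ∷ e) (s ∷ S))) (ksubsets n (suc k)) ≡ (suc n ∸ ∣ s ∷ S ∣) C suc k
  go inside  = cong₂ _+_ (#-none _ (ksubsets n k) (λ _ h → h (zero , here , here))) (out inside)
  go outside = trans (cong₂ _+_ (trans (#-cong _ (λ e → ¬? (Meets? e S)) (ksubsets n k)
      (λ h (x , p , q) → h (suc x , there p , there q))
      (λ { h (suc x , there p , there q) → h (x , p , q) })) (#-avoiding k S)) (out outside))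
    (trans (nCk+nC[k+1]≡[n+1]C[k+1] (n ∸ ∣ S ∣) k) (cong (_C suc k) (sym (+-∸-assoc 1 (∣p∣≤n S)))))

#-meeting : ∀ {n} k (S : Subset n) → # (λ e → Meets? e S) (ksubsets n k) ≡ n C k ∸ (n ∸ ∣ S ∣) C k
#-meeting {n} k S = trans (sym (m+n∸n≡m (# (λ e → Meets? e S) (ksubsets n k)) (# (λ e → ¬? (Meets? e S)) (ksubsets n k)))) (cong₂ _∸_
  (trans (sym (#-¬ (λ e → Meets? e S) (ksubsets n k))) (length-ksubsets n k)) (#-avoiding k S))

-- Bounds for binomial coefficients

C-mono-suc : ∀ m j → m C j ≤ suc m C j
C-mono-suc m zero    = ≤-refl
C-mono-suc m (suc j) = subst (m C suc j ≤_) (nCk+nC[k+1]≡[n+1]C[k+1] m j) (m≤n+m _ _)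

C≤^ : ∀ m j → m C j ≤ m ^ j
C≤^ m       zero    = ≤-refl
C≤^ zero    (suc j) = z≤n
C≤^ (suc m) (suc j) = begin
  suc m C suc j       ≡⟨ nCk+nC[k+1]≡[n+1]C[k+1] m j ⟨
  m C j + m C suc j   ≤⟨ +-mono-≤ (C≤^ m j) (C≤^ m (suc j)) ⟩
  suc m * m ^ j       ≤⟨ *-monoʳ-≤ (suc m) (^-monoˡ-≤ j (n≤1+n m)) ⟩
  suc m * suc m ^ j   ∎
  where open ≤-Reasoning

-- Pascal's rule applied t times. With m = n - t it shows that at least t·C(n - t, k - 1) of the
-- k-sets meet a t-set, the edge density on which the stability argument runs.
C-lower : ∀ t m j → t * (m C j) + m C suc j ≤ (t + m) C suc j
C-lower zero    m j = ≤-refl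
C-lower (suc t) m j = begin
  m C j + t * (m C j) + m C suc j         ≡⟨ cong (_+ m C suc j) (+-comm (m C j) _) ⟩
  t * (m C j) + m C j + m C suc j         ≡⟨ +-assoc (t * (m C j)) _ _ ⟩
  t * (m C j) + (m C j + m C suc j)       ≡⟨ cong (t * (m C j) +_) (nCk+nC[k+1]≡[n+1]C[k+1] m j) ⟩
  t * (m C j) + suc m C suc j             ≤⟨ +-monoˡ-≤ _ (*-monoʳ-≤ t (C-mono-suc m j)) ⟩
  t * (suc m C j) + suc m C suc j         ≤⟨ C-lower t (suc m) j ⟩
  (t + suc m) C suc j                     ≡⟨ cong (_C suc j) (+-suc t m) ⟩
  suc (t + m) C suc j                     ∎
  where open ≤-Reasoning

-- Pascal's rule again, each summand bounded by the largest power. It makes C(n, k - 1) and C(n - t,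
-- k - 1) differ only in lower order.
C-upper : ∀ t m j → (t + m) C suc j ≤ m C suc j + t * (t + m) ^ j
C-upper zero    m j = ≤-reflexive (sym (+-identityʳ _))
C-upper (suc t) m j = begin
  suc (t + m) C suc j                                   ≡⟨ nCk+nC[k+1]≡[n+1]C[k+1] (t + m) j ⟨
  (t + m) C j + (t + m) C suc j                         ≤⟨ +-mono-≤ (≤-trans (C≤^ (t + m) j) up) (C-upper t m j) ⟩
  suc (t + m) ^ j + (m C suc j + t * (t + m) ^ j)       ≤⟨ +-monoʳ-≤ (suc (t + m) ^ j) (+-monoʳ-≤ (m C suc j) (*-monoʳ-≤ t up)) ⟩
  suc (t + m) ^ j + (m C suc j + t * suc (t + m) ^ j)   ≡⟨ +-comm (suc (t + m) ^ j) _ ⟩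
  m C suc j + t * suc (t + m) ^ j + suc (t + m) ^ j     ≡⟨ +-assoc (m C suc j) _ _ ⟩
  m C suc j + (t * suc (t + m) ^ j + suc (t + m) ^ j)   ≡⟨ cong (m C suc j +_) (+-comm (t * suc (t + m) ^ j) _) ⟩
  m C suc j + suc t * suc (t + m) ^ j                   ∎
  where
  open ≤-Reasoning
  up : (t + m) ^ j ≤ suc (t + m) ^ j
  up = ^-monoˡ-≤ j (n≤1+n (t + m))

-- Tuples of vertices

module _ {n : ℕ} where

  _∈ₗ?_ : ∀ (x : Fin n) w → Dec (x ∈ₗ w)
  _∈ₗ?_ = DecM._∈?_ FinP._≟_

  rest : Subset n → List (Fin n) → List (Fin n)
  rest e r = filter (λ z → ¬? (z ∈ₗ? r)) (elems e)

  rest-unique : ∀ e r → Unique (rest e r)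
  rest-unique e r = UniqueP.filter⁺ (λ z → ¬? (z ∈ₗ? r)) (elems-unique e)

  ∈-rest⁺ : ∀ {e r z} → z ∈ e → z ∉ₗ r → z ∈ₗ rest e r
  ∈-rest⁺ {r = r} z∈ z∉ = ∈-filter⁺ (λ z → ¬? (z ∈ₗ? r)) (∈-elems⁺ z∈) z∉

  ∈-rest⁻ : ∀ e r {z} → z ∈ₗ rest e r → z ∈ e × z ∉ₗ r
  ∈-rest⁻ e r z∈ = let (p , z∉) = ∈-filter⁻ (λ z → ¬? (z ∈ₗ? r)) {xs = elems e} z∈ in ∈-elems⁻ p , z∉

  length-rest : ∀ e {r} → Unique r → All (_∈ e) r → length r + length (rest e r) ≡ ∣ e ∣
  length-rest e {r} ur sub = trans (cong (_+ length (rest e r)) (≤-antisym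
      (unique-⊆-length FinP._≟_ ur (λ z∈ → ∈-filter⁺ (_∈ₗ? r) (∈-elems⁺ (All.lookup sub z∈)) z∈))
      (unique-⊆-length FinP._≟_ (UniqueP.filter⁺ (_∈ₗ? r) (elems-unique e)) (λ z∈ → proj₂ (∈-filter⁻ (_∈ₗ? r) {xs = elems e} z∈)))))
    (trans (sym (#-¬ (_∈ₗ? r) (elems e))) (length-elems e))

  vtuples : ℕ → List (List (Fin n))
  vtuples = tuples (allFin n)

  length-vtuples : ∀ m → length (vtuples m) ≡ n ^ m
  length-vtuples m = trans (length-tuples (allFin n) m) (cong (_^ m) (length-allFin n))

  vtuples-unique : ∀ m → Unique (vtuples m)
  vtuples-unique m = tuples-unique m (UniqueP.allFin⁺ n)

  ∈-vtuples : ∀ w → w ∈ₗ vtuples (length w)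
  ∈-vtuples w = ∈-tuples w (λ _ → ∈-allFin _)

  -- Each entry joins `Z` for the rest of the word, so one condition expresses both avoiding `Z` and
  -- having distinct entries.
  Fresh : List (Fin n) → List (Fin n) → Set
  Fresh Z []      = ⊤
  Fresh Z (x ∷ w) = x ∉ₗ Z × Fresh (x ∷ Z) w

  fresh? : ∀ Z w → Dec (Fresh Z w)
  fresh? Z []      = yes tt
  fresh? Z (x ∷ w) = ¬? (x ∈ₗ? Z) ×-dec fresh? (x ∷ Z) w

  fresh⇒∉ : ∀ {Z} w → Fresh Z w → ∀ {x} → x ∈ₗ w → x ∉ₗ Z
  fresh⇒∉ (y ∷ w) (y∉ , f) (here refl) = y∉
  fresh⇒∉ (y ∷ w) (y∉ , f) (there x∈)  = fresh⇒∉ w f x∈ ∘ there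

  fresh⇒unique : ∀ {Z} w → Fresh Z w → Unique w
  fresh⇒unique []      _       = []
  fresh⇒unique (y ∷ w) (_ , f) = All.tabulate (λ { x∈ refl → fresh⇒∉ w f x∈ (here refl) }) ∷ fresh⇒unique w f

  #-nonfresh : ∀ Z m → n * # (λ w → ¬? (fresh? Z w)) (vtuples m) ≤ m * (length Z + m) * n ^ m
  #-nonfresh Z zero = ≤-reflexive (*-zeroʳ n)
  #-nonfresh Z (suc m) = begin
    n * # (λ w → ¬? (fresh? Z w)) (vtuples (suc m))
      ≡⟨ cong (n *_) (#-cpw _ _∷_ (allFin n) (vtuples m)) ⟩
    n * ∑ (λ x → # (λ w → ¬? (fresh? Z (x ∷ w))) (vtuples m)) (allFin n)
      ≡⟨ ∑-* n _ (allFin n) ⟨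
    ∑ (λ x → n * # (λ w → ¬? (fresh? Z (x ∷ w))) (vtuples m)) (allFin n)
      ≤⟨ ∑-mono (allFin n) (λ {x} _ → bound x) ⟩
    ∑ (λ x → n ^ suc m * ind (x ∈ₗ? Z) + m * (suc (length Z) + m) * n ^ m) (allFin n)
      ≡⟨ ∑-+ _ _ (allFin n) ⟩
    ∑ (λ x → n ^ suc m * ind (x ∈ₗ? Z)) (allFin n) + ∑ (λ _ → m * (suc (length Z) + m) * n ^ m) (allFin n)
      ≡⟨ cong₂ _+_ (trans (∑-* (n ^ suc m) _ (allFin n)) (cong (n ^ suc m *_) (sym (#≡∑ (_∈ₗ? Z) (allFin n)))))
           (trans (∑-const _ (allFin n)) (cong (_* (m * (suc (length Z) + m) * n ^ m)) (length-allFin n))) ⟩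
    n ^ suc m * # (_∈ₗ? Z) (allFin n) + n * (m * (suc (length Z) + m) * n ^ m)
      ≤⟨ +-monoˡ-≤ _ (*-monoʳ-≤ (n ^ suc m) (unique-⊆-length FinP._≟_ (UniqueP.filter⁺ (_∈ₗ? Z) (UniqueP.allFin⁺ n))
           (λ x∈ → proj₂ (∈-filter⁻ (_∈ₗ? Z) {xs = allFin n} x∈)))) ⟩
    n ^ suc m * length Z + n * (m * (suc (length Z) + m) * n ^ m)
      ≡⟨ cong₂ _+_ (*-comm (n ^ suc m) (length Z)) (trans (*-comm n _) (trans (*-assoc (m * (suc (length Z) + m)) (n ^ m) n)
            (cong (m * (suc (length Z) + m) *_) (*-comm (n ^ m) n)))) ⟩
    length Z * n ^ suc m + m * (suc (length Z) + m) * n ^ suc m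
      ≡⟨ *-distribʳ-+ (n ^ suc m) (length Z) _ ⟨
    (length Z + m * (suc (length Z) + m)) * n ^ suc m
      ≤⟨ *-monoˡ-≤ (n ^ suc m) (+-mono-≤ (m≤m+n (length Z) (suc m))
           (*-monoʳ-≤ m (≤-reflexive (sym (+-suc (length Z) m))))) ⟩
    suc m * (length Z + suc m) * n ^ suc m ∎
    where
    open ≤-Reasoning
    -- A first entry in `Z` spoils all n^m continuations; any other first entry must be continued by
    -- a word that is not fresh for `x ∷ Z`. The factor n avoids an exponent m - 1.
    bound : ∀ x → n * # (λ w → ¬? (fresh? Z (x ∷ w))) (vtuples m)
      ≤ n ^ suc m * ind (x ∈ₗ? Z) + m * (suc (length Z) + m) * n ^ m
    bound x with x ∈ₗ? Z
    ... | yes x∈ = ≤-trans (*-monoʳ-≤ n (≤-trans (length-filter _ (vtuples m)) (≤-reflexive (length-vtuples m))))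
                     (≤-trans (≤-reflexive (sym (*-identityʳ (n ^ suc m)))) (m≤m+n _ _))
    ... | no x∉ = ≤-trans (*-monoʳ-≤ n (#-mono _ (λ w → ¬? (fresh? (x ∷ Z) w)) (vtuples m) (λ _ h f → h (x∉ , f))))
                     (≤-trans (#-nonfresh (x ∷ Z) m) (m≤n+m _ _))

  #-tuples-within : ∀ {P : List (Fin n) → Set} (P? : Decidable P) K m fs → (∀ {f} → f ∈ₗ fs → ∣ f ∣ ≤ K) →
    (∀ {w} → w ∈ₗ vtuples m → P w → ∃ λ f → f ∈ₗ fs × All (_∈ f) w) →
    # P? (vtuples m) ≤ length fs * K ^ m
  #-tuples-within P? K m fs hK h = union-bound-const (λ f w → all? (_∈? f) w) (K ^ m) (filter P? (vtuples m)) fs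
    (λ w∈ → let (w∈′ , p) = ∈-filter⁻ P? {xs = vtuples m} w∈ in h w∈′ p)
    (λ {f} f∈ → ≤-trans (unique-⊆-length (λ u v → ListP.≡-dec FinP._≟_ u v)
        (UniqueP.filter⁺ (λ w → all? (_∈? f) w) (UniqueP.filter⁺ P? (vtuples-unique m)))
        (λ {w} w∈ → let (w∈′ , p) = ∈-filter⁻ (λ w → all? (_∈? f) w) {xs = filter P? (vtuples m)} w∈
                        (w∈″ , _) = ∈-filter⁻ P? {xs = vtuples m} w∈′
                    in subst (λ j → w ∈ₗ tuples (elems f) j) (tuples-length m w∈″)
                         (∈-tuples w (λ x∈ → ∈-elems⁺ (All.lookup p x∈)))))
      (≤-trans (≤-reflexive (length-tuples (elems f) m)) (^-monoˡ-≤ m (subst (_≤ K) (sym (length-elems f)) (hK f∈)))))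

-- Kernels and linear cycles

-- D is a q-kernel of L when edges through D can avoid any q prescribed vertices outside D
-- (the large sunflowers with kernel D of the delta-system method).
Ker : ∀ {n} → List (Subset n) → ℕ → List (Fin n) → Set
Ker L q D = ∀ Z → length Z ≤ q → ∃ λ e → e ∈ₗ L × All (_∈ e) D × (∀ {z} → z ∈ₗ Z → z ∈ e → z ∈ₗ D)

-- Exhaustive search over the finitely many lists of length at most q. A failure comes with a
-- witness, which is how a set that is not a kernel yields a small cover.
search : ∀ {n} q {P : List (Fin n) → Set} → Decidable P →
  (∀ Z → length Z ≤ q → P Z) ⊎ (∃ λ Z → length Z ≤ q × ¬ P Z)
search zero P? with P? []
... | yes p = inj₁ (λ { [] _ → p })
... | no ¬p = inj₂ ([] , z≤n , ¬p)
search (suc q) {P} P? with P? []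
... | no ¬p = inj₂ ([] , z≤n , ¬p)
... | yes p with FinP.any? (λ x → dec x)
  where
  dec : ∀ x → Dec (∃ λ Z → length Z ≤ q × ¬ P (x ∷ Z))
  dec x with search q (λ Z → P? (x ∷ Z))
  ... | inj₁ h = no (λ (Z , le , ¬p) → ¬p (h Z le))
  ... | inj₂ h = yes h
...   | yes (x , Z , le , ¬p) = inj₂ (x ∷ Z , s≤s le , ¬p)
...   | no ¬h = inj₁ λ { [] _ → p
                       ; (x ∷ Z) (s≤s le) → decidable-stable (P? (x ∷ Z)) (λ ¬p → ¬h (x , Z , le , ¬p)) }

-- The positive form of failing to be a kernel: `Z` is the list that no edge through `D` avoids, and
-- the counting arguments work with it.
Covers : ∀ {n} → List (Subset n) → List (Fin n) → List (Fin n) → Set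
Covers L D Z = ∀ {e} → e ∈ₗ L → All (_∈ e) D → ∃ λ z → z ∈ₗ Z × z ∈ e × z ∉ₗ D

ker-or-cover : ∀ {n} (L : List (Subset n)) q D → Ker L q D ⊎ (∃ λ Z → length Z ≤ q × Covers L D Z)
ker-or-cover {n} L q D with search q body?
  where
  body? : ∀ Z → Dec (Any (λ e → All (_∈ e) D × All (λ z → z ∈ e → z ∈ₗ D) Z) L)
  body? Z = any? (λ e → all? (_∈? e) D ×-dec all? (λ z → (z ∈? e) →-dec (z ∈ₗ? D)) Z) L
... | inj₁ h = inj₁ (λ Z le → let (e , e∈ , De , ze) = find (h Z le) in e , e∈ , De , All.lookup ze)
... | inj₂ (Z , le , h) = inj₂ (Z , le , λ {e} e∈ De → hit e e∈ De)
  where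
  hit : ∀ e → e ∈ₗ L → All (_∈ e) D → ∃ λ z → z ∈ₗ Z × z ∈ e × z ∉ₗ D
  hit e e∈ De with any? (λ z → (z ∈? e) ×-dec ¬? (z ∈ₗ? D)) Z
  ... | yes p = let (z , z∈ , a , b) = find p in z , z∈ , a , b
  ... | no ¬p = ⊥-elim (h (lose e∈ (De , All.tabulate (λ {z} z∈ ze →
                  decidable-stable (z ∈ₗ? D) (λ z∉ → ¬p (lose z∈ (ze , z∉)))))))

abstract
  Ker? : ∀ {n} (L : List (Subset n)) q D → Dec (Ker L q D)
  Ker? L q D with ker-or-cover L q D
  ... | inj₁ h = yes h
  ... | inj₂ (Z , le , h) = no λ ker → let (e , e∈ , De , ze) = ker Z le
                                           (z , z∈ , z∈e , z∉D) = h e∈ De in z∉D (ze z∈ z∈e)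

Ker-cong : ∀ {n} {L : List (Subset n)} {q D D′} → (∀ {x} → x ∈ₗ D → x ∈ₗ D′) → (∀ {x} → x ∈ₗ D′ → x ∈ₗ D) →
  Ker L q D → Ker L q D′
Ker-cong f g ker Z le = let (e , e∈ , De , ze) = ker Z le in
  e , e∈ , All.tabulate (All.lookup De ∘ g) , (λ z∈ z∈e → f (ze z∈ z∈e))

Ker-edge : ∀ {n} {L : List (Subset n)} {q D e} → e ∈ₗ L → (∀ {x} → x ∈ₗ D → x ∈ e) → (∀ {x} → x ∈ e → x ∈ₗ D) → Ker L q D
Ker-edge e∈ f g Z le = _ , e∈ , All.tabulate f , (λ _ → g)

Ker-⊆ : ∀ {n} {L L′ : List (Subset n)} {q D} → (∀ {e} → e ∈ₗ L → e ∈ₗ L′) → Ker L q D → Ker L′ q D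
Ker-⊆ sub ker Z le = let (e , e∈ , r) = ker Z le in e , sub e∈ , r

Ker-swap : ∀ {n} {L : List (Subset n)} {q a b} → Ker L q (a ∷ b ∷ []) → Ker L q (b ∷ a ∷ [])
Ker-swap = Ker-cong sw sw
  where
  sw : ∀ {A : Set} {a b x : A} → x ∈ₗ a ∷ b ∷ [] → x ∈ₗ b ∷ a ∷ []
  sw (here p) = there (here p)
  sw (there (here p)) = here p

next-cases : ∀ {m} (i : Fin (suc m)) → toℕ (next i) ≡ suc (toℕ i) ⊎ (toℕ i ≡ m × next i ≡ zero)
next-cases {m} i with m≤n⇒m<n∨m≡n (FinP.toℕ<n i)
... | inj₁ lt = inj₁ (trans (FinP.toℕ-fromℕ< _) (m<n⇒m%n≡m lt))
... | inj₂ eq = inj₂ (suc-injective eq , FinP.toℕ-injective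
      (trans (FinP.toℕ-fromℕ< _) (trans (cong (_% suc m) eq) (n%n≡0 (suc m)))))

Unique-++ : ∀ {A : Set} {xs ys : List A} {x} → Unique (xs ++ ys) → x ∈ₗ xs → x ∈ₗ ys → ⊥
Unique-++ {xs = x ∷ xs} (h ∷ u) (here refl) q = All.lookup h (∈-++⁺ʳ xs q) refl
Unique-++ {xs = x ∷ xs} (h ∷ u) (there p)   q = Unique-++ u p q

Unique-++ˡ : ∀ {A : Set} (xs : List A) {ys} → Unique (xs ++ ys) → Unique xs
Unique-++ˡ []       u       = []
Unique-++ˡ (x ∷ xs) (h ∷ u) = All.tabulate (λ y∈ → All.lookup h (∈-++⁺ˡ y∈)) ∷ Unique-++ˡ xs u

Unique-++ʳ : ∀ {A : Set} (xs : List A) {ys} → Unique (xs ++ ys) → Unique ys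
Unique-++ʳ []       u       = u
Unique-++ʳ (x ∷ xs) (h ∷ u) = Unique-++ʳ xs u

Unique-∷ : ∀ {A : Set} {x : A} {xs} → x ∉ₗ xs → Unique xs → Unique (x ∷ xs)
Unique-∷ x∉ u = All.tabulate (λ { y∈ refl → x∉ y∈ }) ∷ u

module Cycles {k n : ℕ} (G : KGraph k n) (q : ℕ) where

  private
    V = Fin n
    L = edges G
    K = Ker L q

  edge-size : ∀ {e} → e ∈ₗ L → ∣ e ∣ ≡ k
  edge-size = All.lookup (uniform G)

  -- Each kernel is asked to avoid `A` together with all edges chosen so far. An edge adds k
  -- vertices to that list, whence the budget `length A + m * k`.
  greedy : ∀ m (D : Fin m → List V) A → (∀ i → K (D i)) → length A + m * k ≤ q →
    ∃ λ (F : Fin m → Subset n) → (∀ i → F i ∈ₗ L) × (∀ i → All (_∈ F i) (D i)) ×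
      (∀ i x → x ∈ₗ A → x ∈ F i → x ∈ₗ D i) ×
      (∀ i j → i ≢ j → ∀ x → x ∈ F i → x ∈ F j → x ∈ₗ D i ⊎ x ∈ₗ D j)
  greedy zero    D A ker le = (λ ()) , (λ ()) , (λ ()) , (λ ()) , λ ()
  greedy (suc m) D A ker le with ker zero A (≤-trans (m≤m+n _ _) le)
  ... | e , e∈ , De , av with greedy m (D ∘ suc) (A ++ elems e) (ker ∘ suc) (≤-trans (≤-reflexive
          (trans (cong (_+ m * k) (trans (length-++ A) (cong (length A +_) (trans (length-elems e) (edge-size e∈)))))
            (+-assoc (length A) k (m * k)))) le)
  ... | F , F∈ , DF , avF , disj = F′ , F′∈ , DF′ , avF′ , disj′
    where
    F′ : Fin (suc m) → Subset n
    F′ zero    = e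
    F′ (suc i) = F i
    F′∈ : ∀ i → F′ i ∈ₗ L
    F′∈ zero    = e∈
    F′∈ (suc i) = F∈ i
    DF′ : ∀ i → All (_∈ F′ i) (D i)
    DF′ zero    = De
    DF′ (suc i) = DF i
    avF′ : ∀ i x → x ∈ₗ A → x ∈ F′ i → x ∈ₗ D i
    avF′ zero    x x∈ = av x∈
    avF′ (suc i) x x∈ = avF i x (∈-++⁺ˡ x∈)
    disj′ : ∀ i j → i ≢ j → ∀ x → x ∈ F′ i → x ∈ F′ j → x ∈ₗ D i ⊎ x ∈ₗ D j
    disj′ zero    zero    i≢j x p r = ⊥-elim (i≢j refl)
    disj′ zero    (suc j) i≢j x p r = inj₂ (avF j x (∈-++⁺ʳ A (∈-elems⁺ p)) r)
    disj′ (suc i) zero    i≢j x p r = inj₁ (avF i x (∈-++⁺ʳ A (∈-elems⁺ r)) p)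
    disj′ (suc i) (suc j) i≢j x p r = disj i j (i≢j ∘ cong suc) x p r

  -- `A` contains every prescribed vertex, so an edge meets the prescribed vertices only in its own
  -- kernel, and two edges share only prescribed vertices. The lists `E i` allow a slot to be filled
  -- by a kernel with more than two vertices, even by a whole given edge.
  cycle : ∀ ℓ (v : Fin ℓ → V) (E : Fin ℓ → List V) (A : List V) → (∀ {i j} → v i ≡ v j → i ≡ j) →
    (∀ i j → v j ∉ₗ E i) → (∀ {i j x} → x ∈ₗ E i → x ∈ₗ E j → i ≡ j) →
    (∀ i → v i ∈ₗ A) → (∀ i {x} → x ∈ₗ E i → x ∈ₗ A) →
    (∀ i → K (v i ∷ v (next i) ∷ E i)) → length A + ℓ * k ≤ q → ContainsCycle ℓ G
  cycle ℓ v E A inj v∉E Edis v∈A E∈A ker le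
    with greedy ℓ (λ i → v i ∷ v (next i) ∷ E i) A ker le
  ... | F , F∈ , DF , av , disj = F , v , F∈ , inj , (λ i j → mk⇔ (to i j) (from i j)) , meet
    where
    D⊆A : ∀ i {x} → x ∈ₗ v i ∷ v (next i) ∷ E i → x ∈ₗ A
    D⊆A i (here refl)         = v∈A i
    D⊆A i (there (here refl)) = v∈A (next i)
    D⊆A i (there (there x∈))  = E∈A i x∈
    to : ∀ i j → v j ∈ F i → j ≡ i ⊎ j ≡ next i
    to i j h with av i (v j) (v∈A j) h
    ... | here eq           = inj₁ (inj eq)
    ... | there (here eq)   = inj₂ (inj eq)
    ... | there (there x∈)  = ⊥-elim (v∉E i j x∈)
    from : ∀ i j → j ≡ i ⊎ j ≡ next i → v j ∈ F i
    from i j (inj₁ refl) = All.lookup (DF i) (here refl)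
    from i j (inj₂ refl) = All.lookup (DF i) (there (here refl))
    both : ∀ i j → i ≢ j → ∀ {x} → x ∈ₗ v i ∷ v (next i) ∷ E i → x ∈ₗ v j ∷ v (next j) ∷ E j → ∃ λ m → x ≡ v m
    both i j i≢j (here eq)         _                  = _ , eq
    both i j i≢j (there (here eq)) _                  = _ , eq
    both i j i≢j (there (there p)) (here eq)          = _ , eq
    both i j i≢j (there (there p)) (there (here eq))  = _ , eq
    both i j i≢j (there (there p)) (there (there r))  = ⊥-elim (i≢j (Edis p r))
    meet : ∀ i j → i ≢ j → ∀ x → x ∈ F i → x ∈ F j → ∃ λ m → x ≡ v m
    meet i j i≢j x p r with disj i j i≢j x p r
    ... | inj₁ x∈ = both i j i≢j x∈ (av j x (D⊆A i x∈) r)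
    ... | inj₂ x∈ = both i j i≢j (av i x (D⊆A j x∈) p) x∈

  -- A cycle is described by the list of its vertices vᵢ, each with the further vertices that are
  -- prescribed for the edge from vᵢ to vᵢ₊₁.
  block : V × List V → List V
  block (v , E) = v ∷ E

  atoms : List (V × List V) → List V
  atoms []       = []
  atoms (c ∷ cs) = block c ++ atoms cs

  -- The vertex `z` stands for the start of the cycle, to which the last slot returns. Keeping it a
  -- parameter lets a path be extended at its front.
  Links : V → List (V × List V) → Set
  Links z []                             = ⊤
  Links z ((v , E) ∷ [])                 = K (v ∷ z ∷ E)
  Links z ((v , E) ∷ c@(v′ , _) ∷ cs) = K (v ∷ v′ ∷ E) × Links z (c ∷ cs)

  private
    block⊆atoms : ∀ cs i {x} → x ∈ₗ block (lookup cs i) → x ∈ₗ atoms cs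
    block⊆atoms (c ∷ cs) zero    x∈ = ∈-++⁺ˡ x∈
    block⊆atoms (c ∷ cs) (suc i) x∈ = ∈-++⁺ʳ (block c) (block⊆atoms cs i x∈)

    block-inj : ∀ cs → Unique (atoms cs) → ∀ {i j x} → x ∈ₗ block (lookup cs i) → x ∈ₗ block (lookup cs j) → i ≡ j
    block-inj (c ∷ cs) u {zero}  {zero}  p r = refl
    block-inj (c ∷ cs) u {zero}  {suc j} p r = ⊥-elim (Unique-++ u p (block⊆atoms cs j r))
    block-inj (c ∷ cs) u {suc i} {zero}  p r = ⊥-elim (Unique-++ u r (block⊆atoms cs i p))
    block-inj (c ∷ cs) u {suc i} {suc j} p r = cong suc (block-inj cs (Unique-++ʳ (block c) u) p r)

    block-unique : ∀ cs → Unique (atoms cs) → ∀ i → Unique (block (lookup cs i))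
    block-unique (c ∷ cs) u zero    = Unique-++ˡ (block c) u
    block-unique (c ∷ cs) u (suc i) = block-unique cs (Unique-++ʳ (block c) u) i

    links-at : ∀ z cs → Links z cs → ∀ i →
      (∀ j → toℕ j ≡ suc (toℕ i) → K (proj₁ (lookup cs i) ∷ proj₁ (lookup cs j) ∷ proj₂ (lookup cs i))) ×
      (suc (toℕ i) ≡ length cs → K (proj₁ (lookup cs i) ∷ z ∷ proj₂ (lookup cs i)))
    links-at z (c ∷ [])       h       zero    = (λ { zero () }) , (λ _ → h)
    links-at z (c ∷ c′ ∷ cs)  (h , l) zero    = (λ { (suc zero) _ → h }) , (λ ())
    links-at z (c ∷ c′ ∷ cs)  (h , l) (suc i) =
      (λ { (suc j) eq → proj₁ (links-at z (c′ ∷ cs) l i) j (suc-injective eq) }) ,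
      (λ eq → proj₂ (links-at z (c′ ∷ cs) l i) (suc-injective eq))

  cycle-from-list : ∀ v E cs → let cs′ = (v , E) ∷ cs in Unique (atoms cs′) → Links v cs′ →
    length (atoms cs′) + length cs′ * k ≤ q → ContainsCycle (length cs′) G
  cycle-from-list v E cs u l le = cycle (length cs′) (proj₁ ∘ lookup cs′) (proj₂ ∘ lookup cs′) (atoms cs′)
    (λ {i} {j} eq → block-inj cs′ u {i} {j} (here refl) (here eq))
    v∉E
    (λ {i} {j} p r → block-inj cs′ u {i} {j} (there p) (there r))
    (λ i → block⊆atoms cs′ i (here refl)) (λ i x∈ → block⊆atoms cs′ i (there x∈)) ker le
    where
    cs′ = (v , E) ∷ cs
    v∉E : ∀ i j → proj₁ (lookup cs′ j) ∉ₗ proj₂ (lookup cs′ i)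
    v∉E i j h with block-inj cs′ u {i} {j} (there h) (here refl)
    ... | refl = UniqueP.Unique[x∷xs]⇒x∉xs (block-unique cs′ u i) h
    ker : ∀ i → K (proj₁ (lookup cs′ i) ∷ proj₁ (lookup cs′ (next i)) ∷ proj₂ (lookup cs′ i))
    ker i with next-cases i
    ... | inj₁ eq = proj₁ (links-at v cs′ l i) (next i) eq
    ... | inj₂ (eq , nz) = subst (λ j → K (proj₁ (lookup cs′ i) ∷ proj₁ (lookup cs′ j) ∷ proj₂ (lookup cs′ i)))
                             (sym nz) (proj₂ (links-at v cs′ l i) (cong suc eq))

  -- Triangulating a polygon as a fan: the pairs of Q-triples are kernels, and a Q-triple a b c can be
  -- glued along its side a c to a new one.
  polygon : (Q : V → V → V → Set) →
    (∀ {a b c} → Q a b c → a ≢ b × b ≢ c × a ≢ c × K (a ∷ b ∷ []) × K (b ∷ c ∷ []) × K (a ∷ c ∷ [])) →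
    (∀ {a b c} → Q a b c → ∀ Z → length Z ≤ q → ∃ λ w → w ∉ₗ Z × Q a c w) →
    ∀ m → (3 + m) + (3 + m) * k ≤ q → ∀ {a b c} → Q a b c → ContainsCycle (3 + m) G
  polygon Q sides ext m le {a} {b} {c} Qabc = close
    where
    pairs : List V → List (V × List V)
    pairs = map (_, [])
    atoms-pairs : ∀ ws → atoms (pairs ws) ≡ ws
    atoms-pairs []       = refl
    atoms-pairs (w ∷ ws) = cong (w ∷_) (atoms-pairs ws)
    fan : ∀ i → i ≤ m → ∃ λ b′ → ∃ λ c′ → ∃ λ ws → Q a b′ c′ × length ws ≡ i × Unique (a ∷ c′ ∷ b′ ∷ ws) ×
      Links a (pairs (c′ ∷ b′ ∷ ws))
    fan zero _ with sides Qabc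
    ... | ab , bc , ac , kab , kbc , kac = b , c , [] , Qabc , refl ,
          ((ac ∷ ab ∷ []) ∷ ((bc ∘ sym) ∷ []) ∷ [] ∷ []) , Ker-swap kbc , Ker-swap kab
    fan (suc i) i<m with fan i (≤-trans (n≤1+n i) i<m)
    -- The side a c′ becomes a diagonal: the new vertex w goes between a and c′. Only the link w c′
    -- is added now; the side from a to the last new vertex is supplied in `close`.
    ... | b′ , c′ , ws , Qq , len , u , l with ext Qq (a ∷ c′ ∷ b′ ∷ ws)
            (≤-trans (s≤s (s≤s (s≤s (≤-trans (≤-reflexive len) (≤-trans (n≤1+n i) i<m))))) (≤-trans (m≤m+n (3 + m) _) le))
    ... | w , w∉ , Qw with sides Qw | u
    ... | _ , bc , _ , _ , kbc , _ | a∉ ∷ u′ = c′ , w , b′ ∷ ws , Qw , cong suc len ,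
          Unique-∷ (λ { (here eq) → w∉ (here (sym eq)) ; (there p) → All.lookup a∉ p refl })
            (Unique-∷ (w∉ ∘ there) u′) , Ker-swap kbc , l
    close : ContainsCycle (3 + m) G
    close with fan m ≤-refl
    ... | b′ , c′ , ws , Qq , refl , u , l = subst (λ j → ContainsCycle (3 + j) G) (length-map (_, []) ws)
          (cycle-from-list a [] (pairs (c′ ∷ b′ ∷ ws)) (subst Unique (sym (atoms-pairs (a ∷ c′ ∷ b′ ∷ ws))) u)
            (proj₂ (proj₂ (proj₂ (proj₂ (proj₂ (sides Qq))))) , l)
            (subst₂ (λ x y → x + (3 + y) * k ≤ q) (sym (cong length (atoms-pairs (a ∷ c′ ∷ b′ ∷ ws)))) (sym (length-map (_, []) ws)) le))

  -- A path y₀ x y₁ x′ y₂ … alternating between the vertices x, xs and further vertices of Y, continued by tl.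
  connect : ∀ (T Y : List V) → Unique Y → (∀ {y} → y ∈ₗ Y → All (λ x → K (x ∷ y ∷ [])) T) →
    ∀ z y′ E tl → All (λ x → K (x ∷ y′ ∷ [])) T → Links z ((y′ , E) ∷ tl) →
    ∀ x xs y₀ Av → All (_∈ₗ T) (x ∷ xs) → All (λ x → K (x ∷ y₀ ∷ [])) T →
    Unique (y₀ ∷ x ∷ xs ++ atoms ((y′ , E) ∷ tl)) →
    length Av + 3 * suc (length xs) + length (atoms ((y′ , E) ∷ tl)) ≤ length Y →
    ∃ λ cs → Links z ((y₀ , []) ∷ cs) × Unique (y₀ ∷ atoms cs) ×
      length cs ≡ suc (2 * length xs + suc (length tl)) ×
      length (atoms cs) ≡ suc (2 * length xs + length (atoms ((y′ , E) ∷ tl))) ×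
      (∀ {a} → a ∈ₗ atoms cs → a ∈ₗ (x ∷ xs ++ atoms ((y′ , E) ∷ tl)) ⊎ a ∉ₗ Av)
  connect T Y uY goodY z y′ E tl good′ ltl x [] y₀ Av (x∈ ∷ _) good₀ u le =
    (x , []) ∷ (y′ , E) ∷ tl , (Ker-swap (All.lookup good₀ x∈) , All.lookup good′ x∈ , ltl) , u , refl , refl , inj₁
  connect T Y uY goodY z y′ E tl good′ ltl x (x′ ∷ xs) y₀ Av (x∈ ∷ xs∈) good₀ u@(h₀ ∷ hx ∷ u″) le
    -- y₁ must avoid `Av`, the current y₀ and x, and everything still to come. Passing y₀ and x into
    -- `Av` keeps later choices away from them.
    with fresh-pick FinP._≟_ (Av ++ (y₀ ∷ x ∷ x′ ∷ xs ++ atoms ((y′ , E) ∷ tl))) id uY (λ _ _ → id) lt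
    where
    tlA = atoms ((y′ , E) ∷ tl)
    arith : ∀ a s b → suc (a + (3 + (s + b))) + (2 + 2 * s) ≡ a + 3 * suc (suc s) + b
    arith = solve-∀
    lt : length (Av ++ (y₀ ∷ x ∷ x′ ∷ xs ++ tlA)) < length Y
    lt = ≤-trans (≤-reflexive (cong suc (trans (length-++ Av) (cong (λ j → length Av + (3 + j)) (length-++ xs)))))
         (≤-trans (m≤m+n _ (2 + 2 * length xs)) (≤-trans (≤-reflexive (arith (length Av) (length xs) (length tlA))) le))
  ... | y₁ , y₁∈ , y₁∉ with connect T Y uY goodY z y′ E tl good′ ltl x′ xs y₁ (y₀ ∷ x ∷ Av) xs∈ (goodY y₁∈)
            (Unique-∷ (λ p → y₁∉ (∈-++⁺ʳ Av (there (there p)))) u″)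
            (≤-trans (n≤1+n _) (≤-trans (≤-reflexive (arith (length Av) (length xs) _)) le))
    where
    arith : ∀ a s b → suc (2 + a + 3 * suc s + b) ≡ a + 3 * suc (suc s) + b
    arith = solve-∀
  ... | cs , l , uc , len , lenA , from = (x , []) ∷ (y₁ , []) ∷ cs ,
      (Ker-swap (All.lookup good₀ x∈) , All.lookup (goodY y₁∈) x∈ , l) ,
      Unique-∷ (λ { (here refl) → All.lookup h₀ (here refl) refl
                  ; (there (here refl)) → y₁∉ (∈-++⁺ʳ Av (here refl))
                  ; (there (there a∈)) → old (here refl) (λ p → All.lookup h₀ (there p) refl) a∈ })
        (Unique-∷ (λ { (here refl) → y₁∉ (∈-++⁺ʳ Av (there (here refl)))
                     ; (there a∈) → old (there (here refl)) (λ p → All.lookup hx p refl) a∈ }) uc) ,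
      trans (cong (2 +_) len) (arith₁ (length xs) (length tl)) ,
      trans (cong (2 +_) lenA) (arith₂ (length xs) _) ,
      λ { (here refl) → inj₁ (here refl)
        ; (there (here refl)) → inj₂ (y₁∉ ∘ ∈-++⁺ˡ)
        ; (there (there a∈)) → case from a∈ of λ { (inj₁ p) → inj₁ (there p) ; (inj₂ p) → inj₂ (λ r → p (there (there r))) } }
    where
    arith₁ : ∀ s b → 2 + suc (2 * s + suc b) ≡ suc (2 * suc s + suc b)
    arith₁ = solve-∀
    arith₂ : ∀ s b → 2 + suc (2 * s + b) ≡ suc (2 * suc s + b)
    arith₂ = solve-∀
    old : ∀ {a} → a ∈ₗ y₀ ∷ x ∷ Av → a ∉ₗ (x′ ∷ xs ++ atoms ((y′ , E) ∷ tl)) → a ∈ₗ atoms cs → ⊥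
    old a∈ a∉ p = case from p of λ { (inj₁ r) → a∉ r ; (inj₂ r) → r a∈ }

  -- With s the length of `x ∷ xs`, the alternating path contributes y₀, these s vertices and s - 1
  -- vertices of `Y`; y′ and `tl` complete the cycle. An empty `tl` gives length 2s + 1, one further
  -- vertex gives 2s + 2.
  connect-cycle : ∀ x xs Y → Unique Y → (∀ {y} → y ∈ₗ Y → All (λ x → K (x ∷ y ∷ [])) (x ∷ xs)) →
    ∀ y₀ y′ E tl → All (λ x → K (x ∷ y₀ ∷ [])) (x ∷ xs) → All (λ x → K (x ∷ y′ ∷ [])) (x ∷ xs) →
    Links y₀ ((y′ , E) ∷ tl) → Unique (y₀ ∷ x ∷ xs ++ atoms ((y′ , E) ∷ tl)) →
    3 * suc (length xs) + length (atoms ((y′ , E) ∷ tl)) ≤ length Y →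
    2 * suc (length xs) + length (atoms ((y′ , E) ∷ tl)) + (2 * suc (length xs) + suc (length tl)) * k ≤ q →
    ContainsCycle (2 * suc (length xs) + suc (length tl)) G
  connect-cycle x xs Y uY goodY y₀ y′ E tl good₀ good′ ltl u le le′
    with connect (x ∷ xs) Y uY goodY y₀ y′ E tl good′ ltl x xs y₀ [] (All.tabulate id) good₀ u le
  ... | cs , l , uc , len , lenA , _ = subst (λ j → ContainsCycle j G) eq
        (cycle-from-list y₀ [] cs uc l (subst₂ (λ i j → i + j * k ≤ q) (sym eqA) (sym eq) le′))
    where
    arith : ∀ s b → 2 + (2 * s + b) ≡ 2 * suc s + b
    arith = solve-∀
    eq : suc (length cs) ≡ 2 * suc (length xs) + suc (length tl)
    eq = trans (cong suc len) (arith (length xs) _)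
    eqA : suc (length (atoms cs)) ≡ 2 * suc (length xs) + length (atoms ((y′ , E) ∷ tl))
    eqA = trans (cong suc lenA) (arith (length xs) _)

-- Homogeneous families

subsets : ∀ k → List (Subset k)
subsets zero    = [] ∷ []
subsets (suc k) = map (inside ∷_) (subsets k) ++ map (outside ∷_) (subsets k)

∈-subsets : ∀ {k} (D : Subset k) → D ∈ₗ subsets k
∈-subsets []            = here refl
∈-subsets (inside ∷ D)  = ∈-++⁺ˡ (∈-map⁺ _ (∈-subsets D))
∈-subsets {suc k} (outside ∷ D) = ∈-++⁺ʳ (map (inside ∷_) (subsets k)) (∈-map⁺ _ (∈-subsets D))

choose : ∀ {A : Set} {P : Set} {Q : A → Set} xs → (∀ {x} → x ∈ₗ xs → P ⊎ Q x) → P ⊎ (∀ {x} → x ∈ₗ xs → Q x)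
choose []       h = inj₂ λ ()
choose (x ∷ xs) h with h (here refl) | choose xs (h ∘ there)
... | inj₁ p | _      = inj₁ p
... | inj₂ _ | inj₁ p = inj₁ p
... | inj₂ q | inj₂ r = inj₂ λ { (here refl) → q ; (there x∈) → r x∈ }

-- `N` counts the sets of positions that may still be kernels. The first summand serves families
-- with an uncovered r-set of positions; the second collects one recursive bound, with one set
-- fewer, for each cause of deletion.
homC : ℕ → ℕ → ℕ → ℕ
homC k q zero    = suc (q * k) ^ k
homC k q (suc N) = suc (q * k) ^ k + suc N * homC k q N

-- Items are read as tuples of vertices through o.
module Homogeneous {I : Set} {k n : ℕ} (o : I → Fin k → Fin n) (q : ℕ) where

  Agree : Subset k → I → I → Set
  Agree D e e′ = ∀ p → p ∈ D → o e p ≡ o e′ p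

  agree? : ∀ D e e′ → Dec (Agree D e e′)
  agree? D e e′ = FinP.all? (λ p → (p ∈? D) →-dec (o e p FinP.≟ o e′ p))

  -- Kernels by position: the vertices of `D` must reappear at the same positions, which lets
  -- kernels at different sets of positions be composed.
  KerAt : List I → Subset k → I → Set
  KerAt F D e = ∀ Z → length Z ≤ q → ∃ λ e′ → e′ ∈ₗ F × Agree D e e′ × (∀ p → p ∉ D → o e′ p ∉ₗ Z)

  Proper : Subset k → Set
  Proper D = ∃ λ p → p ∉ D

  kerAt-or-cover : ∀ F D e → KerAt F D e ⊎
    (∃ λ Z → length Z ≤ q × (∀ {e′} → e′ ∈ₗ F → Agree D e e′ → ∃ λ p → p ∉ D × o e′ p ∈ₗ Z))
  kerAt-or-cover F D e with search q body?
    where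
    body? : ∀ Z → Dec (Any (λ e′ → Agree D e e′ × (∀ p → p ∉ D → o e′ p ∉ₗ Z)) F)
    body? Z = any? (λ e′ → agree? D e e′ ×-dec FinP.all? (λ p → ¬? (p ∈? D) →-dec ¬? (o e′ p ∈ₗ? Z))) F
  ... | inj₁ h = inj₁ (λ Z le → find (h Z le))
  ... | inj₂ (Z , le , h) = inj₂ (Z , le , λ {e′} → hit e′)
    where
    hit : ∀ e′ → e′ ∈ₗ F → Agree D e e′ → ∃ λ p → p ∉ D × o e′ p ∈ₗ Z
    hit e′ e′∈ ag with FinP.any? (λ p → ¬? (p ∈? D) ×-dec (o e′ p ∈ₗ? Z))
    ... | yes r = r
    ... | no ¬r = ⊥-elim (h (lose e′∈ (ag , λ p p∉ z → ¬r (p , p∉ , z))))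

  abstract
    kerAt? : ∀ F D e → Dec (KerAt F D e)
    kerAt? F D e with kerAt-or-cover F D e
    ... | inj₁ h = yes h
    ... | inj₂ (Z , le , h) = no λ ker → let (e′ , e′∈ , ag , av) = ker Z le
                                             (p , p∉ , z) = h e′∈ ag in av p p∉ z

  KerIn : List I → Subset k → Set
  KerIn F D = ∀ {e} → e ∈ₗ F → KerAt F D e

  -- Closure under intersection. The item is changed once for each position p outside `D`, through a
  -- kernel D′ that omits p: positions outside D′ become free of `Z` and those in D′ keep their
  -- vertex, so what is cleared stays cleared.
  KerIn-cover : ∀ {F} D → (∀ p → p ∉ D → ∃ λ D′ → (∀ {r} → r ∈ D → r ∈ D′) × p ∉ D′ × KerIn F D′) → KerIn F D
  KerIn-cover {F} D cov {e} e∈ Z le = let (e′ , e′∈ , ag , av) = go (allFin k) in e′ , e′∈ , ag , (λ p → av (∈-allFin p))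
    where
    go : ∀ ps → ∃ λ e′ → e′ ∈ₗ F × Agree D e e′ × (∀ {p} → p ∈ₗ ps → p ∉ D → o e′ p ∉ₗ Z)
    go [] = e , e∈ , (λ _ _ → refl) , λ ()
    go (p ∷ ps) with go ps | p ∈? D
    ... | e′ , e′∈ , ag , av | yes p∈ = e′ , e′∈ , ag , λ { (here refl) p∉ → ⊥-elim (p∉ p∈) ; (there r∈) → av r∈ }
    ... | e′ , e′∈ , ag , av | no p∉ with cov p p∉
    ... | D′ , D⊆ , p∉′ , ker with ker e′∈ Z le
    ... | e″ , e″∈ , ag′ , av′ = e″ , e″∈ , (λ r r∈ → trans (ag r r∈) (ag′ r (D⊆ r∈))) ,
          λ { (here refl) _ → av′ p p∉′
            ; {r} (there r∈) r∉ → case r ∈? D′ of λ { (yes y) → subst (_∉ₗ Z) (ag′ r y) (av r∈ r∉) ; (no y) → av′ r y } }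

  InjOn : List I → Set
  InjOn L = ∀ {e e′} → e ∈ₗ L → e′ ∈ₗ L → (∀ p → o e p ≡ o e′ p) → e ≡ e′

  -- As `D` is no kernel at e₀, some `Z` with at most q vertices is met by every item of the fibre
  -- at a position outside `D`. Fixing one of these at most q·k pairs of vertex and position
  -- enlarges `D`, and this can happen at most m times.
  fiber : ∀ m D {L} → InjOn L →
    (∀ {D′} → (∀ {p} → p ∈ D → p ∈ D′) → Proper D′ → ∀ {e} → e ∈ₗ L → ¬ KerAt L D′ e) →
    k ≤ ∣ D ∣ + m → ∀ L′ → Unique L′ → (∀ {e} → e ∈ₗ L′ → e ∈ₗ L) →
    (∀ {e e′} → e ∈ₗ L′ → e′ ∈ₗ L′ → Agree D e e′) → length L′ ≤ suc (q * k) ^ m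
  fiber m D inj non le [] u sub ag = z≤n
  fiber m D inj non le (e₀ ∷ L′) u sub ag with FinP.any? (λ p → ¬? (p ∈? D))
  ... | no full = ≤-trans (all-equal⇒length≤1 u (λ p r → inj (sub p) (sub r)
          (λ i → ag p r i (decidable-stable (i ∈? D) (λ h → full (i , h)))))) (m^n>0 (suc (q * k)) m)
  fiber zero D inj non le (e₀ ∷ L′) u sub ag | yes (p , p∉) =
    ⊥-elim (p∉ (subst (p ∈_) (sym (∣p∣≡n⇒p≡⊤ {p = D} (≤-antisym (∣p∣≤n D) (subst (k ≤_) (+-identityʳ _) le)))) ∈⊤))
  fiber (suc m) D {L} inj non le (e₀ ∷ L′) u sub ag | yes pr with kerAt-or-cover L D e₀
  ... | inj₁ ker = ⊥-elim (non id pr (sub (here refl)) ker)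
  ... | inj₂ (Z , leZ , cov) = ≤-trans
      (union-bound-const Q? (suc (q * k) ^ m) (e₀ ∷ L′) (cartesianProduct Z (allFin k))
        (λ {e} e∈ → let (p , p∉ , z) = cov (sub e∈) (ag (here refl) e∈) in (o e p , p) , ∈-cartesianProduct⁺ z (∈-allFin p) , p∉ , refl)
        (λ {(z , p)} _ → part z p (p ∈? D)))
      (*-monoˡ-≤ (suc (q * k) ^ m) (≤-trans (≤-reflexive (trans (length-cpw _,_ Z (allFin k)) (cong (length Z *_) (length-allFin k))))
        (≤-trans (*-monoˡ-≤ k leZ) (n≤1+n _))))
    where
    Q? : ∀ (i : Fin n × Fin k) e → Dec (proj₂ i ∉ D × o e (proj₂ i) ≡ proj₁ i)
    Q? (z , p) e = ¬? (p ∈? D) ×-dec (o e p FinP.≟ z)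
    part : ∀ z p → Dec (p ∈ D) → # (Q? (z , p)) (e₀ ∷ L′) ≤ suc (q * k) ^ m
    part z p (yes p∈) = ≤-trans (≤-reflexive (#-none (Q? (z , p)) (e₀ ∷ L′) (λ _ h → proj₁ h p∈))) z≤n
    part z p (no p∉) = fiber m (D ∪ ⁅ p ⁆) inj (λ h → non (h ∘ p⊆p∪q ⁅ p ⁆)) (≤-trans le (≤-trans (≤-reflexive (+-suc ∣ D ∣ m))
          (+-monoˡ-≤ m (p⊂q⇒∣p∣<∣q∣ (p⊆p∪q ⁅ p ⁆ , p , q⊆p∪q D ⁅ p ⁆ (x∈⁅x⁆ p) , p∉)))))
        (filter (Q? (z , p)) (e₀ ∷ L′)) (UniqueP.filter⁺ (Q? (z , p)) u)
        (λ e∈ → sub (proj₁ (∈-filter⁻ (Q? (z , p)) {xs = e₀ ∷ L′} e∈)))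
        (λ {e} {e′} e∈ e′∈ r r∈ →
          let (e∈₁ , _ , eq) = ∈-filter⁻ (Q? (z , p)) {xs = e₀ ∷ L′} e∈
              (e∈₂ , _ , eq′) = ∈-filter⁻ (Q? (z , p)) {xs = e₀ ∷ L′} e′∈
          in case x∈p∪q⁻ D ⁅ p ⁆ r∈ of λ
            { (inj₁ h) → ag e∈₁ e∈₂ r h
            ; (inj₂ h) → case x∈⁅y⁆⇒x≡y p h of λ { refl → trans eq (sym eq′) } })

  fibers : ∀ c ps L → Unique L →
    (∀ L′ → Unique L′ → (∀ {e} → e ∈ₗ L′ → e ∈ₗ L) →
      (∀ {e e′} → e ∈ₗ L′ → e′ ∈ₗ L′ → ∀ {p} → p ∈ₗ ps → o e p ≡ o e′ p) → length L′ ≤ c) →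
    length L ≤ n ^ length ps * c
  fibers c [] L u h = subst (length L ≤_) (sym (*-identityˡ c)) (h L u id (λ _ _ ()))
  fibers c (p ∷ ps) L u h = subst (length L ≤_) (trans (cong (_* (n ^ length ps * c)) (length-allFin n)) (sym (*-assoc n (n ^ length ps) c)))
    (union-bound-const (λ v e → o e p FinP.≟ v) (n ^ length ps * c) L (allFin n) (λ {e} _ → o e p , ∈-allFin _ , refl)
      (λ {v} _ → fibers c ps (filter (λ e → o e p FinP.≟ v) L) (UniqueP.filter⁺ (λ e → o e p FinP.≟ v) u)
        (λ L′ u′ sub ag → h L′ u′ (λ e∈ → proj₁ (∈-filter⁻ (λ e → o e p FinP.≟ v) {xs = L} (sub e∈)))
          (λ e∈ e′∈ → λ { (here refl) → trans (proj₂ (∈-filter⁻ (λ e → o e p FinP.≟ v) {xs = L} (sub e∈)))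
                                          (sym (proj₂ (∈-filter⁻ (λ e → o e p FinP.≟ v) {xs = L} (sub e′∈))))
                        ; (there r∈) → ag e∈ e′∈ r∈ }))))

  private
    KerAt-⊆ : ∀ {F F′ D e} → (∀ {x} → x ∈ₗ F → x ∈ₗ F′) → KerAt F D e → KerAt F′ D e
    KerAt-⊆ sub ker Z le = let (e′ , e′∈ , r) = ker Z le in e′ , sub e′∈ , r

    bump : ∀ (f g : Subset k → ℕ) a D J → (∀ D′ → f D′ ≤ g D′) → a + f D ≤ g D → D ∈ₗ J → a + ∑ f J ≤ ∑ g J
    bump f g a D (_ ∷ J) le eq (here refl) = ≤-trans (≤-reflexive (sym (+-assoc a (f D) _))) (+-mono-≤ eq (∑-mono J (λ _ → le _)))
    bump f g a D (D₀ ∷ J) le eq (there D∈) = ≤-trans (≤-reflexive (trans (sym (+-assoc a (f D₀) _))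
      (trans (cong (_+ ∑ f J) (+-comm a (f D₀))) (+-assoc (f D₀) a _)))) (+-mono-≤ (le D₀) (bump f g a D J le eq D∈))

  -- Deleting whole fibres that fail to be kernels: what is deleted because of D has no D-kernels.
  purify : ∀ m J L → length L ≤ m → Unique L →
    ∃ λ F → ∃ λ (R : Subset k → List I) → (∀ {e} → e ∈ₗ F → e ∈ₗ L) × (∀ {D} → D ∈ₗ J → KerIn F D) ×
      (∀ D → Unique (R D) × (∀ {e} → e ∈ₗ R D → e ∈ₗ L × ¬ KerAt (R D) D e)) ×
      length L ≤ length F + ∑ (length ∘ R) J
  purify m J L le u with any? (λ D → any? (λ e → ¬? (kerAt? L D e)) L) J
  ... | no ¬h = L , (λ _ → []) , id , (λ {D} D∈ {e} e∈ → decidable-stable (kerAt? L D e) (λ h → ¬h (lose D∈ (lose e∈ h)))) ,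
        (λ _ → [] , λ ()) , m≤m+n _ _
  purify zero J [] le u | yes h with find h
  ... | _ , _ , h′ with find h′
  ... | _ , () , _
  purify (suc m) J L le u | yes h with find h
  ... | D , D∈ , h′ with find h′
  ... | e , e∈ , ¬ker with purify m J (filter (¬? ∘ agree? D e) L)
        (≤-pred (≤-trans (filter-notAll (¬? ∘ agree? D e) L (lose e∈ (λ h → h (λ _ _ → refl)))) le))
        (UniqueP.filter⁺ (¬? ∘ agree? D e) u)
  ... | F , R , F⊆ , kerF , RR , len = F , R′ , (λ x∈ → proj₁ (∈-filter⁻ (¬? ∘ agree? D e) {xs = L} (F⊆ x∈))) , kerF , RR′ ,
        ≤-trans (≤-reflexive (#-¬ (agree? D e) L)) (≤-trans (+-monoʳ-≤ (length cut) len)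
          (≤-trans (≤-reflexive (trans (sym (+-assoc (length cut) (length F) _)) (trans (cong (_+ ∑ (length ∘ R) J) (+-comm (length cut) _)) (+-assoc (length F) (length cut) _))))
            (+-monoʳ-≤ (length F) (bump (length ∘ R) (length ∘ R′) (length cut) D J mono eq D∈))))
    where
    cut = filter (agree? D e) L
    R′ : Subset k → List I
    R′ D′ with D′ ≟S D
    ... | yes _ = cut ++ R D′
    ... | no _  = R D′
    mono : ∀ D′ → length (R D′) ≤ length (R′ D′)
    mono D′ with D′ ≟S D
    ... | yes _ = ≤-trans (m≤n+m _ (length cut)) (≤-reflexive (sym (length-++ cut)))
    ... | no _  = ≤-refl
    eq : length cut + length (R D) ≤ length (R′ D)
    eq with D ≟S D
    ... | yes _ = ≤-reflexive (sym (length-++ cut))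
    ... | no ¬r = ⊥-elim (¬r refl)
    inL : ∀ {x} D′ → x ∈ₗ R D′ → x ∈ₗ L × ¬ Agree D e x
    inL D′ x∈ = ∈-filter⁻ (¬? ∘ agree? D e) {xs = L} (proj₁ (proj₂ (RR D′) x∈))
    inCut : ∀ {x} → x ∈ₗ cut → x ∈ₗ L × Agree D e x
    inCut = ∈-filter⁻ (agree? D e) {xs = L}
    RR′ : ∀ D′ → Unique (R′ D′) × (∀ {x} → x ∈ₗ R′ D′ → x ∈ₗ L × ¬ KerAt (R′ D′) D′ x)
    RR′ D′ with D′ ≟S D
    ... | no _ = proj₁ (RR D′) , λ x∈ → proj₁ (inL D′ x∈) , proj₂ (proj₂ (RR D′) x∈)
    -- Pieces removed because of `D` have different traces on `D`, so their union creates no new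
    -- kernel at `D`.
    ... | yes refl = UniqueP.++⁺ (UniqueP.filter⁺ (agree? D e) u) (proj₁ (RR D)) (λ (p , r) → proj₂ (inL D r) (proj₂ (inCut p))) , cases
      where
      inCutR : ∀ {x} → x ∈ₗ cut ++ R D → x ∈ₗ L
      inCutR x∈ = [ proj₁ ∘ inCut , proj₁ ∘ inL D ]′ (∈-++⁻ cut x∈)
      cases : ∀ {x} → x ∈ₗ cut ++ R D → x ∈ₗ L × ¬ KerAt (cut ++ R D) D x
      cases {x} x∈ with ∈-++⁻ cut x∈
      ... | inj₁ p = proj₁ (inCut p) , λ ker → ¬ker (λ Z leZ → let (e″ , e″∈ , ag , av) = ker Z leZ in
                e″ , inCutR e″∈ , (λ r r∈ → trans (proj₂ (inCut p) r r∈) (ag r r∈)) , av)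
      ... | inj₂ p = proj₁ (inL D p) , λ ker → proj₂ (proj₂ (RR D) p) (λ Z leZ → let (e″ , e″∈ , ag , av) = ker Z leZ in
                e″ , [ (λ a → ⊥-elim (proj₂ (inL D p) (λ r r∈ → trans (proj₂ (inCut a) r r∈) (sym (ag r r∈))))) , id ]′ (∈-++⁻ cut e″∈) , ag , av)

  Covered : List (Subset k) → List (Fin k) → Set
  Covered J P = Any (λ D → Proper D × All (_∈ D) P) J

  covered? : ∀ J P → Dec (Covered J P)
  covered? J P = any? (λ D → FinP.any? (λ p → ¬? (p ∈? D)) ×-dec all? (_∈? D) P) J

  Homog : List (List (Fin k)) → List I → Set
  Homog Ps L = ∃ λ F → ∃ λ J → (∃ λ e → e ∈ₗ F) × (∀ {e} → e ∈ₗ F → e ∈ₗ L) × (∀ {D} → D ∈ₗ J → KerIn F D) ×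
    (∀ {P} → P ∈ₗ Ps → Covered J P)

  -- Invariant: no D outside J is a kernel.
  homogeneous-or-small : ∀ r Ps → (∀ {P} → P ∈ₗ Ps → length P ≡ r) → ∀ N J → length J ≤ N → ∀ L → Unique L → InjOn L →
    (∀ {D} → D ∉ₗ J → Proper D → ∀ {e} → e ∈ₗ L → ¬ KerAt L D e) → Homog Ps L ⊎ length L ≤ homC k q N * n ^ r
  homogeneous-or-small r Ps lenP N J leJ L u inj non with all? (covered? J) Ps
  ... | no ¬cov = inj₂ (uncov (find (AllP.¬All⇒Any¬ (covered? J) Ps ¬cov)))
    where
    C₀≤ : ∀ N → suc (q * k) ^ k ≤ homC k q N
    C₀≤ zero    = ≤-refl
    C₀≤ (suc N) = m≤m+n _ _
    uncov : (∃ λ P → P ∈ₗ Ps × ¬ Covered J P) → length L ≤ homC k q N * n ^ r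
    -- No proper set in `J` contains `P`, so by the invariant no proper superset of `P` is a kernel,
    -- and each of the n^r traces on `P` is shared by boundedly many items.
    uncov (P , P∈ , ¬c) = ≤-trans (fibers (suc (q * k) ^ k) P L u (λ L′ u′ sub ag →
        fiber k (fromList P) inj (λ D⊆ pr → non (λ D∈ → ¬c (lose D∈ (pr , All.tabulate (D⊆ ∘ ∈-fromList⁺)))) pr)
          (m≤n+m k _) L′ u′ sub (λ e∈ e′∈ p p∈ → ag e∈ e′∈ (∈-fromList⁻ P p∈))))
      (≤-trans (≤-reflexive (trans (cong (λ j → n ^ j * suc (q * k) ^ k) (lenP P∈)) (*-comm (n ^ r) _))) (*-monoˡ-≤ (n ^ r) (C₀≤ N)))
  ... | yes cov with purify (length L) J L ≤-refl u
  ... | e ∷ F , R , F⊆ , kerF , _ , _ = inj₁ (e ∷ F , J , (e , here refl) , F⊆ , kerF , All.lookup cov)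
  homogeneous-or-small r Ps lenP zero [] leJ L u inj non | yes cov | [] , R , _ , _ , _ , len = inj₂ (≤-trans len z≤n)
  homogeneous-or-small r Ps lenP (suc N) J leJ L u inj non | yes cov | [] , R , _ , _ , RR , len
    with choose {Q = λ D → length (R D) ≤ homC k q N * n ^ r} J sub
    where
    sub : ∀ {D} → D ∈ₗ J → Homog Ps L ⊎ length (R D) ≤ homC k q N * n ^ r
    sub {D} D∈ with homogeneous-or-small r Ps lenP N (filter (λ D′ → ¬? (D′ ≟S D)) J)
          (≤-pred (≤-trans (filter-notAll (λ D′ → ¬? (D′ ≟S D)) J (lose D∈ (λ h → h refl))) leJ)) (R D) (proj₁ (RR D))
          (λ p p′ → inj (proj₁ (proj₂ (RR D) p)) (proj₁ (proj₂ (RR D) p′))) non′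
      where
      -- `D` is no kernel of `R D`, so it can leave `J` without breaking the invariant; any other
      -- kernel of `R D` would be a kernel of `L`.
      non′ : ∀ {D′} → D′ ∉ₗ filter (λ D′ → ¬? (D′ ≟S D)) J → Proper D′ → ∀ {e} → e ∈ₗ R D → ¬ KerAt (R D) D′ e
      non′ {D′} D′∉ pr e∈ ker with D′ ≟S D
      ... | yes refl = proj₂ (proj₂ (RR D) e∈) ker
      ... | no ne = non (λ D′∈ → D′∉ (∈-filter⁺ (λ D′ → ¬? (D′ ≟S D)) D′∈ ne)) pr (proj₁ (proj₂ (RR D) e∈))
                      (KerAt-⊆ (λ x∈ → proj₁ (proj₂ (RR D) x∈)) ker)
    ... | inj₁ (F , J′ , ne , F⊆ , r′) = inj₁ (F , J′ , ne , (λ x∈ → proj₁ (proj₂ (RR D) (F⊆ x∈))) , r′)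
    ... | inj₂ b = inj₂ b
  ... | inj₁ h = inj₁ h
  ... | inj₂ b = inj₂ (≤-trans len (≤-trans (∑-≤ (homC k q N * n ^ r) J b) (≤-trans (*-monoˡ-≤ (homC k q N * n ^ r) leJ)
        (≤-trans (≤-reflexive (sym (*-assoc (suc N) (homC k q N) (n ^ r)))) (*-monoˡ-≤ (n ^ r) (m≤n+m _ (suc (q * k) ^ k)))))))

  homogeneous : ∀ r Ps → (∀ {P} → P ∈ₗ Ps → length P ≡ r) → ∀ L → Unique L → InjOn L →
    homC k q (length (subsets k)) * n ^ r < length L → Homog Ps L
  homogeneous r Ps lenP L u inj lt
    with homogeneous-or-small r Ps lenP (length (subsets k)) (subsets k) ≤-refl L u inj (λ D∉ → ⊥-elim (D∉ (∈-subsets _)))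
  ... | inj₁ h = h
  ... | inj₂ h = ⊥-elim (<⇒≱ lt h)

module _ {k : ℕ} where

  others : List (Fin k) → List (Fin k)
  others ws = filter (λ p → ¬? (p ∈ₗ? ws)) (allFin k)

  length-others : ∀ {ws} → Unique ws → length (others ws) ≡ k ∸ length ws
  length-others {ws} u = trans (sym (m+n∸m≡n (length ws) _)) (cong (_∸ length ws) (trans
    (cong (_+ length (others ws)) (≤-antisym
      (unique-⊆-length FinP._≟_ u (λ x∈ → ∈-filter⁺ (_∈ₗ? ws) (∈-allFin _) x∈))
      (unique-⊆-length FinP._≟_ (UniqueP.filter⁺ (_∈ₗ? ws) (UniqueP.allFin⁺ k)) (λ x∈ → proj₂ (∈-filter⁻ (_∈ₗ? ws) {xs = allFin k} x∈)))))
    (trans (sym (#-¬ (_∈ₗ? ws) (allFin k))) (length-allFin k))))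

module Cohomogeneous {I : Set} {k n : ℕ} (o : I → Fin k → Fin n) (q : ℕ) where

  open Homogeneous o q public

  constant : ℕ
  constant = homC k q (length (subsets k))

  -- Covering every (k - c)-set by a proper member of `J` means, after complementation, that every
  -- c-set contains a nonempty complement of a member. For c = 2 and c = 3 this leaves few possible
  -- shapes of `J`.
  cohomogeneous : ∀ c L → Unique L → InjOn L → constant * n ^ (k ∸ c) < length L →
    ∃ λ F → ∃ λ J → (∃ λ e → e ∈ₗ F) × (∀ {e} → e ∈ₗ F → e ∈ₗ L) × (∀ {D} → D ∈ₗ J → KerIn F D) ×
    (∀ ws → Unique ws → length ws ≡ c → ∃ λ D → D ∈ₗ J × Proper D × (∀ {p} → p ∉ D → p ∈ₗ ws))
  cohomogeneous c L u inj lt with homogeneous (k ∸ c) Ps lenPs L u inj lt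
    where
    u? : ∀ ws → Dec (Unique ws)
    u? = uniqueBy? FinP._≟_
    Ps = map others (filter u? (tuples (allFin k) c))
    lenPs : ∀ {P} → P ∈ₗ Ps → length P ≡ k ∸ c
    lenPs P∈ with _ , ws∈ , refl ← ∈-map⁻ others P∈ =
      let (ws∈′ , uw) = ∈-filter⁻ u? {xs = tuples (allFin k) c} ws∈
      in trans (length-others uw) (cong (k ∸_) (tuples-length c ws∈′))
  ... | F , J , ne , F⊆ , kerF , cov = F , J , ne , F⊆ , kerF , cov′
    where
    cov′ : ∀ ws → Unique ws → length ws ≡ c → ∃ λ D → D ∈ₗ J × Proper D × (∀ {p} → p ∉ D → p ∈ₗ ws)
    cov′ ws uw refl with find (cov (∈-map⁺ others (∈-filter⁺ (uniqueBy? FinP._≟_) (∈-tuples ws (λ _ → ∈-allFin _)) uw)))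
    ... | D , D∈ , pr , all = D , D∈ , pr , λ {p} p∉ → decidable-stable (p ∈ₗ? ws)
          (λ h → p∉ (All.lookup all (∈-filter⁺ (λ p → ¬? (p ∈ₗ? ws)) (∈-allFin p) h)))

-- Edges as tuples of their vertices

at : ∀ {A : Set} → A → List A → ℕ → A
at d []       i       = d
at d (x ∷ xs) zero    = x
at d (x ∷ xs) (suc i) = at d xs i

at-∈ : ∀ {A : Set} (d : A) xs i → i < length xs → at d xs i ∈ₗ xs
at-∈ d (x ∷ xs) zero    lt       = here refl
at-∈ d (x ∷ xs) (suc i) (s≤s lt) = there (at-∈ d xs i lt)

at-onto : ∀ {A : Set} (d : A) {xs x} → x ∈ₗ xs → ∃ λ i → i < length xs × at d xs i ≡ x
at-onto d (here refl) = zero , s≤s z≤n , refl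
at-onto d (there x∈) = let (i , lt , eq) = at-onto d x∈ in suc i , s≤s lt , eq

at-inj : ∀ {A : Set} (d : A) {xs} → Unique xs → ∀ {i j} → i < length xs → j < length xs → at d xs i ≡ at d xs j → i ≡ j
at-inj d {x ∷ xs} (h ∷ u) {zero}  {zero}  p       r       eq = refl
at-inj d {x ∷ xs} (h ∷ u) {zero}  {suc j} p       (s≤s r) eq = ⊥-elim (All.lookup h (at-∈ d xs j r) eq)
at-inj d {x ∷ xs} (h ∷ u) {suc i} {zero}  (s≤s p) r       eq = ⊥-elim (All.lookup h (at-∈ d xs i p) (sym eq))
at-inj d {x ∷ xs} (h ∷ u) {suc i} {suc j} (s≤s p) (s≤s r) eq = cong suc (at-inj d u p r eq)

module Ordering {k n : ℕ} (d : Fin n) where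

  -- The elements in increasing order. The default `d` is never reached for an edge with k elements.
  ord : Subset n → Fin k → Fin n
  ord e p = at d (elems e) (toℕ p)

  private
    bound : ∀ {e : Subset n} → ∣ e ∣ ≡ k → (p : Fin k) → toℕ p < length (elems e)
    bound {e} h p = subst (toℕ p <_) (sym (trans (length-elems e) h)) (FinP.toℕ<n p)

  ord-∈ : ∀ {e} → ∣ e ∣ ≡ k → ∀ p → ord e p ∈ e
  ord-∈ {e} h p = ∈-elems⁻ (at-∈ d (elems e) (toℕ p) (bound {e} h p))

  ord-onto : ∀ {e} → ∣ e ∣ ≡ k → ∀ {x} → x ∈ e → ∃ λ p → ord e p ≡ x
  ord-onto {e} h x∈ with at-onto d (∈-elems⁺ x∈)
  ... | i , lt , eq = fromℕ< lt′ , trans (cong (at d (elems e)) (FinP.toℕ-fromℕ< lt′)) eq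
    where lt′ = subst (i <_) (trans (length-elems e) h) lt

  ord-inj : ∀ {e} → ∣ e ∣ ≡ k → ∀ {p r} → ord e p ≡ ord e r → p ≡ r
  ord-inj {e} h {p} {r} eq = FinP.toℕ-injective (at-inj d (elems-unique e) (bound {e} h p) (bound {e} h r) eq)

  ord-ext : ∀ {e e′} → ∣ e ∣ ≡ k → ∣ e′ ∣ ≡ k → (∀ p → ord e p ≡ ord e′ p) → e ≡ e′
  ord-ext {e} {e′} h h′ eq = ⊆∧∣∣⇒≡
    (λ x∈ → let (p , px) = ord-onto h x∈ in subst (_∈ e′) (trans (sym (eq p)) px) (ord-∈ h′ p))
    (≤-reflexive (trans h′ (sym h)))

fromList-swap : ∀ {k} (i j : Fin k) → fromList (i ∷ j ∷ []) ≡ fromList (j ∷ i ∷ [])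
fromList-swap i j = ⊆-antisym (sw i j) (sw j i)
  where
  sw : ∀ i j {x} → x ∈ fromList (i ∷ j ∷ []) → x ∈ fromList (j ∷ i ∷ [])
  sw i j x∈ with ∈-fromList⁻ (i ∷ j ∷ []) x∈
  ... | here refl         = ∈-fromList⁺ {w = j ∷ i ∷ []} (there (here refl))
  ... | there (here refl) = ∈-fromList⁺ {w = j ∷ i ∷ []} (here refl)

module OrderedFamily {k n : ℕ} (d : Fin n) (q : ℕ) where

  open Ordering {k} d public
  open Cohomogeneous ord q public

  KerIn⇒Ker : ∀ {F L} → (∀ {e} → e ∈ₗ F → e ∈ₗ L) → (∀ {e} → e ∈ₗ L → ∣ e ∣ ≡ k) →
    ∀ ps → KerIn F (fromList ps) → ∀ {e} → e ∈ₗ F → Ker L q (map (ord e) ps)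
  KerIn⇒Ker F⊆ size ps ker {e} e∈ Z le with ker e∈ Z le
  ... | e′ , e′∈ , ag , av = e′ , F⊆ e′∈ ,
        All.tabulate (λ x∈ → case ∈-map⁻ (ord e) x∈ of λ { (p , p∈ , refl) →
          subst (_∈ e′) (sym (ag p (∈-fromList⁺ p∈))) (ord-∈ (size (F⊆ e′∈)) p) }) , mem
    where
    mem : ∀ {z} → z ∈ₗ Z → z ∈ e′ → z ∈ₗ map (ord e) ps
    mem z∈ z∈e′ with ord-onto (size (F⊆ e′∈)) z∈e′
    ... | p , refl with p ∈? fromList ps
    ... | yes p∈ = subst (_∈ₗ map (ord e) ps) (ag p p∈) (∈-map⁺ (ord e) (∈-fromList⁻ ps p∈))
    ... | no p∉ = ⊥-elim (av p p∉ z∈)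

-- Central edges

module Centers {k n : ℕ} (G : KGraph k n) (q : ℕ) (d : Fin n) (5≤k : 5 ≤ k) where

  open Cycles G q
  open OrderedFamily {k} d q

  private
    V = Fin n
    K = Ker (edges G) q

  -- The patterns J that do not force short cycles consist of all sets through one position, the centre.
  Central : Subset n → V → Set
  Central e x = x ∈ e × (∀ y y′ → y ∈ e → y′ ∈ e → K (x ∷ y ∷ y′ ∷ []))

  abstract
    central? : ∀ e → Dec (∃ λ x → Central e x)
    central? e = FinP.any? (λ x → (x ∈? e) ×-dec FinP.all? (λ y → FinP.all? (λ y′ →
      (y ∈? e) →-dec ((y′ ∈? e) →-dec Ker? (edges G) q (x ∷ y ∷ y′ ∷ [])))))

  noncentral : List (Subset n)
  noncentral = filter (¬? ∘ central?) (edges G)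

  private
    module Pattern (m : ℕ) (large : (3 + m) + (3 + m) * k ≤ q) (free : ¬ ContainsCycle (3 + m) G)
      (F : List (Subset n)) (J : List (Subset k)) (e₀ : Subset n) (e₀∈ : e₀ ∈ₗ F)
      (F⊆ : ∀ {e} → e ∈ₗ F → e ∈ₗ noncentral) (kerJ : ∀ {D} → D ∈ₗ J → KerIn F D)
      (cov : ∀ ws → Unique ws → length ws ≡ 2 → ∃ λ D → D ∈ₗ J × Proper D × (∀ {p} → p ∉ D → p ∈ₗ ws)) where

      F⊆G : ∀ {e} → e ∈ₗ F → e ∈ₗ edges G
      F⊆G e∈ = proj₁ (∈-filter⁻ (¬? ∘ central?) {xs = edges G} (F⊆ e∈))

      size : ∀ {e} → e ∈ₗ F → ∣ e ∣ ≡ k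
      size = edge-size ∘ F⊆G

      KerIn⇒K : ∀ ps → KerIn F (fromList ps) → ∀ {e} → e ∈ₗ F → K (map (ord e) ps)
      KerIn⇒K = KerIn⇒Ker F⊆G edge-size

      -- If N is the set of positions that are not Single, every D with ∣N ∖ D∣ ≠ 1 is a kernel; for ∣N∣ ≠ 1
      -- and k ≥ 5 there are three positions all of whose pairs are such D.
      Single : Fin k → Set
      Single a = Any (λ D → a ∉ D × (∀ p → p ∉ D → p ≡ a)) J

      single? : ∀ a → Dec (Single a)
      single? a = any? (λ D → ¬? (a ∈? D) ×-dec FinP.all? (λ p → ¬? (p ∈? D) →-dec (p FinP.≟ a))) J

      -- The complement of the covering set is a nonempty subset of {a, b}, and neither singleton is
      -- available, so it is {a, b} itself.
      pair-complement : ∀ {a b} → a ≢ b → ¬ Single a → ¬ Single b →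
        ∃ λ D → D ∈ₗ J × a ∉ D × b ∉ D × (∀ {p} → p ∉ D → p ∈ₗ a ∷ b ∷ [])
      pair-complement {a} {b} a≢b ¬a ¬b with cov (a ∷ b ∷ []) ((a≢b ∷ []) ∷ [] ∷ []) refl
      ... | D , D∈ , (p , p∉) , sub = D , D∈ ,
            (λ a∈ → ¬b (lose D∈ (only-b a∈ p (sub p∉) p∉ , λ r r∉ → b-only a∈ r (sub r∉) r∉))) ,
            (λ b∈ → ¬a (lose D∈ (only-a b∈ p (sub p∉) p∉ , λ r r∉ → a-only b∈ r (sub r∉) r∉))) , sub
        where
        b-only : a ∈ D → ∀ r → r ∈ₗ a ∷ b ∷ [] → r ∉ D → r ≡ b
        b-only a∈ r (here refl) r∉ = ⊥-elim (r∉ a∈)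
        b-only a∈ r (there (here eq)) r∉ = eq
        a-only : b ∈ D → ∀ r → r ∈ₗ a ∷ b ∷ [] → r ∉ D → r ≡ a
        a-only b∈ r (here eq) r∉ = eq
        a-only b∈ r (there (here refl)) r∉ = ⊥-elim (r∉ b∈)
        only-b : a ∈ D → ∀ r → r ∈ₗ a ∷ b ∷ [] → r ∉ D → b ∉ D
        only-b a∈ r r∈ r∉ = subst (_∉ D) (b-only a∈ r r∈ r∉) r∉
        only-a : b ∈ D → ∀ r → r ∈ₗ a ∷ b ∷ [] → r ∉ D → a ∉ D
        only-a b∈ r r∈ r∉ = subst (_∉ D) (a-only b∈ r r∈ r∉) r∉

      -- Closure under intersection: a single position p is removed by the set with complement {p},
      -- a non-single p by the set with complement {p, p′}, where p′ is another non-single position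
      -- outside `D`.
      kernel : ∀ D → (∀ p → p ∉ D → ¬ Single p → ∃ λ p′ → p′ ≢ p × p′ ∉ D × ¬ Single p′) → KerIn F D
      kernel D h = KerIn-cover D go
        where
        go : ∀ p → p ∉ D → ∃ λ D′ → (∀ {r} → r ∈ D → r ∈ D′) × p ∉ D′ × KerIn F D′
        go p p∉ with single? p
        ... | yes s = let (D′ , D′∈ , p∉′ , only) = find s in D′ ,
              (λ {r} r∈ → decidable-stable (r ∈? D′) (λ r∉ → p∉ (subst (_∈ D) (only r r∉) r∈))) , p∉′ , kerJ D′∈
        ... | no ¬s with h p p∉ ¬s
        ... | p′ , ne , p′∉ , ¬s′ with pair-complement (ne ∘ sym) ¬s ¬s′
        ... | D′ , D′∈ , p∉′ , _ , sub = D′ , (λ {r} r∈ → decidable-stable (r ∈? D′) (λ r∉ → case sub r∉ of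
                λ { (here refl) → p∉ r∈ ; (there (here refl)) → p′∉ r∈ })) , p∉′ , kerJ D′∈

      Pair : Fin k → Fin k → Set
      Pair i j = KerIn F (fromList (i ∷ j ∷ []))

      pair : ∀ {i j} u v → u ≢ v → ¬ Single u → ¬ Single v → u ∉ₗ i ∷ j ∷ [] → v ∉ₗ i ∷ j ∷ [] → Pair i j
      pair {i} {j} u v u≢v ¬u ¬v u∉ v∉ = kernel _ λ p p∉ ¬p → case p FinP.≟ u of λ
        { (yes refl) → v , (u≢v ∘ sym) , v∉ ∘ ∈-fromList⁻ (i ∷ j ∷ []) , ¬v
        ; (no ne) → u , (ne ∘ sym) , u∉ ∘ ∈-fromList⁻ (i ∷ j ∷ []) , ¬u }

      Q : V → V → V → Set
      Q a b c = ∃ λ e → e ∈ₗ F × ∃ λ i → ∃ λ j → ∃ λ l → (i ≢ j × j ≢ l × i ≢ l) × (Pair i j × Pair j l × Pair i l) ×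
        ord e i ≡ a × ord e j ≡ b × ord e l ≡ c

      -- The kernel at positions i and l supplies an edge through the same two vertices whose vertex
      -- at position j is new. This is the gluing step of `polygon`, so one triangle of pair kernels
      -- already gives the forbidden cycle.
      triangle : ∀ i j l → i ≢ j → j ≢ l → i ≢ l → Pair i j → Pair j l → Pair i l → ⊥
      triangle i j l ij jl il kij kjl kil = free (polygon Q sides ext m large
          (e₀ , e₀∈ , i , j , l , (ij , jl , il) , (kij , kjl , kil) , refl , refl , refl))
        where
        sides : ∀ {a b c} → Q a b c → a ≢ b × b ≢ c × a ≢ c × K (a ∷ b ∷ []) × K (b ∷ c ∷ []) × K (a ∷ c ∷ [])
        sides (e , e∈ , i , j , l , (ij , jl , il) , (kij , kjl , kil) , refl , refl , refl) =
          ij ∘ ord-inj {e} (size e∈) , jl ∘ ord-inj {e} (size e∈) , il ∘ ord-inj {e} (size e∈) ,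
          KerIn⇒K (i ∷ j ∷ []) kij e∈ , KerIn⇒K (j ∷ l ∷ []) kjl e∈ , KerIn⇒K (i ∷ l ∷ []) kil e∈
        ext : ∀ {a b c} → Q a b c → ∀ Z → length Z ≤ q → ∃ λ w → w ∉ₗ Z × Q a c w
        ext (e , e∈ , i , j , l , (ij , jl , il) , (kij , kjl , kil) , refl , refl , refl) Z le with kil e∈ Z le
        ... | e′ , e′∈ , ag , av = ord e′ j , av j (λ j∈ → case ∈-fromList⁻ (i ∷ l ∷ []) j∈ of
                λ { (here eq) → ij (sym eq) ; (there (here eq)) → jl eq }) ,
              e′ , e′∈ , i , l , j , (il , jl ∘ sym , ij) , (kil , subst (KerIn F) (fromList-swap j l) kjl , kij) ,
              sym (ag i (∈-fromList⁺ {w = i ∷ l ∷ []} (here refl))) ,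
              sym (ag l (∈-fromList⁺ {w = i ∷ l ∷ []} (there (here refl)))) , refl

      -- If every position but c is single, every set of positions containing c is an intersection
      -- of kernels, and e₀ would be central.
      not-central : ∀ c → (∀ p → p ≢ c → Single p) → ⊥
      not-central c h = proj₂ (∈-filter⁻ (¬? ∘ central?) {xs = edges G} (F⊆ e₀∈)) (ord e₀ c , ord-∈ (size e₀∈) c , ker)
        where
        ker : ∀ y y′ → y ∈ e₀ → y′ ∈ e₀ → K (ord e₀ c ∷ y ∷ y′ ∷ [])
        ker y y′ y∈ y′∈ with ord-onto (size e₀∈) y∈ | ord-onto (size e₀∈) y′∈
        ... | p , refl | p′ , refl = KerIn⇒K (c ∷ p ∷ p′ ∷ []) (kernel _ (λ r r∉ ¬s →
                ⊥-elim (¬s (h r (λ { refl → r∉ (∈-fromList⁺ {w = c ∷ p ∷ p′ ∷ []} (here refl)) }))))) e₀∈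

      private
        2∉ : ∀ {a i j : Fin k} → a ≢ i → a ≢ j → a ∉ₗ i ∷ j ∷ []
        2∉ ai aj (here eq) = ai eq
        2∉ ai aj (there (here eq)) = aj eq

        diff : ∀ {a s} → ¬ Single a → Single s → a ≢ s
        diff ¬a s refl = ¬a s

        two : ∀ {a b p₁ p₂ p₃} → a ≢ b → ¬ Single a → ¬ Single b → p₁ ≢ p₂ → p₂ ≢ p₃ → p₁ ≢ p₃ →
          Single p₁ → Single p₂ → Single p₃ → ⊥
        two {a} {b} {p₁} {p₂} {p₃} ab na nb p12 p23 p13 s₁ s₂ s₃ =
          triangle p₁ p₂ p₃ p12 p23 p13 (go s₁ s₂) (go s₂ s₃) (go s₁ s₃)
          where
          go : ∀ {i j} → Single i → Single j → Pair i j
          go si sj = pair a b ab na nb (2∉ (diff na si) (diff na sj)) (2∉ (diff nb si) (diff nb sj))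

        three : ∀ {a b c p₁ p₂} → a ≢ b → b ≢ c → a ≢ c → ¬ Single a → ¬ Single b → ¬ Single c → p₁ ≢ p₂ →
          Single p₁ → Single p₂ → ⊥
        three {a} {b} {c} {p₁} {p₂} ab bc ac na nb nc p12 s₁ s₂ =
          triangle p₁ p₂ a p12 (diff na s₂ ∘ sym) (diff na s₁ ∘ sym)
            (pair a b ab na nb (2∉ (diff na s₁) (diff na s₂)) (2∉ (diff nb s₁) (diff nb s₂)))
            (pair b c bc nb nc (2∉ (diff nb s₂) (ab ∘ sym)) (2∉ (diff nc s₂) (ac ∘ sym)))
            (pair b c bc nb nc (2∉ (diff nb s₁) (ab ∘ sym)) (2∉ (diff nc s₁) (ac ∘ sym)))

        four : ∀ {a b c d} → a ≢ b → b ≢ c → a ≢ c → a ≢ d → b ≢ d → c ≢ d →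
          ¬ Single a → ¬ Single b → ¬ Single c → ¬ Single d → ⊥
        four {a} {b} {c} {d} ab bc ac ad bd cd na nb nc nd =
          triangle a b c ab bc ac
            (pair c d cd nc nd (2∉ (ac ∘ sym) (bc ∘ sym)) (2∉ (ad ∘ sym) (bd ∘ sym)))
            (pair a d ad na nd (2∉ ab ac) (2∉ (bd ∘ sym) (cd ∘ sym)))
            (pair b d bd nb nd (2∉ (ab ∘ sym) bc) (2∉ (ad ∘ sym) (cd ∘ sym)))

        0∈ : ∀ {A : Set} {x : A} {xs} → x ∈ₗ x ∷ xs
        0∈ = here refl
        1∈ : ∀ {A : Set} {x y : A} {xs} → x ∈ₗ y ∷ x ∷ xs
        1∈ = there (here refl)
        2∈ : ∀ {A : Set} {x y z : A} {xs} → x ∈ₗ y ∷ z ∷ x ∷ xs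
        2∈ = there (there (here refl))
        3∈ : ∀ {A : Set} {x y z w : A} {xs} → x ∈ₗ y ∷ z ∷ w ∷ x ∷ xs
        3∈ = there (there (there (here refl)))

        head≢ : ∀ {A : Set} {x y : A} {xs} → Unique (x ∷ xs) → y ∈ₗ xs → x ≢ y
        head≢ (h ∷ _) y∈ = All.lookup h y∈

        tail-unique : ∀ {A : Set} {x : A} {xs} → Unique (x ∷ xs) → Unique xs
        tail-unique (_ ∷ u) = u

        -- `N` holds the non-single and `A` the single positions. Each side of the triangle must
        -- leave two non-single positions outside it: with two of them the triangle takes three
        -- single positions, with three it takes two, with four it takes none. That is where k ≥ 5
        -- enters. With at most one non-single position the pattern is central.
        cases : ∀ N A → Unique N → Unique A → (∀ {p} → p ∈ₗ N → ¬ Single p) → (∀ {p} → p ∈ₗ A → Single p) →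
          (∀ {p} → p ∉ₗ N → Single p) → 5 ≤ length A + length N → ⊥
        cases [] [] _ _ _ _ _ ()
        cases [] (p ∷ _) _ _ _ _ all _ = not-central p (λ r _ → all (λ ()))
        cases (c ∷ []) _ _ _ _ _ all _ = not-central c (λ r ne → all (λ { (here eq) → ne eq }))
        cases (a ∷ b ∷ []) [] _ _ _ _ _ (s≤s (s≤s ()))
        cases (a ∷ b ∷ []) (_ ∷ []) _ _ _ _ _ (s≤s (s≤s (s≤s ())))
        cases (a ∷ b ∷ []) (_ ∷ _ ∷ []) _ _ _ _ _ (s≤s (s≤s (s≤s (s≤s ()))))
        cases (a ∷ b ∷ []) (p₁ ∷ p₂ ∷ p₃ ∷ _) uN uA nonS isS _ _ =
          two (head≢ uN 0∈) (nonS 0∈) (nonS 1∈) (head≢ uA 0∈) (head≢ (tail-unique uA) 0∈) (head≢ uA 1∈) (isS 0∈) (isS 1∈) (isS 2∈)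
        cases (a ∷ b ∷ c ∷ []) [] _ _ _ _ _ (s≤s (s≤s (s≤s ())))
        cases (a ∷ b ∷ c ∷ []) (_ ∷ []) _ _ _ _ _ (s≤s (s≤s (s≤s (s≤s ()))))
        cases (a ∷ b ∷ c ∷ []) (p₁ ∷ p₂ ∷ _) uN uA nonS isS _ _ =
          three (head≢ uN 0∈) (head≢ (tail-unique uN) 0∈) (head≢ uN 1∈) (nonS 0∈) (nonS 1∈) (nonS 2∈) (head≢ uA 0∈) (isS 0∈) (isS 1∈)
        cases (a ∷ b ∷ c ∷ d ∷ _) _ uN _ nonS _ _ _ =
          four (head≢ uN 0∈) (head≢ (tail-unique uN) 0∈) (head≢ uN 1∈) (head≢ uN 2∈) (head≢ (tail-unique uN) 1∈)
            (head≢ (tail-unique (tail-unique uN)) 0∈) (nonS 0∈) (nonS 1∈) (nonS 2∈) (nonS 3∈)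

      inconsistent : ⊥
      inconsistent = cases (filter (¬? ∘ single?) (allFin k)) (filter single? (allFin k))
        (UniqueP.filter⁺ (¬? ∘ single?) (UniqueP.allFin⁺ k)) (UniqueP.filter⁺ single? (UniqueP.allFin⁺ k))
        (λ p∈ → proj₂ (∈-filter⁻ (¬? ∘ single?) {xs = allFin k} p∈))
        (λ p∈ → proj₂ (∈-filter⁻ single? {xs = allFin k} p∈))
        (λ {p} p∉ → decidable-stable (single? p) (λ ¬s → p∉ (∈-filter⁺ (¬? ∘ single?) (∈-allFin p) ¬s)))
        (subst (5 ≤_) (trans (sym (length-allFin k)) (#-¬ single? (allFin k))) 5≤k)

  #-noncentral : ∀ m → (3 + m) + (3 + m) * k ≤ q → ¬ ContainsCycle (3 + m) G →
    length noncentral ≤ constant * n ^ (k ∸ 2)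
  #-noncentral m large free = decidable-stable (_ ≤? _) λ ¬h →
    let (F , J , (e₀ , e₀∈) , F⊆ , kerJ , cov) = cohomogeneous 2 noncentral (UniqueP.filter⁺ (¬? ∘ central?) (unique G)) inj (≰⇒> ¬h)
    in Pattern.inconsistent m large free F J e₀ e₀∈ F⊆ kerJ cov
    where
    inj : InjOn noncentral
    inj p r = ord-ext (edge-size (proj₁ (∈-filter⁻ (¬? ∘ central?) {xs = edges G} p)))
                      (edge-size (proj₁ (∈-filter⁻ (¬? ∘ central?) {xs = edges G} r)))

-- Families with large codegrees

private
  variable
    n : ℕ

-- An edge containing r has just one further vertex.
extras : ∀ {k} {r : List (Fin n)} {Fr ys} → Unique r → suc (length r) ≡ k → Unique Fr →
  (∀ {e} → e ∈ₗ Fr → ∣ e ∣ ≡ k × All (_∈ e) r) →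
  (∀ {e} → e ∈ₗ Fr → ∃ λ y → y ∈ₗ ys × y ∈ e × y ∉ₗ r) → length Fr ≤ length ys
extras {r = r} {Fr} {ys} ur lr uF hF h = subst (length Fr ≤_) (*-identityʳ _)
  (union-bound-const Q? 1 Fr ys h
    (λ {y} _ → all-equal⇒length≤1 (UniqueP.filter⁺ (Q? y) uF) (λ p p′ →
      let (e∈ , y∈ , y∉) = ∈-filter⁻ (Q? y) {xs = Fr} p ; (e′∈ , y∈′ , _) = ∈-filter⁻ (Q? y) {xs = Fr} p′
      in trans (sym (same y e∈ y∈ y∉)) (same y e′∈ y∈′ y∉))))
  where
  Q? : ∀ y e → Dec (y ∈ e × y ∉ₗ r)
  Q? y e = (y ∈? e) ×-dec ¬? (y ∈ₗ? r)
  same : ∀ y {e} → e ∈ₗ Fr → y ∈ e → y ∉ₗ r → fromList (y ∷ r) ≡ e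
  same y e∈ y∈ y∉ = ⊆∧∣∣⇒≡ (λ x∈ → case ∈-fromList⁻ (y ∷ r) x∈ of λ { (here refl) → y∈ ; (there x∈′) → All.lookup (proj₂ (hF e∈)) x∈′ })
    (≤-reflexive (trans (proj₁ (hF e∈)) (trans (sym lr) (sym (∣fromList∣ (Unique-∷ y∉ ur))))))

extra : ∀ {r : List (Fin n)} {e} → length r < ∣ e ∣ → ∃ λ y → y ∈ e × y ∉ₗ r
extra {r = r} {e} lt = let (y , y∈ , y∉) = fresh-pick FinP._≟_ r id (elems-unique e) (λ _ _ → id)
                                            (subst (length r <_) (sym (length-elems e)) lt)
                       in y , ∈-elems⁻ y∈ , y∉

extend-avoiding : ∀ {k} {r : List (Fin n)} {Fr} Z → Unique r → suc (length r) ≡ k → Unique Fr →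
  (∀ {e} → e ∈ₗ Fr → ∣ e ∣ ≡ k × All (_∈ e) r) → length Z < length Fr →
  ∃ λ e → e ∈ₗ Fr × (∀ {z} → z ∈ₗ Z → z ∈ e → z ∈ₗ r)
extend-avoiding {r = r} {Fr} Z ur lr uF hF lt with any? (λ e → all? (λ z → (z ∈? e) →-dec (z ∈ₗ? r)) Z) Fr
... | yes p = let (e , e∈ , h) = find p in e , e∈ , All.lookup h
... | no ¬p = ⊥-elim (<⇒≱ lt (extras ur lr uF hF hit))
  where
  hit : ∀ {e} → e ∈ₗ Fr → ∃ λ y → y ∈ₗ Z × y ∈ e × y ∉ₗ r
  hit {e} e∈ with any? (λ z → (z ∈? e) ×-dec ¬? (z ∈ₗ? r)) Z
  ... | yes h = find h
  ... | no ¬h = ⊥-elim (¬p (lose e∈ (All.tabulate (λ {z} z∈ z∈e → decidable-stable (z ∈ₗ? r) (λ z∉ → ¬h (lose z∈ (z∈e , z∉)))))))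

rest-⊆ : ∀ {k} {r : List (Fin n)} {e y} → Unique r → suc (length r) ≡ k → ∣ e ∣ ≡ k → All (_∈ e) r → y ∈ e → y ∉ₗ r →
  ∀ {x} → x ∈ e → x ≢ y → x ∈ₗ r
rest-⊆ {r = r} {e} {y} ur lr he re y∈ y∉ x∈ x≢y with Unique-⊇-elems {w = y ∷ r} (Unique-∷ y∉ ur)
    (λ { (here refl) → y∈ ; (there z∈) → All.lookup re z∈ }) (≤-reflexive (trans he (sym lr))) x∈
... | here eq  = ⊥-elim (x≢y eq)
... | there x∈r = x∈r

module Sparse {k n : ℕ} (G : KGraph k n) (q m : ℕ) (3≤k : 3 ≤ k)
  (large : (3 + m) + (3 + m) * k ≤ q) (free : ¬ ContainsCycle (3 + m) G) where

  open Cycles G q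

  private
    V = Fin n
    K = Ker (edges G) q

  -- Clean with the (k - 1)-sets in `rs` as reasons. In a nonempty remainder an edge minus any
  -- vertex extends to more than q edges, so every subset of an edge is a kernel, and triples inside
  -- edges glue to a polygon of the forbidden length. Hence nothing remains.
  sparse : ∀ B rs → Unique B → (∀ {e} → e ∈ₗ B → e ∈ₗ edges G) →
    (∀ {e y} → e ∈ₗ B → y ∈ e → ∃ λ r → r ∈ₗ rs × Unique r × suc (length r) ≡ k × All (_∈ e) r × y ∉ₗ r) →
    length B ≤ length rs * q
  sparse B rs uB B⊆ reason with clean rs B uB
    where open Cleaning {Rsn = λ r e → All (_∈ e) r} (λ r e → all? (_∈? e) r) q
  ... | [] , _ , _ , _ , len = ≤-trans len (≤-reflexive (+-identityʳ _))
  ... | F@(e₀ ∷ _) , F⊆ , uF , full , _ = ⊥-elim (free (polygon Q sides ext m large start))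
    where
    size : ∀ {e} → e ∈ₗ F → ∣ e ∣ ≡ k
    size e∈ = edge-size (B⊆ (F⊆ e∈))
    has? : ∀ r e → Dec (All (_∈ e) r)
    has? r e = all? (_∈? e) r
    swap : ∀ {e y} → e ∈ₗ F → y ∈ e → ∀ Z → length Z ≤ q →
      ∃ λ e′ → e′ ∈ₗ F × (∀ {x} → x ∈ e → x ≢ y → x ∈ e′) × (∀ {z} → z ∈ₗ Z → z ∈ e′ → z ∈ e × z ≢ y)
    swap {e} {y} e∈ y∈ Z le =
      let (r , r∈ , ur , lr , re , y∉) = reason (F⊆ e∈) y∈
          (e′ , e′∈ , av) = extend-avoiding Z ur lr (UniqueP.filter⁺ (has? r) uF)
            (λ p → let (p∈ , h) = ∈-filter⁻ (has? r) {xs = F} p in size p∈ , h)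
            (≤-trans (s≤s le) (full e∈ r∈ re))
          (e′∈F , re′) = ∈-filter⁻ (has? r) {xs = F} e′∈
      in e′ , e′∈F , (λ x∈ x≢y → All.lookup re′ (rest-⊆ ur lr (size e∈) re y∈ y∉ x∈ x≢y)) ,
         (λ z∈ z∈e′ → All.lookup re (av z∈ z∈e′) , λ { refl → y∉ (av z∈ z∈e′) })
    KF : ∀ {e} → e ∈ₗ F → ∀ {D} → All (_∈ e) D → Ker F q D
    KF {e} e∈ {D} De Z le = let (e′ , e′∈ , De′ , av) = go Z id in e′ , e′∈ , De′ , av
      where
      go : ∀ zs → (∀ {z} → z ∈ₗ zs → z ∈ₗ Z) → ∃ λ e′ → e′ ∈ₗ F × All (_∈ e′) D × (∀ {z} → z ∈ₗ zs → z ∈ e′ → z ∈ₗ D)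
      go [] _ = e , e∈ , De , λ ()
      go (z ∷ zs) sub with go zs (sub ∘ there)
      ... | e′ , e′∈ , De′ , av with z ∈? e′ | z ∈ₗ? D
      ... | no z∉  | _      = e′ , e′∈ , De′ , λ { (here refl) h → ⊥-elim (z∉ h) ; (there w∈) → av w∈ }
      ... | yes _  | yes z∈ = e′ , e′∈ , De′ , λ { (here refl) _ → z∈ ; (there w∈) → av w∈ }
      -- z is exchanged for a vertex outside all of `Z`, so vertices already cleared do not come
      -- back.
      ... | yes z∈ | no z∉  with swap e′∈ z∈ Z le
      ... | e″ , e″∈ , keep , av″ = e″ , e″∈ , All.tabulate (λ x∈ → keep (All.lookup De′ x∈) (λ { refl → z∉ x∈ })) ,
            λ { (here refl) h → ⊥-elim (proj₂ (av″ (sub (here refl)) h) refl)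
              ; (there w∈) h → av w∈ (proj₁ (av″ (sub (there w∈)) h)) }
    Q : V → V → V → Set
    Q a b c = ∃ λ e → e ∈ₗ F × (a ∈ e × b ∈ e × c ∈ e) × (a ≢ b × b ≢ c × a ≢ c)
    KG : ∀ {D} → Ker F q D → K D
    KG = Ker-⊆ (B⊆ ∘ F⊆)
    sides : ∀ {a b c} → Q a b c → a ≢ b × b ≢ c × a ≢ c × K (a ∷ b ∷ []) × K (b ∷ c ∷ []) × K (a ∷ c ∷ [])
    sides (e , e∈ , (a∈ , b∈ , c∈) , ab , bc , ac) = ab , bc , ac ,
      KG (KF e∈ (a∈ ∷ b∈ ∷ [])) , KG (KF e∈ (b∈ ∷ c∈ ∷ [])) , KG (KF e∈ (a∈ ∷ c∈ ∷ []))
    more : ∀ {e} → e ∈ₗ F → ∀ r → length r ≤ 2 → ∃ λ y → y ∈ e × y ∉ₗ r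
    more {e} e∈ r le = extra {r = r} {e} (≤-trans (s≤s le) (≤-trans 3≤k (≤-reflexive (sym (size e∈)))))
    ext : ∀ {a b c} → Q a b c → ∀ Z → length Z ≤ q → ∃ λ w → w ∉ₗ Z × Q a c w
    ext {a} {b} {c} (e , e∈ , (a∈ , b∈ , c∈) , ab , bc , ac) Z le with KF e∈ (a∈ ∷ c∈ ∷ []) Z le
    ... | e′ , e′∈ , (a∈′ ∷ c∈′ ∷ []) , av with more e′∈ (a ∷ c ∷ []) ≤-refl
    ... | w , w∈ , w∉ = w , (λ z∈ → w∉ (av z∈ w∈)) , e′ , e′∈ , (a∈′ , c∈′ , w∈) ,
          ac , (λ { refl → w∉ (there (here refl)) }) , (λ { refl → w∉ (here refl) })
    start : Q _ _ _
    start = let e₀∈ = here refl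
                (a , a∈ , _) = more e₀∈ [] z≤n
                (b , b∈ , b∉) = more e₀∈ (a ∷ []) (s≤s z≤n)
                (c , c∈ , c∉) = more e₀∈ (a ∷ b ∷ []) ≤-refl
            in e₀ , e₀∈ , (a∈ , b∈ , c∈) , (λ eq → b∉ (here (sym eq))) , (λ eq → c∉ (there (here (sym eq)))) , (λ eq → c∉ (here (sym eq)))

  V³ V⁴ : Set
  V³ = V × V × V
  V⁴ = V × V × V × V

  all³ : List V³
  all³ = cartesianProduct (allFin n) (cartesianProduct (allFin n) (allFin n))

  all⁴ : List V⁴
  all⁴ = cartesianProduct (allFin n) all³

  -- Three faces of a tetrahedron, those at the apex x, are kernels. Any three vertices of a central
  -- edge form a triad with its centre, so a bound on triads limits what centres can carry.
  Triad : V⁴ → Set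
  Triad (a , b , c , x) = (a ≢ b × b ≢ c × a ≢ c) × K (x ∷ a ∷ b ∷ []) × K (x ∷ b ∷ c ∷ []) × K (x ∷ a ∷ c ∷ [])

  abstract
    triad? : ∀ w → Dec (Triad w)
    triad? (a , b , c , x) = (¬? (a FinP.≟ b) ×-dec (¬? (b FinP.≟ c) ×-dec ¬? (a FinP.≟ c))) ×-dec
      (Ker? (edges G) q (x ∷ a ∷ b ∷ []) ×-dec (Ker? (edges G) q (x ∷ b ∷ c ∷ []) ×-dec Ker? (edges G) q (x ∷ a ∷ c ∷ [])))

  triads : List V⁴
  triads = filter triad? all⁴

  ∈-triads : ∀ {w} → Triad w → w ∈ₗ triads
  ∈-triads t = ∈-filter⁺ triad? (∈-cartesianProduct⁺ (∈-allFin _) (∈-cartesianProduct⁺ (∈-allFin _) (∈-cartesianProduct⁺ (∈-allFin _) (∈-allFin _)))) t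

  private
    face : Fin 3 → V⁴ → V³
    face zero             (a , b , c , x) = a , b , c
    face (suc zero)       (a , b , c , x) = a , b , x
    face (suc (suc zero)) (a , b , c , x) = a , c , x

    corner : Fin 3 → V⁴ → V
    corner zero             (a , b , c , x) = x
    corner (suc zero)       (a , b , c , x) = c
    corner (suc (suc zero)) (a , b , c , x) = b

    face-corner : ∀ i {v w} → face i v ≡ face i w → corner i v ≡ corner i w → v ≡ w
    face-corner zero             refl refl = refl
    face-corner (suc zero)       refl refl = refl
    face-corner (suc (suc zero)) refl refl = refl

    _≟³_ : DecidableEquality V³
    _≟³_ = ×-≡-dec FinP._≟_ (×-≡-dec FinP._≟_ FinP._≟_)

    onFace? : ∀ (r : Fin 3 × V³) w → Dec (face (proj₁ r) w ≡ proj₂ r)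
    onFace? (i , r) w = face i w ≟³ r

  -- After cleaning, every pair of a triad has many apexes, so it is a kernel, and triads can be glued to a fan.
  #-triads : length triads ≤ 3 * (n * (n * n)) * q
  #-triads with clean rs triads (UniqueP.filter⁺ triad? all⁴-unique)
    where
    open Cleaning onFace? q
    rs = cartesianProduct (allFin 3) all³
    u² = UniqueP.cartesianProduct⁺ (UniqueP.allFin⁺ n) (UniqueP.allFin⁺ n)
    all⁴-unique : Unique all⁴
    all⁴-unique = UniqueP.cartesianProduct⁺ (UniqueP.allFin⁺ n) (UniqueP.cartesianProduct⁺ (UniqueP.allFin⁺ n) u²)
  ... | [] , _ , _ , _ , len = ≤-trans len (≤-reflexive (trans (+-identityʳ _) (cong (_* q)
          (trans (length-cpw _,_ (allFin 3) all³) (cong (3 *_) (trans (length-cpw _,_ (allFin n) _)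
            (cong₂ _*_ (length-allFin n) (trans (length-cpw _,_ (allFin n) (allFin n)) (cong₂ _*_ (length-allFin n) (length-allFin n))))))))))
  ... | F@((a₀ , b₀ , c₀ , x₀) ∷ _) , F⊆ , uF , full , _ = ⊥-elim (free (polygon Q sides ext m large {a₀} {b₀} {c₀} (x₀ , inj₁ (here refl))))
    where
    isTriad : ∀ {w} → w ∈ₗ F → Triad w
    isTriad w∈ = proj₂ (∈-filter⁻ triad? {xs = all⁴} (F⊆ w∈))
    move : ∀ i {w} → w ∈ₗ F → ∀ Z → length Z ≤ q → ∃ λ w′ → w′ ∈ₗ F × face i w′ ≡ face i w × corner i w′ ∉ₗ Z
    move i {w} w∈ Z le =
      let r = i , face i w
          (w′ , w′∈ , av) = fresh-pick FinP._≟_ Z (corner i) (UniqueP.filter⁺ (onFace? r) uF)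
            (λ p p′ eq → face-corner i (trans (proj₂ (∈-filter⁻ (onFace? r) {xs = F} p)) (sym (proj₂ (∈-filter⁻ (onFace? r) {xs = F} p′)))) eq)
            (≤-trans (s≤s le) (full w∈ (∈-cartesianProduct⁺ (∈-allFin i) (∈-cartesianProduct⁺ (∈-allFin _) (∈-cartesianProduct⁺ (∈-allFin _) (∈-allFin _)))) refl))
          (w′∈F , eq) = ∈-filter⁻ (onFace? r) {xs = F} w′∈
      in w′ , w′∈F , eq , av
    -- Both orders are needed, because the new corner of the glued triad stands alternately in the
    -- second and the third place.
    Q : V → V → V → Set
    Q a b c = ∃ λ x → (a , b , c , x) ∈ₗ F ⊎ (a , c , b , x) ∈ₗ F
    drop : ∀ {x y z Z} {e : Subset n} → x ∉ₗ Z → (∀ {w} → w ∈ₗ Z → w ∈ e → w ∈ₗ x ∷ y ∷ z ∷ []) →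
      ∀ {w} → w ∈ₗ Z → w ∈ e → w ∈ₗ y ∷ z ∷ []
    drop x∉ h w∈ w∈e with h w∈ w∈e
    ... | here refl = ⊥-elim (x∉ w∈)
    ... | there p   = p
    sides′ : ∀ {a b c x} → (a , b , c , x) ∈ₗ F → a ≢ b × b ≢ c × a ≢ c × K (a ∷ b ∷ []) × K (b ∷ c ∷ []) × K (a ∷ c ∷ [])
    sides′ {a} {b} {c} {x} w∈ = ab , bc , ac , side (λ t → proj₁ (proj₂ t)) , side (λ t → proj₁ (proj₂ (proj₂ t))) , side (λ t → proj₂ (proj₂ (proj₂ t)))
      where
      ab = proj₁ (proj₁ (isTriad w∈))
      bc = proj₁ (proj₂ (proj₁ (isTriad w∈)))
      ac = proj₂ (proj₂ (proj₁ (isTriad w∈)))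
      side : ∀ {y z} → (∀ {x} → Triad (a , b , c , x) → K (x ∷ y ∷ z ∷ [])) → K (y ∷ z ∷ [])
      side {y} {z} f Z le with move zero w∈ Z le
      -- The apex is moved off `Z` first; the edge supplied by the face kernel then meets `Z` only
      -- in y and z.
      ... | (a , b , c , x′) , w′∈ , refl , x′∉ with f (isTriad w′∈) Z le
      ... | e , e∈ , (_ ∷ De) , av = e , e∈ , De , drop x′∉ av
    sides : ∀ {a b c} → Q a b c → a ≢ b × b ≢ c × a ≢ c × K (a ∷ b ∷ []) × K (b ∷ c ∷ []) × K (a ∷ c ∷ [])
    sides (x , inj₁ w∈) = sides′ w∈
    sides (x , inj₂ w∈) with sides′ w∈
    ... | ac , cb , ab , kac , kcb , kab = ab , cb ∘ sym , ac , kab , Ker-swap kcb , kac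
    ext : ∀ {a b c} → Q a b c → ∀ Z → length Z ≤ q → ∃ λ w → w ∉ₗ Z × Q a c w
    ext {a} {b} {c} (x , inj₁ w∈) Z le with move (suc (suc zero)) w∈ Z le
    ... | (a , b′ , c , x) , w′∈ , refl , b′∉ = b′ , b′∉ , x , inj₂ w′∈
    ext {a} {b} {c} (x , inj₂ w∈) Z le with move (suc zero) w∈ Z le
    ... | (a , c , w′ , x) , w′∈ , refl , w′∉ = w′ , w′∉ , x , inj₁ w′∈

-- Centres

∑-≥-filter : ∀ {A : Set} {f : A → ℕ} {P : A → Set} (P? : Decidable P) c xs → (∀ {x} → P x → c ≤ f x) → # P? xs * c ≤ ∑ f xs
∑-≥-filter P? c [] h = z≤n
∑-≥-filter {f = f} P? c (x ∷ xs) h with P? x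
... | yes p = +-mono-≤ (h p) (∑-≥-filter P? c xs h)
... | no _  = ≤-trans (∑-≥-filter P? c xs h) (m≤n+m _ (f x))

module Heavy {j n : ℕ} (G : KGraph (5 + j) n) (q m : ℕ) (d : Fin n)
  (large : (3 + m) + (3 + m) * (5 + j) ≤ q) (free : ¬ ContainsCycle (3 + m) G) (dd : ℕ) where

  private
    k = 5 + j
    V = Fin n
    K = Ker (edges G) q

  open Cycles G q using (edge-size)
  open Centers G q d (s≤s (s≤s (s≤s (s≤s (s≤s z≤n))))) public
  open Sparse G q m (s≤s (s≤s (s≤s z≤n))) large free public

  central : List (Subset n)
  central = filter central? (edges G)

  abstract
    cen : Subset n → V
    cen e with central? e
    ... | yes (x , _) = x
    ... | no _        = d

    cen-central : ∀ {e} → e ∈ₗ central → Central e (cen e)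
    cen-central {e} e∈ with central? e | proj₂ (∈-filter⁻ central? {xs = edges G} e∈)
    ... | yes (x , h) | _ = h
    ... | no ¬h       | h = ⊥-elim (¬h h)

  -- For an edge with its centre, a reason leaves just one vertex open. Requiring a triad cuts the
  -- number of reasons from n^(k - 1) to O(n^(k - 2)), so that losing dd edges for each is
  -- affordable even with dd of order n.
  reasons : List (V × List V)
  reasons = cartesianProductWith (λ (a , b , c , x) w → x , a ∷ b ∷ c ∷ w) triads (vtuples j)

  hasReason? : ∀ (r : V × List V) e → Dec (cen e ≡ proj₁ r × All (_∈ e) (proj₂ r))
  hasReason? (x , r) e = (cen e FinP.≟ x) ×-dec all? (_∈? e) r

  open Cleaning hasReason? dd using (clean; Full)

  private abstract
    cleaned : ∃ λ F → (∀ {e} → e ∈ₗ F → e ∈ₗ central) × Unique F × Full reasons F ×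
      length central ≤ length reasons * dd + length F
    cleaned = clean reasons central (UniqueP.filter⁺ central? (unique G))

  core : List (Subset n)
  core = proj₁ cleaned

  core⊆central : ∀ {e} → e ∈ₗ core → e ∈ₗ central
  core⊆central = proj₁ (proj₂ cleaned)

  core-unique : Unique core
  core-unique = proj₁ (proj₂ (proj₂ cleaned))

  length-core : length central ≤ length reasons * dd + length core
  length-core = proj₂ (proj₂ (proj₂ (proj₂ cleaned)))

  core-size : ∀ {e} → e ∈ₗ core → ∣ e ∣ ≡ k
  core-size e∈ = edge-size (proj₁ (∈-filter⁻ central? {xs = edges G} (core⊆central e∈)))

  core-central : ∀ {e} → e ∈ₗ core → Central e (cen e)
  core-central e∈ = cen-central (core⊆central e∈)

  triad : ∀ {e a b c x} → Central e x → a ∈ e → b ∈ e → c ∈ e → a ≢ b → b ≢ c → a ≢ c → Triad (a , b , c , x)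
  triad (_ , K′) a∈ b∈ c∈ ab bc ac = (ab , bc , ac) , K′ _ _ a∈ b∈ , K′ _ _ b∈ c∈ , K′ _ _ a∈ c∈

  -- The vertices of e other than y form a reason at the centre, so more than `dd` core edges share
  -- them. The list `ys` may be any list known to contain every replacement of y.
  exchange : ∀ {e y} ys → e ∈ₗ core → y ∈ e → y ≢ cen e →
    (∀ {e′ y′} → e′ ∈ₗ core → cen e′ ≡ cen e → (∀ {z} → z ∈ e → z ≢ y → z ∈ e′) →
      y′ ∈ e′ → (∀ {z} → z ∈ e → z ≢ y → y′ ≢ z) → y′ ∈ₗ ys) →
    suc dd ≤ length ys
  exchange {e} {y} ys e∈ y∈ y≢x h = go ws (rest-unique e (x ∷ y ∷ [])) lws ws-in ws-all
    where
    x = cen e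
    ws = rest e (x ∷ y ∷ [])
    ws-in : ∀ {z} → z ∈ₗ ws → z ∈ e × z ≢ x × z ≢ y
    ws-in z∈ = let (z∈e , z∉) = ∈-rest⁻ e (x ∷ y ∷ []) z∈ in z∈e , (λ eq → z∉ (here eq)) , (λ eq → z∉ (there (here eq)))
    ws-all : ∀ {z} → z ∈ e → z ≢ y → z ∈ₗ x ∷ ws
    ws-all {z} z∈ z≢y with z FinP.≟ x
    ... | yes eq = here eq
    ... | no ne  = there (∈-rest⁺ z∈ (λ { (here eq) → ne eq ; (there (here eq)) → z≢y eq }))
    lws : length ws ≡ 3 + j
    lws = suc-injective (suc-injective (trans (length-rest e (((y≢x ∘ sym) ∷ []) ∷ [] ∷ []) (proj₁ (core-central e∈) ∷ y∈ ∷ [])) (core-size e∈)))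
    go : ∀ ws′ → Unique ws′ → length ws′ ≡ 3 + j → (∀ {z} → z ∈ₗ ws′ → z ∈ e × z ≢ x × z ≢ y) →
      (∀ {z} → z ∈ e → z ≢ y → z ∈ₗ x ∷ ws′) → suc dd ≤ length ys
    go (a ∷ b ∷ c ∷ w) u@((ab ∷ ac ∷ _) ∷ (bc ∷ _) ∷ _) lw hin hall =
      ≤-trans (proj₁ (proj₂ (proj₂ (proj₂ cleaned))) e∈ r∈ (refl , All.tabulate (proj₁ ∘ hin)))
        (extras {k = k} ur (cong (2 +_) lw) (UniqueP.filter⁺ (hasReason? r) core-unique)
          (λ p → let (p∈ , eq , hr) = ∈-filter⁻ (hasReason? r) {xs = core} p in
                 core-size p∈ , subst (_∈ _) eq (proj₁ (core-central p∈)) ∷ hr)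
          new)
      where
      r : V × List V
      r = x , a ∷ b ∷ c ∷ w
      r∈ : r ∈ₗ reasons
      r∈ = ∈-cartesianProductWith⁺ (λ (a , b , c , x) w → x , a ∷ b ∷ c ∷ w)
        (∈-triads (triad (core-central e∈) (proj₁ (hin (here refl))) (proj₁ (hin (there (here refl)))) (proj₁ (hin (there (there (here refl))))) ab bc ac))
        (subst (λ i → w ∈ₗ vtuples i) (suc-injective (suc-injective (suc-injective lw))) (∈-vtuples w))
      ur : Unique (x ∷ a ∷ b ∷ c ∷ w)
      ur = Unique-∷ (λ x∈ → proj₁ (proj₂ (hin x∈)) refl) u
      new : ∀ {e′} → e′ ∈ₗ filter (hasReason? r) core → ∃ λ y′ → y′ ∈ₗ ys × y′ ∈ e′ × y′ ∉ₗ x ∷ a ∷ b ∷ c ∷ w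
      new {e′} p =
        let (p∈ , eq , hr) = ∈-filter⁻ (hasReason? r) {xs = core} p
            (y′ , y′∈ , y′∉) = extra {r = x ∷ a ∷ b ∷ c ∷ w} {e′} (≤-reflexive (trans (cong (2 +_) lw) (sym (core-size p∈))))
            inc : ∀ {z} → z ∈ₗ x ∷ a ∷ b ∷ c ∷ w → z ∈ e′
            inc = λ { (here refl) → subst (_∈ e′) eq (proj₁ (core-central p∈)) ; (there z∈) → All.lookup hr z∈ }
        in y′ , h p∈ eq (λ z∈ z≢y → inc (hall z∈ z≢y)) y′∈ (λ { z∈ z≢y refl → y′∉ (hall z∈ z≢y) }) , y′∈ , y′∉

  isCentre? : ∀ x → Dec (Any (λ e → cen e ≡ x) core)
  isCentre? x = any? (λ e → cen e FinP.≟ x) core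

  centres : List V
  centres = filter isCentre? (allFin n)

  ∈-centres : ∀ {e} → e ∈ₗ core → cen e ∈ₗ centres
  ∈-centres e∈ = ∈-filter⁺ isCentre? (∈-allFin _) (lose e∈ refl)

  private
    third? : ∀ x a b c → Dec (Triad (a , b , c , x))
    third? x a b c = triad? (a , b , c , x)

    third : V → V → V → ℕ
    third x a b = # (third? x a b) (allFin n)

    second : V → V → ℕ
    second x a = ∑ (third x a) (allFin n)

    pick : ∀ {e} → e ∈ₗ core → ∀ r → length r ≤ 3 → ∃ λ y → y ∈ e × y ∉ₗ r
    pick {e} e∈ r le = extra {r = r} {e} (≤-trans (s≤s le) (≤-trans (s≤s (s≤s (s≤s (s≤s z≤n)))) (≤-reflexive (sym (core-size e∈)))))

    -- Exchanging a vertex other than a, b and the centre yields dd + 1 third corners. `second-≥`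
    -- and `first-≥` do the same for the other corners, which gives (dd + 1)³ triads with this apex.
    third-≥ : ∀ {e a b} → e ∈ₗ core → a ∈ e → b ∈ e → a ≢ b → suc dd ≤ third (cen e) a b
    third-≥ {e} {a} {b} e∈ a∈ b∈ ab =
      let (y , y∈ , y∉) = pick e∈ (a ∷ b ∷ cen e ∷ []) ≤-refl
          a≢y = λ eq → y∉ (here (sym eq)) ; b≢y = λ eq → y∉ (there (here (sym eq)))
      in exchange (filter (third? (cen e) a b) (allFin n)) e∈ y∈ (λ eq → y∉ (there (there (here eq))))
           (λ {e′} {y′} e′∈ eq keep y′∈ ne → ∈-filter⁺ (third? (cen e) a b) (∈-allFin y′)
             (triad (subst (Central e′) eq (core-central e′∈)) (keep a∈ a≢y) (keep b∈ b≢y) y′∈ ab (ne b∈ b≢y ∘ sym) (ne a∈ a≢y ∘ sym)))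

    second-≥ : ∀ {e a} → e ∈ₗ core → a ∈ e → suc dd * suc dd ≤ second (cen e) a
    second-≥ {e} {a} e∈ a∈ =
      let (y , y∈ , y∉) = pick e∈ (a ∷ cen e ∷ []) (n≤1+n _)
          a≢y = λ eq → y∉ (here (sym eq))
          P? = λ b → suc dd ≤? third (cen e) a b
      in ≤-trans (*-monoˡ-≤ (suc dd) (exchange (filter P? (allFin n)) e∈ y∈ (λ eq → y∉ (there (here eq)))
           (λ {e′} {y′} e′∈ eq keep y′∈ ne → ∈-filter⁺ P? (∈-allFin y′)
             (subst (λ x → suc dd ≤ third x a y′) eq (third-≥ e′∈ (keep a∈ a≢y) y′∈ (ne a∈ a≢y ∘ sym))))))
         (∑-≥-filter {f = third (cen e) a} P? (suc dd) (allFin n) id)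

    first-≥ : ∀ {e} → e ∈ₗ core → suc dd * (suc dd * suc dd) ≤ ∑ (second (cen e)) (allFin n)
    first-≥ {e} e∈ =
      let (y , y∈ , y∉) = pick e∈ (cen e ∷ []) (s≤s z≤n)
          P? = λ a → suc dd * suc dd ≤? second (cen e) a
      in ≤-trans (*-monoˡ-≤ (suc dd * suc dd) (exchange (filter P? (allFin n)) e∈ y∈ (λ eq → y∉ (here eq))
           (λ {e′} {y′} e′∈ eq keep y′∈ ne → ∈-filter⁺ P? (∈-allFin y′)
             (subst (λ x → suc dd * suc dd ≤ second x y′) eq (second-≥ e′∈ y′∈)))))
         (∑-≥-filter {f = second (cen e)} P? (suc dd * suc dd) (allFin n) id)

    apex : V⁴ → V
    apex (a , b , c , x) = x

    below : V → List V³
    below x = filter (λ (a , b , c) → triad? (a , b , c , x)) all³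

    length-below : ∀ x → length (below x) ≡ ∑ (second x) (allFin n)
    length-below x = trans (#-cpw _ _,_ (allFin n) (cartesianProduct (allFin n) (allFin n)))
      (∑-ext (allFin n) (λ a → #-cpw (λ (b , c) → triad? (a , b , c , x)) _,_ (allFin n) (allFin n)))

    below-≤ : ∀ x → length (below x) ≤ # (λ w → apex w FinP.≟ x) triads
    below-≤ x = inj-length (×-≡-dec FinP._≟_ (×-≡-dec FinP._≟_ (×-≡-dec FinP._≟_ FinP._≟_))) (λ (a , b , c) → a , b , c , x)
      (UniqueP.filter⁺ _ (UniqueP.cartesianProduct⁺ (UniqueP.allFin⁺ n) (UniqueP.cartesianProduct⁺ (UniqueP.allFin⁺ n) (UniqueP.allFin⁺ n))))
      (λ w∈ → ∈-filter⁺ (λ w → apex w FinP.≟ x) (∈-triads (proj₂ (∈-filter⁻ (λ (a , b , c) → triad? (a , b , c , x)) {xs = all³} w∈))) refl)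
      (λ { _ _ refl → refl })

  -- A centre of the core lies in more than dd³ triads; with dd of order n this bounds the number of centres.
  #-centres : length centres * (suc dd * (suc dd * suc dd)) ≤ 3 * (n * (n * n)) * q
  #-centres = ≤-trans (∑-≥ {f = λ x → # (λ w → apex w FinP.≟ x) triads} _ centres (λ {x} x∈ →
      let (e , e∈ , eq) = find (proj₂ (∈-filter⁻ isCentre? {xs = allFin n} x∈)) in
      ≤-trans (subst (λ x → _ ≤ ∑ (second x) (allFin n)) eq (first-≥ e∈)) (≤-trans (≤-reflexive (sym (length-below x))) (below-≤ x))))
    (≤-trans (≤-reflexive (#-swap (λ x w → apex w FinP.≟ x) triads centres))
      (≤-trans (∑-≤ 1 triads (λ {w} _ → all-equal⇒length≤1 (UniqueP.filter⁺ (λ x → apex w FinP.≟ x) (UniqueP.filter⁺ isCentre? (UniqueP.allFin⁺ n)))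
          (λ p p′ → trans (sym (proj₂ (∈-filter⁻ (λ x → apex w FinP.≟ x) {xs = centres} p))) (proj₂ (∈-filter⁻ (λ x → apex w FinP.≟ x) {xs = centres} p′)))))
        (≤-trans (≤-reflexive (*-identityʳ _)) #-triads)))

  length-reasons : length reasons ≤ 3 * q * n ^ (3 + j)
  length-reasons = ≤-trans (≤-reflexive (trans (length-cpw _ triads (vtuples j)) (cong (length triads *_) (length-vtuples j))))
    (≤-trans (*-monoˡ-≤ (n ^ j) #-triads) (≤-reflexive (arith n q (n ^ j))))
    where
    arith : ∀ n q x → 3 * (n * (n * n)) * q * x ≡ 3 * q * (n * (n * (n * x)))
    arith = solve-∀

-- The dominating set of centres

average-∈ : ∀ {A : Set} (f : A → ℕ) {x} xs → x ∈ₗ xs → ∃ λ y → y ∈ₗ xs × length xs * f y ≤ ∑ f xs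
average-∈ f (x ∷ xs) _ = average f x xs

map-unique : ∀ {A B : Set} {f : A → B} {xs} → Unique xs → (∀ {x y} → x ∈ₗ xs → y ∈ₗ xs → f x ≡ f y → x ≡ y) → Unique (map f xs)
map-unique [] inj = []
map-unique {f = f} {x ∷ xs} (h ∷ u) inj = Unique-∷ (λ fx∈ → case ∈-map⁻ f fx∈ of λ
    { (y , y∈ , eq) → All.lookup h y∈ (inj (here refl) (there y∈) eq) })
  (map-unique u (λ p r → inj (there p) (there r)))

take-⊆ : ∀ {A : Set} i (xs : List A) {x} → x ∈ₗ take i xs → x ∈ₗ xs
take-⊆ (suc i) (y ∷ xs) (here eq) = here eq
take-⊆ (suc i) (y ∷ xs) (there x∈) = there (take-⊆ i xs x∈)

-- 3t vertices feed the alternating path through T, and 2k + 2 allow it to avoid the prescribed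
-- vertices of two closing edges.
goodC : ℕ → ℕ → ℕ
goodC k t = 3 * t + (2 * k + 2)

module Attach {k n : ℕ} (G : KGraph k n) (q ℓ t : ℕ) (1≤t : 1 ≤ t)
  (parity : ℓ ≡ 2 * t + 1 ⊎ ℓ ≡ 2 * t + 2) (large : 2 * t + (2 * k + 2) + (2 * t + 2) * k ≤ q)
  (free : ¬ ContainsCycle ℓ G) where

  open Cycles G q

  private
    V = Fin n
    K = Ker (edges G) q

  t₀ : ℕ
  t₀ = goodC k t

  Good : List V → V → Set
  Good T y = y ∉ₗ T × All (λ x → K (x ∷ y ∷ [])) T

  good? : ∀ T y → Dec (Good T y)
  good? T y = ¬? (y ∈ₗ? T) ×-dec all? (λ x → Ker? (edges G) q (x ∷ y ∷ [])) T

  goods : List V → List V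
  goods T = filter (good? T) (allFin n)

  goods-unique : ∀ T → Unique (goods T)
  goods-unique T = UniqueP.filter⁺ (good? T) (UniqueP.allFin⁺ n)

  ∈-goods : ∀ {T y} → Good T y → y ∈ₗ goods T
  ∈-goods {T} g = ∈-filter⁺ (good? T) (∈-allFin _) g

  goods-good : ∀ {T y} → y ∈ₗ goods T → Good T y
  goods-good {T} y∈ = proj₂ (∈-filter⁻ (good? T) {xs = allFin n} y∈)

  -- The alternating path through all of T from y to y′, closed by tl.
  close : ∀ T → length T ≡ t → Unique T → t₀ ≤ length (goods T) → ∀ {y y′} E tl → Good T y → Good T y′ →
    Links y ((y′ , E) ∷ tl) → Unique (atoms ((y′ , E) ∷ tl)) →
    (∀ {a} → a ∈ₗ atoms ((y′ , E) ∷ tl) → a ∉ₗ T × a ≢ y) →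
    length (atoms ((y′ , E) ∷ tl)) ≤ 2 * k + 2 → suc (length tl) ≤ 2 → 2 * t + suc (length tl) ≡ ℓ → ⊥
  close [] refl = case 1≤t of λ ()
  close (x ∷ xs) refl uT big {y} {y′} E tl gy gy′ l u apart lenA lentl eq = free (subst (λ i → ContainsCycle i G) eq
    (connect-cycle x xs (goods (x ∷ xs)) (goods-unique (x ∷ xs)) (proj₂ ∘ goods-good) y y′ E tl (proj₂ gy) (proj₂ gy′) l
      (Unique-∷ (λ y∈ → case ∈-++⁻ (x ∷ xs) y∈ of λ { (inj₁ p) → proj₁ gy p ; (inj₂ p) → proj₂ (apart p) refl })
        (UniqueP.++⁺ uT u (λ (p , r) → proj₁ (apart r) p)))
      (≤-trans (+-monoʳ-≤ (3 * t) lenA) big)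
      (≤-trans (+-mono-≤ (+-monoʳ-≤ (2 * t) lenA) (*-monoˡ-≤ k (+-monoʳ-≤ (2 * t) lentl))) large)))

  -- For odd ℓ the kernel {x, y, y′} is itself the slot closing the path from y to y′; for even ℓ
  -- the kernels {x, y} and {x, y′} close it through x. So a well-joined t-set tolerates no further
  -- centre over two of its good vertices.
  attach : ∀ T → length T ≡ t → Unique T → t₀ ≤ length (goods T) → ∀ {y y′ x} → y ≢ y′ → Good T y → Good T y′ →
    x ∉ₗ T → x ≢ y → x ≢ y′ → K (x ∷ y ∷ y′ ∷ []) → K (x ∷ y ∷ []) → K (x ∷ y′ ∷ []) → ⊥
  attach T lT uT big {y} {y′} {x} yy′ gy gy′ x∉ xy xy′ k₃ k₁ k₂ = go parity
    where
    go : ℓ ≡ 2 * t + 1 ⊎ ℓ ≡ 2 * t + 2 → ⊥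
    go (inj₁ eq) = close T lT uT big (x ∷ []) [] gy gy′
        (Ker-cong {D = x ∷ y ∷ y′ ∷ []} {y′ ∷ y ∷ x ∷ []} (λ { (here p) → there (there (here p)) ; (there (here p)) → there (here p) ; (there (there (here p))) → here p })
                  (λ { (here p) → there (there (here p)) ; (there (here p)) → there (here p) ; (there (there (here p))) → here p }) k₃)
        ((((xy′ ∘ sym) ∷ []) ∷ [] ∷ []))
        (λ { (here refl) → proj₁ gy′ , (yy′ ∘ sym) ; (there (here refl)) → x∉ , xy })
        (m≤n+m 2 (2 * k)) (s≤s z≤n) (sym eq)
    go (inj₂ eq) = close T lT uT big [] ((x , []) ∷ []) gy gy′ (Ker-swap k₂ , k₁)
        ((((xy′ ∘ sym) ∷ []) ∷ [] ∷ []))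
        (λ { (here refl) → proj₁ gy′ , (yy′ ∘ sym) ; (there (here refl)) → x∉ , xy })
        (m≤n+m 2 (2 * k)) ≤-refl (sym eq)

module Dominating {j n : ℕ} (G : KGraph (5 + j) n) (q m : ℕ) (d : Fin n)
  (large₁ : (3 + m) + (3 + m) * (5 + j) ≤ q) (free : ¬ ContainsCycle (3 + m) G) (dd : ℕ)
  (t : ℕ) (1≤t : 1 ≤ t) (parity : 3 + m ≡ 2 * t + 1 ⊎ 3 + m ≡ 2 * t + 2)
  (large₂ : 2 * t + (2 * (5 + j) + 2) + (2 * t + 2) * (5 + j) ≤ q) where

  open Heavy G q m d large₁ free dd public
  open Attach G q (3 + m) t 1≤t parity large₂ free public

  private
    k = 5 + j
    V = Fin n
    K = Ker (edges G) q

  -- Each core edge is charged to the (k - 1)-set left when its centre is removed. Over a fixed such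
  -- set an edge is determined by its centre.
  base? : ∀ (f e : Subset n) → Dec (f ⊆ₛ e × cen e ∉ f)
  base? f e = (f ⊆? e) ×-dec ¬? (cen e ∈? f)

  above : Subset n → List (Subset n)
  above f = filter (base? f) core

  centresOf : Subset n → List V
  centresOf f = map cen (above f)

  private
    above-in : ∀ {f e} → e ∈ₗ above f → e ∈ₗ core × f ⊆ₛ e × cen e ∉ f
    above-in {f} = ∈-filter⁻ (base? f) {xs = core}

    recover : ∀ {f e} → ∣ f ∣ ≡ 4 + j → e ∈ₗ above f → fromList (cen e ∷ elems f) ≡ e
    recover {f} {e} hf e∈ = let (e∈c , f⊆ , c∉) = above-in e∈ in ⊆∧∣∣⇒≡
      (λ x∈ → case ∈-fromList⁻ (cen e ∷ elems f) x∈ of λ { (here refl) → proj₁ (core-central e∈c) ; (there x∈′) → f⊆ (∈-elems⁻ x∈′) })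
      (≤-reflexive (trans (core-size e∈c) (trans (cong suc (sym (trans (length-elems f) hf)))
        (sym (∣fromList∣ (Unique-∷ (c∉ ∘ ∈-elems⁻) (elems-unique f)))))))

  cen-injective : ∀ {f e e′} → ∣ f ∣ ≡ 4 + j → e ∈ₗ above f → e′ ∈ₗ above f → cen e ≡ cen e′ → e ≡ e′
  cen-injective {f} hf e∈ e′∈ eq = trans (sym (recover hf e∈)) (trans (cong (λ x → fromList (x ∷ elems f)) eq) (recover hf e′∈))

  centresOf-unique : ∀ {f} → ∣ f ∣ ≡ 4 + j → Unique (centresOf f)
  centresOf-unique {f} hf = map-unique (UniqueP.filter⁺ (base? f) core-unique) (cen-injective hf)

  centresOf-⊆ : ∀ {f x} → x ∈ₗ centresOf f → x ∈ₗ centres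
  centresOf-⊆ {f} x∈ with _ , e∈ , refl ← ∈-map⁻ cen x∈ = ∈-centres (proj₁ (above-in e∈))

  centresOf-∉ : ∀ {f x} → x ∈ₗ centresOf f → x ∉ f
  centresOf-∉ {f} x∈ with _ , e∈ , refl ← ∈-map⁻ cen x∈ = proj₂ (proj₂ (above-in e∈))

  centresOf-K₃ : ∀ {f x y y′} → x ∈ₗ centresOf f → y ∈ f → y′ ∈ f → K (x ∷ y ∷ y′ ∷ [])
  centresOf-K₃ {f} x∈ y∈ y′∈ with _ , e∈ , refl ← ∈-map⁻ cen x∈ =
    let (e∈c , f⊆ , _) = above-in e∈ in proj₂ (core-central e∈c) _ _ (f⊆ y∈) (f⊆ y′∈)

  centresOf-K₂ : ∀ {f x y} → x ∈ₗ centresOf f → y ∈ f → K (x ∷ y ∷ [])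
  centresOf-K₂ {f} {x} {y} x∈ y∈ = Ker-cong {D = x ∷ y ∷ y ∷ []} {x ∷ y ∷ []} (λ { (here p) → here p ; (there (here p)) → there (here p) ; (there (there (here p))) → there (here p) })
    (λ { (here p) → here p ; (there (here p)) → there (here p) }) (centresOf-K₃ x∈ y∈ y∈)

  centresOf-good : ∀ {f T} → (∀ {x} → x ∈ₗ T → x ∈ₗ centresOf f) → ∀ {y} → y ∈ f → Good T y
  centresOf-good sub y∈ = (λ y∈T → centresOf-∉ (sub y∈T) y∈) , All.tabulate (λ x∈ → centresOf-K₂ (sub x∈) y∈)

  select : ∀ {f} → ∣ f ∣ ≡ 4 + j → t ≤ length (above f) →
    ∃ λ T → T ∈ₗ tuples centres t × length T ≡ t × Unique T × (∀ {x} → x ∈ₗ T → x ∈ₗ centresOf f)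
  select {f} hf le = T , subst (λ i → T ∈ₗ tuples centres i) lT (∈-tuples T (centresOf-⊆ ∘ sub)) , lT ,
      UniqueP.take⁺ t (centresOf-unique hf) , sub
    where
    T = take t (centresOf f)
    sub : ∀ {x} → x ∈ₗ T → x ∈ₗ centresOf f
    sub = take-⊆ t (centresOf f)
    lT : length T ≡ t
    lT = trans (length-take t (centresOf f)) (m≤n⇒m⊓n≡m (subst (t ≤_) (sym (length-map cen (above f))) le))

  bases : List (Subset n)
  bases = ksubsets n (4 + j)

  poor? : ∀ f → Dec (length (above f) < t)
  poor? f = length (above f) <? t

  rich? : ∀ f → Dec (t < length (above f))
  rich? f = t <? length (above f)

  private
    two-of : ∀ {f : Subset n} → ∣ f ∣ ≡ 4 + j → ∃ λ y → ∃ λ y′ → y ∈ f × y′ ∈ f × y ≢ y′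
    two-of {f} hf =
      let (y , y∈ , _) = extra {r = []} {f} (subst (1 ≤_) (sym hf) (s≤s z≤n))
          (y′ , y′∈ , y′∉) = extra {r = y ∷ []} {f} (subst (2 ≤_) (sym hf) (s≤s (s≤s z≤n)))
      in y , y′ , y∈ , y′∈ , (λ eq → y′∉ (here (sym eq)))

    -- Of more than t centres over f, the first t form T and another one would attach to it, so T
    -- has fewer than `t₀` good vertices. All vertices of f are good for T, which leaves boundedly
    -- many such f.
    rich-small : ∀ {f} → ∣ f ∣ ≡ 4 + j → t < length (above f) →
      ∃ λ T → T ∈ₗ tuples centres t × length (goods T) < t₀ × All (_∈ₗ goods T) (elems f)
    rich-small {f} hf lt =
      let (T , T∈ , lT , uT , sub) = select hf (<⇒≤ lt)
          (x , x∈ , x∉) = fresh-pick FinP._≟_ T id (centresOf-unique hf) (λ _ _ → id)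
                            (subst₂ _<_ (sym lT) (sym (length-map cen (above f))) lt)
          (y , y′ , y∈ , y′∈ , ne) = two-of hf
          good = centresOf-good {f} {T} sub
      in T , T∈ , ≰⇒> (λ big → attach T lT uT big ne (good y∈) (good y′∈) x∉
             (λ eq → centresOf-∉ x∈ (subst (_∈ f) (sym eq) y∈)) (λ eq → centresOf-∉ x∈ (subst (_∈ f) (sym eq) y′∈))
             (centresOf-K₃ x∈ y∈ y′∈) (centresOf-K₂ x∈ y∈) (centresOf-K₂ x∈ y′∈)) ,
         All.tabulate (λ z∈ → ∈-goods (good (∈-elems⁻ z∈)))

  #-rich : # rich? bases ≤ length centres ^ t * t₀ ^ (4 + j)
  #-rich = subst (λ i → # rich? bases ≤ i * t₀ ^ (4 + j)) (length-tuples centres t)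
    (union-bound-const Q? (t₀ ^ (4 + j)) (filter rich? bases) (tuples centres t)
      (λ f∈ → let (f∈b , lt) = ∈-filter⁻ rich? {xs = bases} f∈ ; (T , T∈ , sm , sub) = rich-small (∈-ksubsets⁻ (4 + j) f∈b) lt
              in T , T∈ , sm , sub)
      (λ {T} _ → part T (length (goods T) <? t₀)))
    where
    Q? : ∀ T f → Dec (length (goods T) < t₀ × All (_∈ₗ goods T) (elems f))
    Q? T f = (length (goods T) <? t₀) ×-dec all? (_∈ₗ? goods T) (elems f)
    part : ∀ T → Dec (length (goods T) < t₀) → # (Q? T) (filter rich? bases) ≤ t₀ ^ (4 + j)
    part T (no big) = ≤-trans (≤-reflexive (#-none (Q? T) (filter rich? bases) (λ _ h → big (proj₁ h)))) z≤n
    part T (yes sm) = ≤-trans (inj-length (ListP.≡-dec FinP._≟_) elems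
        (UniqueP.filter⁺ (Q? T) (UniqueP.filter⁺ rich? (ksubsets-unique n (4 + j))))
        (λ {f} f∈ → let (f∈r , _ , sub) = ∈-filter⁻ (Q? T) {xs = filter rich? bases} f∈
                        (f∈b , _) = ∈-filter⁻ rich? {xs = bases} f∈r
                    in subst (λ i → elems f ∈ₗ tuples (goods T) i) (trans (length-elems f) (∈-ksubsets⁻ (4 + j) f∈b))
                         (∈-tuples (elems f) (All.lookup sub)))
        (λ _ _ → elems-injective))
      (≤-trans (≤-reflexive (length-tuples (goods T) (4 + j))) (^-monoˡ-≤ (4 + j) (<⇒≤ sm)))

  above-≤ : ∀ {f} → ∣ f ∣ ≡ 4 + j → length (above f) ≤ length centres
  above-≤ {f} hf = inj-length FinP._≟_ cen (UniqueP.filter⁺ (base? f) core-unique)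
    (λ e∈ → ∈-centres (proj₁ (above-in e∈))) (cen-injective hf)

  length-core-≤ : length core ≤ ∑ (λ f → length (above f)) bases
  length-core-≤ = union-bound base? core bases λ {e} e∈ →
    let x = cen e
        lw = suc-injective (trans (length-rest e ([] ∷ []) (proj₁ (core-central e∈) ∷ [])) (core-size e∈))
    in fromList (rest e (x ∷ [])) , ∈-ksubsets⁺ (4 + j) (trans (∣fromList∣ (rest-unique e (x ∷ []))) lw) ,
       (λ z∈ → proj₁ (∈-rest⁻ e (x ∷ []) (∈-fromList⁻ (rest e (x ∷ [])) z∈))) ,
       (λ x∈ → proj₂ (∈-rest⁻ e (x ∷ []) (∈-fromList⁻ (rest e (x ∷ [])) x∈)) (here refl))

  -- A (k - 1)-set carries at most t core edges, and at most t - 1 if it is poor; the few rich ones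
  -- are bounded by the number of centres. A large core therefore leaves few poor sets.
  core+poor : length core + # poor? bases ≤ t * (n C (4 + j)) + length centres * # rich? bases
  core+poor = begin
    length core + # poor? bases
      ≤⟨ +-mono-≤ length-core-≤ (≤-reflexive (#≡∑ poor? bases)) ⟩
    ∑ (λ f → length (above f)) bases + ∑ (λ f → ind (poor? f)) bases
      ≡⟨ ∑-+ _ _ bases ⟨
    ∑ (λ f → length (above f) + ind (poor? f)) bases
      ≤⟨ ∑-mono bases (λ {f} f∈ → pointwise f (∈-ksubsets⁻ (4 + j) f∈)) ⟩
    ∑ (λ f → t + length centres * ind (rich? f)) bases
      ≡⟨ ∑-+ _ _ bases ⟩
    ∑ (λ f → t) bases + ∑ (λ f → length centres * ind (rich? f)) bases
      ≡⟨ cong₂ _+_ (trans (∑-const t bases) (trans (*-comm (length bases) t) (cong (t *_) (length-ksubsets n (4 + j)))))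
          (trans (∑-* (length centres) _ bases) (cong (length centres *_) (sym (#≡∑ rich? bases)))) ⟩
    t * (n C (4 + j)) + length centres * # rich? bases ∎
    where
    open ≤-Reasoning
    pointwise : ∀ f → ∣ f ∣ ≡ 4 + j → length (above f) + ind (poor? f) ≤ t + length centres * ind (rich? f)
    pointwise f hf = go (poor? f) (rich? f)
      where
      go : (p : Dec (length (above f) < t)) (r : Dec (t < length (above f))) → length (above f) + ind p ≤ t + length centres * ind r
      go (yes p) _       = ≤-trans (≤-reflexive (+-comm _ 1)) (≤-trans p (m≤m+n t _))
      go (no ¬p) (yes r) = ≤-trans (≤-reflexive (+-identityʳ _)) (≤-trans (above-≤ hf)
                             (≤-trans (≤-reflexive (sym (*-identityʳ _))) (m≤n+m _ t)))
      go (no ¬p) (no ¬r) = ≤-trans (≤-reflexive (+-identityʳ _)) (≤-trans (≮⇒≥ ¬r) (m≤m+n t _))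

  -- Words instead of sets, so that averaging can fix the coordinates one at a time.
  Typed : List V → Set
  Typed w = Fresh [] w × ¬ (length (above (fromList w)) < t)

  typed? : ∀ w → Dec (Typed w)
  typed? w = fresh? [] w ×-dec ¬? (poor? (fromList w))

  tups : List (List V)
  tups = vtuples (4 + j)

  #-untyped : # (¬? ∘ typed?) tups ≤
    # (λ w → ¬? (fresh? [] w)) tups + # poor? bases * (4 + j) ^ (4 + j)
  #-untyped = ≤-trans (#-∪ _ (λ w → ¬? (fresh? [] w)) P? tups split) (+-monoʳ-≤ (# (λ w → ¬? (fresh? [] w)) tups)
      (#-tuples-within P? (4 + j) (4 + j) (filter poor? bases)
        (λ f∈ → ≤-reflexive (∈-ksubsets⁻ (4 + j) (proj₁ (∈-filter⁻ poor? {xs = bases} f∈))))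
        (λ {w} w∈ (fr , p) → fromList w , ∈-filter⁺ poor? (∈-ksubsets⁺ (4 + j)
            (trans (∣fromList∣ (fresh⇒unique w fr)) (tuples-length {xs = allFin n} (4 + j) w∈))) p , All.tabulate ∈-fromList⁺)))
    where
    P? : ∀ w → Dec (Fresh [] w × length (above (fromList w)) < t)
    P? w = fresh? [] w ×-dec poor? (fromList w)
    split : ∀ {w} → w ∈ₗ tups → ¬ Typed w → ¬ Fresh [] w ⊎ (Fresh [] w × length (above (fromList w)) < t)
    split {w} _ h with fresh? [] w
    ... | no ¬f = inj₁ ¬f
    ... | yes f = inj₂ (f , decidable-stable (poor? (fromList w)) (λ np → h (f , np)))

  typed-select : ∀ {w} → w ∈ₗ tups → Typed w →
    ∃ λ T → T ∈ₗ tuples centres t × length T ≡ t × Unique T × (∀ {x} → x ∈ₗ T → x ∈ₗ centresOf (fromList w))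
  typed-select {w} w∈ (fr , np) = select (trans (∣fromList∣ (fresh⇒unique w fr)) (tuples-length {xs = allFin n} (4 + j) w∈)) (≮⇒≥ np)

#-all : ∀ {A : Set} {P : A → Set} (P? : Decidable P) xs → (∀ {x} → x ∈ₗ xs → P x) → length xs ≤ # P? xs
#-all P? xs h = ≤-reflexive (trans (#-¬ P? xs) (trans (cong (# P? xs +_) (#-none (¬? ∘ P?) xs (λ x∈ ¬p → ¬p (h x∈)))) (+-identityʳ _)))

unique-⊇ : ∀ {A : Set} → DecidableEquality A → ∀ {xs ys : List A} → Unique xs → length ys ≤ length xs →
  (∀ {x} → x ∈ₗ xs → x ∈ₗ ys) → ∀ {y} → y ∈ₗ ys → y ∈ₗ xs
unique-⊇ _≟_ {xs} u le sub {y} y∈ = decidable-stable (DecM._∈?_ _≟_ y xs) (λ y∉ →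
  <⇒≱ (unique-⊆-length _≟_ (Unique-∷ y∉ u) (λ { (here refl) → y∈ ; (there x∈) → sub x∈ })) le)

^-positive : ∀ {n} m → 1 ≤ n → 1 ≤ n ^ m
^-positive {suc n} m _ = m^n>0 (suc n) m

cancelˡ : ∀ n {a b} → 1 ≤ n → n * a ≤ n * b → a ≤ b
cancelˡ (suc n) _ h = *-cancelˡ-≤ (suc n) h

-- `typeC` counts untyped words in units of n^(k - 1)/M: 1 for words with repetitions and, for each
-- of the (k - 1)^(k - 1) words on a poor set, 3q for the cleaning loss and 2 for two lower-order
-- errors.
centralC typeC : ℕ → ℕ → ℕ
centralC j q = homC (5 + j) q (length (subsets (5 + j)))
typeC j q = 1 + (4 + j) ^ (4 + j) * (3 * q + 2)

-- Bounds the number of centres: with dd + 1 ≥ n/M, the quotient of 3n³q by (dd + 1)³ is at most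
-- 3qM³.
centreC : ℕ → ℕ → ℕ
centreC q M = 3 * q * (M * (M * M))

richC : ℕ → ℕ → ℕ → ℕ → ℕ
richC j q t M = centreC q M ^ t * goodC (5 + j) t ^ (4 + j)

module Domination {j n : ℕ} (G : KGraph (5 + j) n) (q m : ℕ) (d : Fin n)
  (large₁ : (3 + m) + (3 + m) * (5 + j) ≤ q) (free : ¬ ContainsCycle (3 + m) G)
  (t : ℕ) (1≤t : 1 ≤ t) (parity : 3 + m ≡ 2 * t + 1 ⊎ 3 + m ≡ 2 * t + 2)
  (large₂ : 2 * t + (2 * (5 + j) + 2) + (2 * t + 2) * (5 + j) ≤ q) where

  open Attach G q (3 + m) t 1≤t parity large₂ free public

  private
    k = 5 + j
    V = Fin n
    K = Ker (edges G) q

  bads : List V → List V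
  bads T = filter (¬? ∘ good? T) (allFin n)

  C₁ κ C₆ : ℕ
  C₁ = centralC j q
  κ  = (4 + j) ^ (4 + j)
  C₆ = typeC j q

  module _ (M dd : ℕ) where
    K₀ K₁ : ℕ
    K₀ = centreC q M
    K₁ = richC j q t M

    -- The first two hypotheses say that dd is n/M rounded: the upper bound on dd keeps the cleaning
    -- loss a small fraction of n^(k - 1), the lower bound limits the number of centres
    -- independently of n.
    dominating : dd * M ≤ n → n ≤ suc dd * M → t ≤ n → t * ((n ∸ t) C (4 + j)) ≤ length (edges G) →
      M * (C₁ + t * t) ≤ n → M * (K₀ * K₁) ≤ n → M * ((4 + j) * (4 + j)) ≤ n → M * (K₀ ^ t * t₀) < n → C₆ < M →
      ∃ λ T → length T ≡ t × Unique T × t₀ ≤ length (goods T) × M * length (bads T) ≤ C₆ * n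
    dominating lo hi t≤n hE hn₁ hn₂ hn₃ hn₄ hM = result
      where
      open Dominating G q m d large₁ free dd t 1≤t parity large₂ hiding (goods; good?; t₀; Good; attach; goods-good; ∈-goods; goods-unique; close)
      N = n ^ (3 + j)
      1≤n : 1 ≤ n
      1≤n = ≤-trans (s≤s z≤n) hn₄
      1≤N : 1 ≤ N
      1≤N = ^-positive (3 + j) 1≤n

      few-centres : length centres ≤ K₀
      few-centres = cancelˡ (s * (s * s)) (s≤s z≤n) (begin
        s * (s * s) * length centres                  ≡⟨ *-comm (s * (s * s)) _ ⟩
        length centres * (s * (s * s))                ≤⟨ #-centres ⟩
        3 * (n * (n * n)) * q                         ≤⟨ *-monoˡ-≤ q (*-monoʳ-≤ 3 (*-mono-≤ hi (*-mono-≤ hi hi))) ⟩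
        3 * (s * M * (s * M * (s * M))) * q           ≡⟨ arith s M q ⟩
        s * (s * s) * K₀                              ∎)
        where
        open ≤-Reasoning
        s = suc dd
        arith : ∀ s M q → 3 * (s * M * (s * M * (s * M))) * q ≡ s * (s * s) * (3 * q * (M * (M * M)))
        arith = solve-∀

      poor = # poor? bases

      -- In `core+poor` the assumed number of edges puts t·C(n - t, k - 1) on the left, up to
      -- losses, and t·C(n, k - 1) stands on the right. The main terms cancel, so only error terms
      -- can pay for poor sets.
      poor-≤ : poor ≤ (C₁ + t * t) * N + 3 * q * N * dd + K₀ * K₁
      poor-≤ = +-cancelʳ-≤ (t * B′) _ _ (begin
        poor + t * B′                                                  ≤⟨ +-monoʳ-≤ poor hE ⟩
        poor + length (edges G)                                        ≡⟨ cong (poor +_) (#-¬ central? (edges G)) ⟩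
        poor + (length central + length noncentral)                    ≤⟨ +-monoʳ-≤ poor (+-mono-≤ length-core (#-noncentral m large₁ free)) ⟩
        poor + (length reasons * dd + length core + C₁ * N)            ≤⟨ +-monoʳ-≤ poor (+-monoˡ-≤ (C₁ * N) (+-monoˡ-≤ (length core) (*-monoˡ-≤ dd length-reasons))) ⟩
        poor + (3 * q * N * dd + length core + C₁ * N)                 ≡⟨ arith₁ poor (3 * q * N * dd) (length core) (C₁ * N) ⟩
        length core + poor + (3 * q * N * dd + C₁ * N)                 ≤⟨ +-monoˡ-≤ (3 * q * N * dd + C₁ * N) core+poor ⟩
        t * (n C (4 + j)) + length centres * # rich? bases + (3 * q * N * dd + C₁ * N)
          ≤⟨ +-monoˡ-≤ (3 * q * N * dd + C₁ * N) (+-mono-≤ (*-monoʳ-≤ t B-≤) (*-mono-≤ few-centres (≤-trans #-rich (*-monoˡ-≤ (t₀ ^ (4 + j)) (^-monoˡ-≤ t few-centres))))) ⟩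
        t * (B′ + t * N) + K₀ * K₁ + (3 * q * N * dd + C₁ * N)         ≡⟨ arith₂ t B′ N (K₀ * K₁) (3 * q * N * dd) C₁ ⟩
        (C₁ + t * t) * N + 3 * q * N * dd + K₀ * K₁ + t * B′           ∎)
        where
        open ≤-Reasoning
        B′ = (n ∸ t) C (4 + j)
        B-≤ : n C (4 + j) ≤ B′ + t * N
        B-≤ = subst (λ i → i C (4 + j) ≤ B′ + t * i ^ (3 + j)) (m+[n∸m]≡n t≤n) (C-upper t (n ∸ t) (3 + j))
        arith₁ : ∀ p r c s → p + (r + c + s) ≡ c + p + (r + s)
        arith₁ = solve-∀
        arith₂ : ∀ t b N x y c → t * (b + t * N) + x + (y + c * N) ≡ (c + t * t) * N + y + x + t * b
        arith₂ = solve-∀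

      M*poor-≤ : M * poor ≤ (3 * q + 2) * (n * N)
      M*poor-≤ = begin
        M * poor                                                       ≤⟨ *-monoʳ-≤ M poor-≤ ⟩
        M * ((C₁ + t * t) * N + 3 * q * N * dd + K₀ * K₁)              ≡⟨ arith₁ M (C₁ + t * t) N q dd (K₀ * K₁) ⟩
        M * (C₁ + t * t) * N + 3 * q * N * (dd * M) + M * (K₀ * K₁)    ≤⟨ +-mono-≤ (+-mono-≤ (*-monoˡ-≤ N hn₁) (*-monoʳ-≤ (3 * q * N) lo)) hn₂ ⟩
        n * N + 3 * q * N * n + n                                      ≤⟨ +-monoʳ-≤ (n * N + 3 * q * N * n) (≤-trans (≤-reflexive (sym (*-identityʳ n))) (*-monoʳ-≤ n 1≤N)) ⟩
        n * N + 3 * q * N * n + n * N                                  ≡⟨ arith₂ n N q ⟩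
        (3 * q + 2) * (n * N)                                          ∎
        where
        open ≤-Reasoning
        arith₁ : ∀ M c N q d x → M * (c * N + 3 * q * N * d + x) ≡ M * c * N + 3 * q * N * (d * M) + M * x
        arith₁ = solve-∀
        arith₂ : ∀ n N q → n * N + 3 * q * N * n + n * N ≡ (3 * q + 2) * (n * N)
        arith₂ = solve-∀

      nonfresh = # (λ w → ¬? (fresh? [] w)) tups

      M*nonfresh-≤ : M * nonfresh ≤ n * N
      M*nonfresh-≤ = cancelˡ n 1≤n (begin
        n * (M * nonfresh)                            ≡⟨ arith n M nonfresh ⟩
        M * (n * nonfresh)                            ≤⟨ *-monoʳ-≤ M (#-nonfresh {n} [] (4 + j)) ⟩
        M * ((4 + j) * (4 + j) * (n * N))             ≡⟨ *-assoc M ((4 + j) * (4 + j)) (n * N) ⟨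
        M * ((4 + j) * (4 + j)) * (n * N)             ≤⟨ *-monoˡ-≤ (n * N) hn₃ ⟩
        n * (n * N)                                   ∎)
        where
        open ≤-Reasoning
        arith : ∀ n M x → n * (M * x) ≡ M * (n * x)
        arith = solve-∀

      U = # (¬? ∘ typed?) tups

      M*U-≤ : M * U ≤ C₆ * (n * N)
      M*U-≤ = begin
        M * U                                         ≤⟨ *-monoʳ-≤ M #-untyped ⟩
        M * (nonfresh + poor * κ)                     ≡⟨ arith₁ M nonfresh poor κ ⟩
        M * nonfresh + κ * (M * poor)                 ≤⟨ +-mono-≤ M*nonfresh-≤ (*-monoʳ-≤ κ M*poor-≤) ⟩
        n * N + κ * ((3 * q + 2) * (n * N))           ≡⟨ arith₂ (n * N) κ (3 * q + 2) ⟩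
        C₆ * (n * N)                                  ∎
        where
        open ≤-Reasoning
        arith₁ : ∀ M x p k → M * (x + p * k) ≡ M * x + k * (M * p)
        arith₁ = solve-∀
        arith₂ : ∀ x k c → x + k * (c * x) ≡ (1 + k * c) * x
        arith₂ = solve-∀

      U₂ : V → V → ℕ
      U₂ y y′ = # (λ w → ¬? (typed? (y ∷ y′ ∷ w))) (vtuples (2 + j))

      U₁ : V → ℕ
      U₁ y = ∑ (U₂ y) (allFin n)

      U≡ : U ≡ ∑ U₁ (allFin n)
      U≡ = trans (#-cpw _ _∷_ (allFin n) (vtuples (3 + j)))
        (∑-ext (allFin n) (λ y → #-cpw (λ w → ¬? (typed? (y ∷ w))) _∷_ (allFin n) (vtuples (2 + j))))

      -- Two coordinates are fixed by averaging because `attach` needs two vertices that are good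
      -- for the candidate T.
      anchor : ∃ λ y → ∃ λ y′ → M * U₂ y y′ ≤ C₆ * n ^ (2 + j)
      anchor =
        let (y , _ , h₁) = average-∈ U₁ (allFin n) (∈-allFin d)
            (y′ , _ , h₂) = average-∈ (U₂ y) (allFin n) (∈-allFin d)
        in y , y′ , cancelˡ n 1≤n (cancelˡ n 1≤n (begin
          n * (n * (M * U₂ y y′))          ≡⟨ arith₁ n M (U₂ y y′) ⟩
          M * (n * (n * U₂ y y′))          ≤⟨ *-monoʳ-≤ M (*-monoʳ-≤ n (subst (λ i → i * U₂ y y′ ≤ U₁ y) (length-allFin n) h₂)) ⟩
          M * (n * U₁ y)                   ≤⟨ *-monoʳ-≤ M (subst₂ (λ i u → i * U₁ y ≤ u) (length-allFin n) (sym U≡) h₁) ⟩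
          M * U                            ≤⟨ M*U-≤ ⟩
          C₆ * (n * (n * n ^ (2 + j)))     ≡⟨ arith₂ C₆ n (n ^ (2 + j)) ⟩
          n * (n * (C₆ * n ^ (2 + j)))     ∎))
        where
        open ≤-Reasoning
        arith₁ : ∀ n M x → n * (n * (M * x)) ≡ M * (n * (n * x))
        arith₁ = solve-∀
        arith₂ : ∀ c n x → c * (n * (n * x)) ≡ n * (n * (c * x))
        arith₂ = solve-∀

      module _ (y y′ : V) (hU : M * U₂ y y′ ≤ C₆ * n ^ (2 + j)) where

        Suitable : List V → Set
        Suitable T = Unique T × length T ≡ t × Good T y × Good T y′ × t₀ ≤ length (goods T)

        suitable? : ∀ T → Dec (Suitable T)
        suitable? T = uniqueBy? FinP._≟_ T ×-dec ((length T ≟ t) ×-dec (good? T y ×-dec (good? T y′ ×-dec (t₀ ≤? length (goods T)))))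

        W = vtuples {n} (2 + j)

        typed-in : ∀ {w} → w ∈ₗ W → Typed (y ∷ y′ ∷ w) → ∃ λ T → T ∈ₗ tuples centres t × length T ≡ t × Unique T ×
          (∀ {x} → x ∈ₗ T → x ∈ₗ centresOf (fromList (y ∷ y′ ∷ w)))
        typed-in {w} w∈ ty = typed-select (subst (λ i → (y ∷ y′ ∷ w) ∈ₗ vtuples (2 + i)) (tuples-length {xs = allFin n} (2 + j) w∈) (∈-vtuples (y ∷ y′ ∷ w))) ty

        HeadIn : List V → List V → Set
        HeadIn ys []      = ⊥
        HeadIn ys (z ∷ _) = z ∈ₗ ys

        headIn? : ∀ ys w → Dec (HeadIn ys w)
        headIn? ys []      = no id
        headIn? ys (z ∷ _) = z ∈ₗ? ys

        #-headIn : ∀ ys → # (headIn? ys) W ≤ length ys * n ^ (1 + j)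
        #-headIn ys = ≤-trans (unique-⊆-length (ListP.≡-dec FinP._≟_) (UniqueP.filter⁺ (headIn? ys) (vtuples-unique (2 + j))) inc)
            (≤-reflexive (trans (length-cpw _∷_ ys (vtuples (1 + j))) (cong (length ys *_) (length-vtuples {n} (1 + j)))))
          where
          inc : ∀ {w} → w ∈ₗ filter (headIn? ys) W → w ∈ₗ cartesianProductWith _∷_ ys (vtuples (1 + j))
          inc {[]} w∈ = ⊥-elim (proj₂ (∈-filter⁻ (headIn? ys) {xs = W} w∈))
          inc {z ∷ w} w∈ = let (p , h) = ∈-filter⁻ (headIn? ys) {xs = W} w∈ in ∈-cartesianProductWith⁺ _∷_ h
            (subst (λ i → w ∈ₗ vtuples i) (suc-injective (tuples-length {xs = allFin n} (2 + j) p)) (∈-vtuples w))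

        Q? : ∀ T w → Dec (length (goods T) < t₀ × HeadIn (goods T) w)
        Q? T w = (length (goods T) <? t₀) ×-dec headIn? (goods T) w

        #-Q : ∀ T → # (Q? T) (filter (λ w → typed? (y ∷ y′ ∷ w)) W) ≤ t₀ * n ^ (1 + j)
        #-Q T = go (length (goods T) <? t₀)
          where
          go : Dec (length (goods T) < t₀) → # (Q? T) (filter (λ w → typed? (y ∷ y′ ∷ w)) W) ≤ t₀ * n ^ (1 + j)
          go (no big) = ≤-trans (≤-reflexive (#-none (Q? T) (filter (λ w → typed? (y ∷ y′ ∷ w)) W) (λ _ h → big (proj₁ h)))) z≤n
          go (yes sm) = ≤-trans (#-filter-≤ (Q? T) (λ w → typed? (y ∷ y′ ∷ w)) W)
            (≤-trans (#-mono (Q? T) (headIn? (goods T)) W (λ _ → proj₂)) (≤-trans (#-headIn (goods T)) (*-monoˡ-≤ (n ^ (1 + j)) (<⇒≤ sm))))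

        -- Otherwise every typed completion of y, y′ has its first entry among fewer than `t₀` good
        -- vertices of one of boundedly many T, which allows O(n^(k - 4)) completions. But at most a
        -- proportion C₆/M < 1 of all n^(k - 3) completions is untyped.
        unsuitable : (∀ {T} → T ∈ₗ tuples centres t → ¬ Suitable T) → ⊥
        unsuitable none = <⇒≱ hn₄ (cancelˡ (n ^ (1 + j)) (^-positive (1 + j) 1≤n) (≤-trans (≤-reflexive (*-comm (n ^ (1 + j)) n))
            (≤-trans last (≤-reflexive (*-comm (M * (K₀ ^ t * t₀)) (n ^ (1 + j)))))))
          where
          typedW = filter (λ w → typed? (y ∷ y′ ∷ w)) W
          place : ∀ {w} → w ∈ₗ typedW → ∃ λ T → T ∈ₗ tuples centres t × length (goods T) < t₀ × HeadIn (goods T) w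
          place {w} w∈ = let (w∈W , ty) = ∈-filter⁻ (λ w → typed? (y ∷ y′ ∷ w)) {xs = W} w∈
                             (T , T∈ , lT , uT , sub) = typed-in w∈W ty
                             good : ∀ {v} → v ∈ₗ (y ∷ y′ ∷ w) → Good T v
                             good = λ v∈ → centresOf-good {fromList (y ∷ y′ ∷ w)} {T} sub (∈-fromList⁺ v∈)
                         in T , T∈ , ≰⇒> (λ big → none T∈ (uT , lT , good (here refl) , good (there (here refl)) , big)) ,
                            head {T} w (tuples-length {xs = allFin n} (2 + j) w∈W) (λ v∈ → ∈-goods {T} (good (there (there v∈))))
            where
            head : ∀ {T} w → length w ≡ 2 + j → (∀ {v} → v ∈ₗ w → v ∈ₗ goods T) → HeadIn (goods T) w
            head (z ∷ w) _ h = h (here refl)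
          #-typed : length typedW ≤ K₀ ^ t * (t₀ * n ^ (1 + j))
          #-typed = ≤-trans (union-bound-const Q? (t₀ * n ^ (1 + j)) typedW (tuples centres t) place (λ {T} _ → #-Q T))
            (*-monoˡ-≤ (t₀ * n ^ (1 + j)) (≤-trans (≤-reflexive (length-tuples centres t)) (^-monoˡ-≤ t few-centres)))
          last : n * n ^ (1 + j) ≤ M * (K₀ ^ t * t₀) * n ^ (1 + j)
          last = +-cancelˡ-≤ (C₆ * n ^ (2 + j)) _ _ (begin
            C₆ * n ^ (2 + j) + n ^ (2 + j)                    ≡⟨ +-comm (C₆ * n ^ (2 + j)) _ ⟩
            suc C₆ * n ^ (2 + j)                              ≤⟨ *-monoˡ-≤ (n ^ (2 + j)) hM ⟩
            M * n ^ (2 + j)                                   ≡⟨ cong (M *_) (trans (sym (length-vtuples {n} (2 + j))) (#-¬ (λ w → typed? (y ∷ y′ ∷ w)) W)) ⟩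
            M * (length typedW + U₂ y y′)                     ≤⟨ *-monoʳ-≤ M (+-monoˡ-≤ (U₂ y y′) #-typed) ⟩
            M * (K₀ ^ t * (t₀ * n ^ (1 + j)) + U₂ y y′)       ≡⟨ arith M (K₀ ^ t) t₀ (n ^ (1 + j)) (U₂ y y′) ⟩
            M * U₂ y y′ + M * (K₀ ^ t * t₀) * n ^ (1 + j)     ≤⟨ +-monoˡ-≤ _ hU ⟩
            C₆ * n ^ (2 + j) + M * (K₀ ^ t * t₀) * n ^ (1 + j) ∎)
            where
            open ≤-Reasoning
            arith : ∀ M a b x u → M * (a * (b * x) + u) ≡ M * u + M * (a * b) * x
            arith = solve-∀

        -- A typed completion through z has t centres of its own. One outside T would attach to T at
        -- y and y′, so they are exactly T, and z is good. Hence a bad z spoils all its completions,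
        -- and there are few bad z.
        untyped : ∀ {T} → Suitable T → ∀ {z} → ¬ Good T z → ∀ {w} → w ∈ₗ vtuples (1 + j) → ¬ Typed (y ∷ y′ ∷ z ∷ w)
        untyped {T} (uT , lT , gy , gy′ , big) {z} bad {w} w∈ ty
          with typed-in (∈-cartesianProductWith⁺ _∷_ (∈-allFin z) w∈) ty
        ... | T′ , _ , lT′ , uT′ , sub with any? (λ x → ¬? (x ∈ₗ? T)) T′
        ... | yes p = let (x , x∈ , x∉) = find p
                          f∋y = ∈-fromList⁺ {w = y ∷ y′ ∷ z ∷ w} (here refl)
                          f∋y′ = ∈-fromList⁺ {w = y ∷ y′ ∷ z ∷ w} (there (here refl))
                          yy′ = λ eq → fresh⇒∉ (y′ ∷ z ∷ w) (proj₂ (proj₁ ty)) (here refl) (here (sym eq))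
                      in attach T lT uT big yy′ gy gy′ x∉
                           (λ eq → centresOf-∉ (sub x∈) (subst (_∈ _) (sym eq) f∋y)) (λ eq → centresOf-∉ (sub x∈) (subst (_∈ _) (sym eq) f∋y′))
                           (centresOf-K₃ (sub x∈) f∋y f∋y′) (centresOf-K₂ (sub x∈) f∋y) (centresOf-K₂ (sub x∈) f∋y′)
        ... | no ¬p = bad (centresOf-good {fromList (y ∷ y′ ∷ z ∷ w)} {T}
              (sub ∘ unique-⊇ FinP._≟_ uT′ (≤-reflexive (trans lT (sym lT′))) (λ {x} x∈ → decidable-stable (x ∈ₗ? T) (λ x∉ → ¬p (lose x∈ x∉))))
              (∈-fromList⁺ {w = y ∷ y′ ∷ z ∷ w} (there (there (here refl)))))

        few-bad : ∀ {T} → Suitable T → M * length (bads T) ≤ C₆ * n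
        few-bad {T} st = cancelˡ (n ^ (1 + j)) (^-positive (1 + j) 1≤n) (begin
          n ^ (1 + j) * (M * length (bads T))      ≡⟨ arith₁ (n ^ (1 + j)) M (length (bads T)) ⟩
          M * (length (bads T) * n ^ (1 + j))      ≤⟨ *-monoʳ-≤ M (∑-≥-filter {f = f} (¬? ∘ good? T) (n ^ (1 + j)) (allFin n) (λ {z} bad →
                                                        ≤-trans (≤-reflexive (sym (length-vtuples {n} (1 + j)))) (#-all _ (vtuples (1 + j)) (untyped st bad)))) ⟩
          M * ∑ f (allFin n)                       ≡⟨ cong (M *_) (#-cpw (λ w → ¬? (typed? (y ∷ y′ ∷ w))) _∷_ (allFin n) (vtuples (1 + j))) ⟨
          M * U₂ y y′                              ≤⟨ hU ⟩
          C₆ * (n * n ^ (1 + j))                   ≡⟨ arith₂ C₆ n (n ^ (1 + j)) ⟩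
          n ^ (1 + j) * (C₆ * n)                   ∎)
          where
          open ≤-Reasoning
          f = λ z → # (λ w → ¬? (typed? (y ∷ y′ ∷ z ∷ w))) (vtuples (1 + j))
          arith₁ : ∀ x M b → x * (M * b) ≡ M * (b * x)
          arith₁ = solve-∀
          arith₂ : ∀ c n x → c * (n * x) ≡ x * (c * n)
          arith₂ = solve-∀

        found : ∃ λ T → length T ≡ t × Unique T × t₀ ≤ length (goods T) × M * length (bads T) ≤ C₆ * n
        found = go (any? suitable? (tuples centres t))
          where
          go : Dec (Any Suitable (tuples centres t)) → _
          go (no ¬p) = ⊥-elim (unsuitable (λ T∈ s → ¬p (lose T∈ s)))
          go (yes p) = let (T , _ , st) = find p in T , proj₁ (proj₂ st) , proj₁ st , proj₂ (proj₂ (proj₂ (proj₂ st))) , few-bad st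

      result : ∃ λ T → length T ≡ t × Unique T × t₀ ≤ length (goods T) × M * length (bads T) ≤ C₆ * n
      result = let (y , y′ , hU) = anchor in found y y′ hU

-- Comparison with the extremal family

-- By `hn` at least half of all words are fresh, and one set contains at most K^m of them.
fresh-cover : ∀ {n} K m Z (L : List (Subset n)) → (∀ {e} → e ∈ₗ L → ∣ e ∣ ≤ K) →
  (∀ {w} → w ∈ₗ vtuples m → Fresh Z w → ∃ λ e → e ∈ₗ L × All (_∈ e) w) →
  2 * (m * (length Z + m)) ≤ n → 1 ≤ n → n ^ m ≤ 2 * (length L * K ^ m)
fresh-cover {n} K m Z L hK cov hn 1≤n = ≤-trans half (*-monoʳ-≤ 2 (#-tuples-within (fresh? Z) K m L hK cov))
  where
  open ≤-Reasoning
  fr = # (fresh? Z) (vtuples m)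
  nf = # (λ w → ¬? (fresh? Z w)) (vtuples m)
  arith₁ : ∀ n x → n * (2 * x) ≡ 2 * (n * x)
  arith₁ = solve-∀
  arith₂ : ∀ x y → x + y + (x + y) ≡ 2 * x + 2 * y
  arith₂ = solve-∀
  total : n ^ m ≡ fr + nf
  total = trans (sym (length-vtuples {n} m)) (#-¬ (fresh? Z) (vtuples m))
  2nf≤ : 2 * nf ≤ n ^ m
  2nf≤ = cancelˡ n 1≤n (begin
    n * (2 * nf)                        ≡⟨ arith₁ n nf ⟩
    2 * (n * nf)                        ≤⟨ *-monoʳ-≤ 2 (#-nonfresh Z m) ⟩
    2 * (m * (length Z + m) * n ^ m)    ≡⟨ *-assoc 2 (m * (length Z + m)) (n ^ m) ⟨
    2 * (m * (length Z + m)) * n ^ m    ≤⟨ *-monoˡ-≤ (n ^ m) hn ⟩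
    n * n ^ m                           ∎)
  half : n ^ m ≤ 2 * fr
  half = +-cancelʳ-≤ (n ^ m) _ _ (begin
    n ^ m + n ^ m                       ≡⟨ cong₂ _+_ total total ⟩
    fr + nf + (fr + nf)                 ≡⟨ arith₂ fr nf ⟩
    2 * fr + 2 * nf                     ≤⟨ +-monoʳ-≤ (2 * fr) 2nf≤ ⟩
    2 * fr + n ^ m                      ∎)

#-∋-≤ : ∀ {n} K (ys : List (Fin n)) L → Unique ys → (∀ {e} → e ∈ₗ L → ∣ e ∣ ≤ K) → ∑ (λ y → # (λ e → y ∈? e) L) ys ≤ length L * K
#-∋-≤ K ys L u hK = ≤-trans (≤-reflexive (#-swap (λ y e → y ∈? e) L ys)) (∑-≤ K L (λ {e} e∈ →
  ≤-trans (Unique-⊆-elems (UniqueP.filter⁺ (_∈? e) u) (λ p → proj₂ (∈-filter⁻ (_∈? e) {xs = ys} p))) (hK e∈)))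

_∈E?_ : ∀ {n} (e : Subset n) L → Dec (e ∈ₗ L)
_∈E?_ = DecM._∈?_ _≟S_

module Comparison {j n : ℕ} (G : KGraph (5 + j) n) (q m : ℕ)
  (large₁ : (3 + m) + (3 + m) * (5 + j) ≤ q) (free : ¬ ContainsCycle (3 + m) G)
  (t : ℕ) (1≤t : 1 ≤ t) (parity : 3 + m ≡ 2 * t + 1 ⊎ 3 + m ≡ 2 * t + 2)
  (large₂ : 2 * t + (2 * (5 + j) + 2) + (2 * t + 2) * (5 + j) ≤ q)
  (T : List (Fin n)) (lT : length T ≡ t) (uT : Unique T)
  (big : Attach.t₀ G q (3 + m) t 1≤t parity large₂ free ≤ length (Attach.goods G q (3 + m) t 1≤t parity large₂ free T))
  (1≤n : 1 ≤ n) (hn : 2 * ((3 + j) * (2 + q + (3 + j))) ≤ n) where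

  open Cycles G q
  open Attach G q (3 + m) t 1≤t parity large₂ free
  open Sparse G q m (s≤s (s≤s (s≤s z≤n))) large₁ free using (sparse)

  private
    k = 5 + j
    V = Fin n
    K = Ker (edges G) q

  S : Subset n
  S = fromList T

  ∣S∣ : ∣ S ∣ ≡ t
  ∣S∣ = trans (∣fromList∣ uT) lT

  meeting : List (Subset n)
  meeting = filter (λ e → Meets? e S) (ksubsets n k)

  length-meeting : length meeting ≡ n C k ∸ (n ∸ t) C k
  length-meeting = trans (#-meeting k S) (cong (λ i → n C k ∸ (n ∸ i) C k) ∣S∣)

  missing : List (Subset n)
  missing = filter (λ e → ¬? (e ∈E? edges G)) meeting

  outer : List (Subset n)
  outer = filter (λ e → ¬? (Meets? e S)) (edges G)

  outer-in : ∀ {e} → e ∈ₗ outer → e ∈ₗ edges G × ¬ Meets e S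
  outer-in = ∈-filter⁻ (λ e → ¬? (Meets? e S)) {xs = edges G}

  outer-∉ : ∀ {e} → e ∈ₗ outer → ∀ {x} → x ∈ e → x ∉ₗ T
  outer-∉ e∈ x∈ x∈T = proj₂ (outer-in e∈) (_ , x∈ , ∈-fromList⁺ x∈T)

  outer-size : ∀ {e} → e ∈ₗ outer → ∣ e ∣ ≡ k
  outer-size e∈ = edge-size (proj₁ (outer-in e∈))

  outer-unique : Unique outer
  outer-unique = UniqueP.filter⁺ (λ e → ¬? (Meets? e S)) (unique G)

  edges+missing : length (edges G) + length missing ≤ length meeting + length outer
  edges+missing = begin
    length (edges G) + length missing                        ≡⟨ cong (_+ length missing) (#-¬ (λ e → Meets? e S) (edges G)) ⟩
    # (λ e → Meets? e S) (edges G) + length outer + length missing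
      ≤⟨ +-monoˡ-≤ (length missing) (+-monoˡ-≤ (length outer) inner) ⟩
    # (_∈E? edges G) meeting + length outer + length missing  ≡⟨ arith (# (_∈E? edges G) meeting) (length outer) (length missing) ⟩
    # (_∈E? edges G) meeting + length missing + length outer  ≡⟨ cong (_+ length outer) (#-¬ (_∈E? edges G) meeting) ⟨
    length meeting + length outer                             ∎
    where
    open ≤-Reasoning
    arith : ∀ a b c → a + b + c ≡ a + c + b
    arith = solve-∀
    inner : # (λ e → Meets? e S) (edges G) ≤ # (_∈E? edges G) meeting
    inner = unique-⊆-length _≟S_ (UniqueP.filter⁺ (λ e → Meets? e S) (unique G)) (λ e∈ →
      let (e∈G , me) = ∈-filter⁻ (λ e → Meets? e S) {xs = edges G} e∈
      in ∈-filter⁺ (_∈E? edges G) (∈-filter⁺ (λ e → Meets? e S) (∈-ksubsets⁺ k (edge-size e∈G)) me) e∈G)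

  spoilt? : ∀ y → Dec (¬ Good T y × y ∉ₗ T)
  spoilt? y = ¬? (good? T y) ×-dec ¬? (y ∈ₗ? T)

  spoilt : List V
  spoilt = filter spoilt? (allFin n)

  spoilt-unique : Unique spoilt
  spoilt-unique = UniqueP.filter⁺ spoilt? (UniqueP.allFin⁺ n)

  missing-in : ∀ {e} → e ∈ₗ missing → ∣ e ∣ ≡ k × Meets e S × e ∉ₗ edges G
  missing-in e∈ = let (e∈m , e∉) = ∈-filter⁻ (λ e → ¬? (e ∈E? edges G)) {xs = meeting} e∈
                      (e∈k , me) = ∈-filter⁻ (λ e → Meets? e S) {xs = ksubsets n k} e∈m
                  in ∈-ksubsets⁻ k e∈k , me , e∉

  -- Some x in T forms no kernel with y, so a list of at most q vertices meets every edge through x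
  -- and y elsewhere; all k-sets through x and y that avoid this list are missing.
  missing-at : ∀ {y} → y ∈ₗ spoilt → n ^ (3 + j) ≤ 2 * (# (λ e → y ∈? e) missing * k ^ (3 + j))
  missing-at {y} y∈ = go (proj₂ (∈-filter⁻ spoilt? {xs = allFin n} y∈))
    where
    My = filter (λ e → y ∈? e) missing
    go : ¬ Good T y × y ∉ₗ T → n ^ (3 + j) ≤ 2 * (length My * k ^ (3 + j))
    go (bad , y∉) = weak (find (AllP.¬All⇒Any¬ (λ x → Ker? (edges G) q (x ∷ y ∷ [])) T (λ all → bad (y∉ , all))))
      where
      weak : (∃ λ x → x ∈ₗ T × ¬ K (x ∷ y ∷ [])) → n ^ (3 + j) ≤ 2 * (length My * k ^ (3 + j))
      weak (x , x∈ , ¬ker) = cover (ker-or-cover (edges G) q (x ∷ y ∷ []))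
        where
        xy : x ≢ y
        xy refl = y∉ x∈
        cover : K (x ∷ y ∷ []) ⊎ (∃ λ Z → length Z ≤ q × Covers (edges G) (x ∷ y ∷ []) Z) → n ^ (3 + j) ≤ 2 * (length My * k ^ (3 + j))
        cover (inj₁ ker) = ⊥-elim (¬ker ker)
        cover (inj₂ (Z , le , cov)) = fresh-cover k (3 + j) (x ∷ y ∷ Z) My
          (λ e∈ → ≤-reflexive (proj₁ (missing-in (proj₁ (∈-filter⁻ (λ e → y ∈? e) {xs = missing} e∈)))))
          (λ {w} w∈ fr → fromList (x ∷ y ∷ w) , in-My w w∈ fr , All.tabulate (λ z∈ → ∈-fromList⁺ {w = x ∷ y ∷ w} (there (there z∈))))
          (≤-trans (*-monoʳ-≤ 2 (*-monoʳ-≤ (3 + j) (+-monoˡ-≤ (3 + j) (s≤s (s≤s le))))) hn) 1≤n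
          where
          in-My : ∀ w → w ∈ₗ vtuples (3 + j) → Fresh (x ∷ y ∷ Z) w → fromList (x ∷ y ∷ w) ∈ₗ My
          in-My w w∈ fr = ∈-filter⁺ (λ e → y ∈? e) (∈-filter⁺ (λ e → ¬? (e ∈E? edges G))
              (∈-filter⁺ (λ e → Meets? e S) (∈-ksubsets⁺ k size) (x , x∈e , ∈-fromList⁺ x∈)) not-in) y∈e
            where
            off : ∀ {z} → z ∈ₗ w → z ∉ₗ x ∷ y ∷ Z
            off = fresh⇒∉ w fr
            u : Unique (x ∷ y ∷ w)
            u = Unique-∷ (λ { (here eq) → xy eq ; (there p) → off p (here refl) }) (Unique-∷ (λ p → off p (there (here refl))) (fresh⇒unique w fr))
            size : ∣ fromList (x ∷ y ∷ w) ∣ ≡ k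
            size = trans (∣fromList∣ u) (cong (2 +_) (tuples-length {xs = allFin n} (3 + j) w∈))
            x∈e : x ∈ fromList (x ∷ y ∷ w)
            x∈e = ∈-fromList⁺ {w = x ∷ y ∷ w} (here refl)
            y∈e : y ∈ fromList (x ∷ y ∷ w)
            y∈e = ∈-fromList⁺ {w = x ∷ y ∷ w} (there (here refl))
            not-in : fromList (x ∷ y ∷ w) ∉ₗ edges G
            not-in e∈ = let (z , z∈Z , z∈e , z∉) = cov e∈ (x∈e ∷ y∈e ∷ []) in
              case ∈-fromList⁻ (x ∷ y ∷ w) z∈e of λ
                { (here eq) → z∉ (here eq) ; (there (here eq)) → z∉ (there (here eq)) ; (there (there p)) → off p (there (there z∈Z)) }

  missing-≥ : length spoilt * n ^ (3 + j) ≤ 2 * k ^ (4 + j) * length missing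
  missing-≥ = begin
    length spoilt * n ^ (3 + j)                                              ≤⟨ ∑-≥ (n ^ (3 + j)) spoilt missing-at ⟩
    ∑ (λ y → 2 * (# (λ e → y ∈? e) missing * k ^ (3 + j))) spoilt            ≡⟨ ∑-ext spoilt (λ y → arith₁ (# (λ e → y ∈? e) missing) (k ^ (3 + j))) ⟩
    ∑ (λ y → 2 * k ^ (3 + j) * # (λ e → y ∈? e) missing) spoilt              ≡⟨ ∑-* (2 * k ^ (3 + j)) _ spoilt ⟩
    2 * k ^ (3 + j) * ∑ (λ y → # (λ e → y ∈? e) missing) spoilt              ≤⟨ *-monoʳ-≤ (2 * k ^ (3 + j)) (#-∋-≤ k spoilt missing spoilt-unique (≤-reflexive ∘ proj₁ ∘ missing-in)) ⟩
    2 * k ^ (3 + j) * (length missing * k)                                   ≡⟨ arith₂ (k ^ (3 + j)) (length missing) k ⟩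
    2 * k ^ (4 + j) * length missing                                         ∎
    where
    open ≤-Reasoning
    arith₁ : ∀ a b → 2 * (a * b) ≡ 2 * b * a
    arith₁ = solve-∀
    arith₂ : ∀ a b c → 2 * a * (b * c) ≡ 2 * (c * a) * b
    arith₂ = solve-∀

  goodIn : Subset n → List V
  goodIn e = filter (good? T) (elems e)

  goodIn-unique : ∀ e → Unique (goodIn e)
  goodIn-unique e = UniqueP.filter⁺ (good? T) (elems-unique e)

  goodIn-in : ∀ {e y} → y ∈ₗ goodIn e → y ∈ e × Good T y
  goodIn-in {e} y∈ = let (p , g) = ∈-filter⁻ (good? T) {xs = elems e} y∈ in ∈-elems⁻ p , g

  low? : ∀ e → Dec (length (goodIn e) ≤ 1)
  low? e = length (goodIn e) ≤? 1

  low : List (Subset n)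
  low = filter low? outer

  -- All but one vertex of an edge of low are spoilt, so its (k − 1)-subsets are few.
  low-≤ : length low ≤ n * length spoilt ^ (3 + j) * q
  low-≤ = subst (λ i → length low ≤ i * q) (trans (length-cpw _∷_ (allFin n) (tuples spoilt (3 + j))) (cong₂ _*_ (length-allFin n) (length-tuples spoilt (3 + j))))
    (sparse low rs (UniqueP.filter⁺ low? outer-unique) (λ e∈ → proj₁ (outer-in (proj₁ (low-in e∈)))) reason)
    where
    rs = cartesianProductWith _∷_ (allFin n) (tuples spoilt (3 + j))
    low-in : ∀ {e} → e ∈ₗ low → e ∈ₗ outer × length (goodIn e) ≤ 1
    low-in = ∈-filter⁻ low? {xs = outer}
    reason : ∀ {e y} → e ∈ₗ low → y ∈ e → ∃ λ r → r ∈ₗ rs × Unique r × suc (length r) ≡ k × All (_∈ e) r × y ∉ₗ r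
    reason {e} {y} e∈ y∈ = r , r∈ gs refl , ur , lr , All.tabulate (proj₁ ∘ r-in) , (λ p → proj₂ (r-in p) refl)
      where
      ws = rest e (y ∷ [])
      gs = filter (good? T) ws
      bs = filter (¬? ∘ good? T) ws
      r = gs ++ bs
      uw : Unique ws
      uw = rest-unique e (y ∷ [])
      ur : Unique r
      ur = UniqueP.++⁺ (UniqueP.filter⁺ (good? T) uw) (UniqueP.filter⁺ (¬? ∘ good? T) uw)
        (λ (p , p′) → proj₂ (∈-filter⁻ (¬? ∘ good? T) {xs = ws} p′) (proj₂ (∈-filter⁻ (good? T) {xs = ws} p)))
      w-in : ∀ {z} → z ∈ₗ ws → z ∈ e × z ≢ y
      w-in z∈ = let (p , z∉) = ∈-rest⁻ e (y ∷ []) z∈ in p , (λ eq → z∉ (here eq))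
      r-in : ∀ {z} → z ∈ₗ r → z ∈ e × z ≢ y
      r-in z∈ = w-in ([ proj₁ ∘ ∈-filter⁻ (good? T) {xs = ws} , proj₁ ∘ ∈-filter⁻ (¬? ∘ good? T) {xs = ws} ]′ (∈-++⁻ gs z∈))
      lr : suc (length r) ≡ k
      lr = trans (cong suc (trans (length-++ gs) (sym (#-¬ (good? T) ws))))
             (trans (length-rest e ([] ∷ []) (y∈ ∷ [])) (outer-size (proj₁ (low-in e∈))))
      gs≤1 : length gs ≤ 1
      gs≤1 = ≤-trans (#-filter-≤ (good? T) (λ z → ¬? (z ∈ₗ? (y ∷ []))) (elems e)) (proj₂ (low-in e∈))
      bad-spoilt : ∀ {z} → z ∈ₗ bs → z ∈ₗ spoilt
      bad-spoilt z∈ = let (p , ng) = ∈-filter⁻ (¬? ∘ good? T) {xs = ws} z∈ in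
        ∈-filter⁺ spoilt? (∈-allFin _) (ng , outer-∉ (proj₁ (low-in e∈)) (proj₁ (w-in p)))
      tup : ∀ w → length w ≡ 3 + j → (∀ {z} → z ∈ₗ w → z ∈ₗ bs) → w ∈ₗ tuples spoilt (3 + j)
      tup w lw sub = subst (λ i → w ∈ₗ tuples spoilt i) lw (∈-tuples w (bad-spoilt ∘ sub))
      r∈ : ∀ gs′ → gs ≡ gs′ → r ∈ₗ rs
      r∈ [] eq = subst (_∈ₗ rs) (cong (_++ bs) (sym eq)) (head bs (trans (cong (λ g → length (g ++ bs)) (sym eq)) (suc-injective lr)) id)
        where
        head : ∀ b → length b ≡ 4 + j → (∀ {z} → z ∈ₗ b → z ∈ₗ bs) → b ∈ₗ rs
        head (z ∷ b) lb sub = ∈-cartesianProductWith⁺ _∷_ (∈-allFin z) (tup b (suc-injective lb) (sub ∘ there))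
      r∈ (g ∷ []) eq = subst (_∈ₗ rs) (cong (_++ bs) (sym eq)) (∈-cartesianProductWith⁺ _∷_ (∈-allFin g)
        (tup bs (suc-injective (trans (cong (λ g → length (g ++ bs)) (sym eq)) (suc-injective lr))) id))
      r∈ (_ ∷ _ ∷ _) eq = ⊥-elim (<⇒≱ (s≤s (s≤s z≤n)) (subst (λ g → length g ≤ 1) eq gs≤1))

  -- With b spoilt vertices, `low` has at most q·n·b^(k - 2) edges and at least a constant times
  -- b·n^(k - 2) sets are missing. One factor b is kept, a second is at most X·n/M and beats the
  -- constants, the others are bounded by n. The factor 2 later forces both numbers to vanish.
  2*low≤missing : ∀ M X → M * length (filter (¬? ∘ good? T) (allFin n)) ≤ X * n →
    2 * (suc (q * X * (2 * k ^ (4 + j)))) ≤ M → 2 * length low ≤ length missing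
  2*low≤missing M X hM hX = cancelˡ Y (s≤s z≤n) (begin
    Y * (2 * length low)                                 ≡⟨ arith₁ Y (length low) ⟩
    2 * Y * length low                                   ≤⟨ *-monoˡ-≤ (length low) hX ⟩
    M * length low                                       ≤⟨ *-monoʳ-≤ M low-≤ ⟩
    M * (n * (b * (b * b ^ (1 + j))) * q)                ≤⟨ *-monoʳ-≤ M (*-monoˡ-≤ q (*-monoʳ-≤ n (*-monoʳ-≤ b (*-monoʳ-≤ b (^-monoˡ-≤ (1 + j) b≤n))))) ⟩
    M * (n * (b * (b * n ^ (1 + j))) * q)                ≡⟨ arith₂ M n b (n ^ (1 + j)) q ⟩
    q * b * (M * b) * (n * n ^ (1 + j))                  ≤⟨ *-monoˡ-≤ (n * n ^ (1 + j)) (*-monoʳ-≤ (q * b) (≤-trans (*-monoʳ-≤ M b≤bads) hM)) ⟩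
    q * b * (X * n) * (n * n ^ (1 + j))                  ≡⟨ arith₃ q b X n (n ^ (1 + j)) ⟩
    q * X * (b * n ^ (3 + j))                            ≤⟨ *-monoʳ-≤ (q * X) missing-≥ ⟩
    q * X * (2 * k ^ (4 + j) * length missing)           ≡⟨ *-assoc (q * X) (2 * k ^ (4 + j)) (length missing) ⟨
    q * X * (2 * k ^ (4 + j)) * length missing           ≤⟨ *-monoˡ-≤ (length missing) (n≤1+n (q * X * (2 * k ^ (4 + j)))) ⟩
    Y * length missing                                   ∎)
    where
    open ≤-Reasoning
    Y = suc (q * X * (2 * k ^ (4 + j)))
    b = length spoilt
    b≤n : b ≤ n
    b≤n = ≤-trans (length-filter spoilt? (allFin n)) (≤-reflexive (length-allFin n))
    b≤bads : b ≤ length (filter (¬? ∘ good? T) (allFin n))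
    b≤bads = #-mono spoilt? (¬? ∘ good? T) (allFin n) (λ _ → proj₁)
    arith₁ : ∀ y x → y * (2 * x) ≡ 2 * y * x
    arith₁ = solve-∀
    arith₂ : ∀ M n b x q → M * (n * (b * (b * x)) * q) ≡ q * b * (M * b) * (n * x)
    arith₂ = solve-∀
    arith₃ : ∀ q b X n x → q * b * (X * n) * (n * x) ≡ q * X * (b * (n * (n * x)))
    arith₃ = solve-∀

  others-of : Subset n → V → V → List V
  others-of e y y′ = rest e (y ∷ y′ ∷ [])

  others-in : ∀ e y y′ {z} → z ∈ₗ others-of e y y′ → z ∈ e × z ≢ y × z ≢ y′
  others-in e y y′ z∈ = let (p , z∉) = ∈-rest⁻ e (y ∷ y′ ∷ []) z∈ in p , (λ eq → z∉ (here eq)) , (λ eq → z∉ (there (here eq)))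

  others-unique : ∀ e y y′ → Unique (others-of e y y′)
  others-unique e y y′ = rest-unique e (y ∷ y′ ∷ [])

  others-length : ∀ {e} y y′ → e ∈ₗ outer → length (others-of e y y′) ≤ k
  others-length {e} y y′ e∈ = ≤-trans (length-filter (λ z → ¬? (z ∈ₗ? (y ∷ y′ ∷ []))) (elems e)) (≤-reflexive (trans (length-elems e) (outer-size e∈)))

  -- An edge is a kernel of itself, so prescribing all its vertices inserts it unchanged into a
  -- cycle.
  edge-slot : ∀ {e y y′} → e ∈ₗ outer → y ∈ e → y′ ∈ e → K (y ∷ y′ ∷ others-of e y y′)
  edge-slot {e} {y} {y′} e∈ y∈ y′∈ = Ker-edge (proj₁ (outer-in e∈))
    (λ { (here refl) → y∈ ; (there (here refl)) → y′∈ ; (there (there z∈)) → proj₁ (others-in e y y′ z∈) }) back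
    where
    back : ∀ {z} → z ∈ e → z ∈ₗ y ∷ y′ ∷ others-of e y y′
    back {z} z∈ with z FinP.≟ y | z FinP.≟ y′
    ... | yes eq | _      = here eq
    ... | no _   | yes eq = there (here eq)
    ... | no ne  | no ne′ = there (there (∈-rest⁺ z∈ (λ { (here eq) → ne eq ; (there (here eq)) → ne′ eq })))

  good-avoiding : ∀ {e} → ¬ (length (goodIn e) ≤ 1) → ∀ w → ∃ λ y → y ∈ e × Good T y × y ≢ w
  good-avoiding {e} hi w = let (y , y∈ , y∉) = fresh-pick FinP._≟_ (w ∷ []) id (goodIn-unique e) (λ _ _ → id) (≰⇒> hi)
                               (y∈e , g) = goodIn-in y∈
                           in y , y∈e , g , (λ eq → y∉ (here eq))

  odd-low : 3 + m ≡ 2 * t + 1 → ∀ {e} → e ∈ₗ outer → length (goodIn e) ≤ 1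
  odd-low odd {e} e∈ = decidable-stable (low? e) λ hi →
    -- `good-avoiding` expects a vertex to avoid; for the first choice any vertex serves.
    let (y , y∈ , gy , _) = good-avoiding hi (choose-one hi)
        (y′ , y′∈ , gy′ , ne) = good-avoiding hi y
        E = others-of e y′ y
    in close T lT uT big E [] gy gy′ (edge-slot e∈ y′∈ y∈)
         (subst Unique (sym (++-identityʳ (y′ ∷ E))) (Unique-∷ (λ p → proj₁ (proj₂ (others-in e y′ y p)) refl) (others-unique e y′ y)))
         (λ {a} a∈ → apart y∈ y′∈ ne (subst (a ∈ₗ_) (++-identityʳ (y′ ∷ E)) a∈))
         (≤-trans (≤-reflexive (cong length (++-identityʳ (y′ ∷ E)))) (≤-trans (s≤s (others-length y′ y e∈))
           (≤-trans (m≤n+m (suc k) (suc k)) (≤-reflexive (arith k)))))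
         (s≤s z≤n) (sym odd)
    where
    arith : ∀ k → suc k + suc k ≡ 2 * k + 2
    arith = solve-∀
    choose-one : ¬ (length (goodIn e) ≤ 1) → V
    choose-one hi = head (goodIn e) hi
      where
      head : ∀ ys → ¬ (length ys ≤ 1) → V
      head []      h = ⊥-elim (h z≤n)
      head (y ∷ _) h = y
    apart : ∀ {y y′} → y ∈ e → y′ ∈ e → y′ ≢ y → ∀ {a} → a ∈ₗ y′ ∷ others-of e y′ y → a ∉ₗ T × a ≢ y
    apart y∈ y′∈ ne (here refl) = outer-∉ e∈ y′∈ , ne
    apart {y} {y′} y∈ y′∈ ne (there p) = outer-∉ e∈ (proj₁ (others-in e y′ y p)) , proj₂ (proj₂ (others-in e y′ y p))

  -- The two edges form a path y′, w, y outside T. Its ends must be good and different from w, which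
  -- is why each edge needs two good vertices.
  even-meet : 3 + m ≡ 2 * t + 2 → ∀ {e e′ w} → e ∈ₗ outer → ¬ (length (goodIn e) ≤ 1) → e′ ∈ₗ outer → ¬ (length (goodIn e′) ≤ 1) →
    w ∈ e → w ∈ e′ → (∀ {z} → z ∈ e → z ∈ e′ → z ≡ w) → ⊥
  even-meet even {e} {e′} {w} e∈ hi e′∈ hi′ w∈ w∈′ only =
    let (y , y∈ , gy , yw) = good-avoiding hi w
        (y′ , y′∈ , gy′ , y′w) = good-avoiding hi′ w
        E′ = others-of e′ y′ w
        E = others-of e w y
    in close T lT uT big E′ ((w , E) ∷ []) gy gy′ (edge-slot e′∈ y′∈ w∈′ , edge-slot e∈ w∈ y∈)
         (uniq y y′ y′∈ y′w) (apart y y′ y∈ yw y′∈)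
         (len y y′) ≤-refl (sym even)
    where
    arith : ∀ k → suc k + suc k ≡ 2 * k + 2
    arith = solve-∀
    atomsOf : V → V → List V
    atomsOf y y′ = (y′ ∷ others-of e′ y′ w) ++ ((w ∷ others-of e w y) ++ [])
    uniq : ∀ y y′ → y′ ∈ e′ → y′ ≢ w → Unique (atomsOf y y′)
    uniq y y′ y′∈ y′w = UniqueP.++⁺
      (Unique-∷ (λ p → proj₁ (proj₂ (others-in e′ y′ w p)) refl) (others-unique e′ y′ w))
      (subst Unique (sym (++-identityʳ (w ∷ others-of e w y))) (Unique-∷ (λ p → proj₁ (proj₂ (others-in e w y p)) refl) (others-unique e w y)))
      (λ {a} (p , p′) → disj p (subst (a ∈ₗ_) (++-identityʳ (w ∷ others-of e w y)) p′))
      where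
      disj : ∀ {a} → a ∈ₗ y′ ∷ others-of e′ y′ w → a ∈ₗ w ∷ others-of e w y → ⊥
      disj (here refl) (here eq)   = y′w eq
      disj (here refl) (there p)   = y′w (only (proj₁ (others-in e w y p)) y′∈)
      disj (there p)   (here refl) = proj₂ (proj₂ (others-in e′ y′ w p)) refl
      disj (there p)   (there r)   = proj₂ (proj₂ (others-in e′ y′ w p)) (only (proj₁ (others-in e w y r)) (proj₁ (others-in e′ y′ w p)))
    apart : ∀ y y′ → y ∈ e → y ≢ w → y′ ∈ e′ → ∀ {a} → a ∈ₗ atomsOf y y′ → a ∉ₗ T × a ≢ y
    apart y y′ y∈ yw y′∈ {a} a∈ with ∈-++⁻ (y′ ∷ others-of e′ y′ w) a∈
    ... | inj₁ (here refl) = outer-∉ e′∈ y′∈ , (λ { refl → yw (only y∈ y′∈) })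
    ... | inj₁ (there p)   = outer-∉ e′∈ (proj₁ (others-in e′ y′ w p)) , (λ { refl → yw (only y∈ (proj₁ (others-in e′ y′ w p))) })
    ... | inj₂ p with subst (a ∈ₗ_) (++-identityʳ (w ∷ others-of e w y)) p
    ...   | here refl = outer-∉ e∈ w∈ , (yw ∘ sym)
    ...   | there r   = outer-∉ e∈ (proj₁ (others-in e w y r)) , proj₂ (proj₂ (others-in e w y r))
    len : ∀ y y′ → length (atomsOf y y′) ≤ 2 * k + 2
    len y y′ = ≤-trans (≤-reflexive (trans (length-++ (y′ ∷ others-of e′ y′ w)) (cong (λ i → length (y′ ∷ others-of e′ y′ w) + length i) (++-identityʳ (w ∷ others-of e w y)))))
      (≤-trans (+-mono-≤ (s≤s (others-length y′ w e′∈)) (s≤s (others-length w y e∈))) (≤-reflexive (arith k)))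

-- Families without singleton intersections

-- The complements of the members of J are the generators of a union-closed family; a ▷ r says that every
-- generator containing a contains r.
module Twins {k : ℕ} (5≤k : 5 ≤ k) (J : List (Subset k))
  (cov : ∀ ws → Unique ws → length ws ≡ 3 → ∃ λ D → D ∈ₗ J × (∃ λ p → p ∉ D) × (∀ {p} → p ∉ D → p ∈ₗ ws)) where

  _▷_ : Fin k → Fin k → Set
  a ▷ r = a ≢ r × All (λ D → a ∉ D → r ∉ D) J

  _▷?_ : ∀ a r → Dec (a ▷ r)
  a ▷? r = ¬? (a FinP.≟ r) ×-dec all? (λ D → ¬? (a ∈? D) →-dec ¬? (r ∈? D)) J

  ▷-trans : ∀ {a b c} → a ≢ c → a ▷ b → b ▷ c → a ▷ c
  ▷-trans ac (_ , h) (_ , h′) = ac , All.tabulate (λ D∈ a∉ → All.lookup h′ D∈ (All.lookup h D∈ a∉))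

  Single : Fin k → Set
  Single c = ∃ λ D → D ∈ₗ J × c ∉ D × (∀ {p} → p ∉ D → p ≡ c)

  private
    _⊏_ : Fin k → Fin k → Set
    a ⊏ b = a ▷ b × ¬ (b ▷ a)

    ⊏-spo : IsStrictPartialOrder _≡_ _⊏_
    ⊏-spo = record
      { isEquivalence = ≡.isEquivalence
      ; irrefl = λ { refl ((ne , _) , _) → ne refl }
      ; trans = λ { (ab , ¬ba) (bc , ¬cb) →
          ▷-trans (λ { refl → ¬ba bc }) ab bc , (λ ca → ¬cb (▷-trans (proj₁ bc ∘ sym) ca ab)) }
      ; <-resp-≈ = (λ { refl h → h }) , (λ { refl h → h }) }

    outside-of : ∀ ws → length ws ≤ 4 → ∃ λ p → p ∉ₗ ws
    outside-of ws le = let (p , _ , p∉) = fresh-pick FinP._≟_ ws id (UniqueP.allFin⁺ k) (λ _ _ → id)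
                                            (≤-trans (s≤s le) (≤-trans 5≤k (≤-reflexive (sym (length-allFin k)))))
                       in p , p∉

    distinct₃ : ∀ {a b c : Fin k} → a ≢ b → b ≢ c → a ≢ c → Unique (a ∷ b ∷ c ∷ [])
    distinct₃ ab bc ac = (ab ∷ ac ∷ []) ∷ (bc ∷ []) ∷ [] ∷ []

  module _ (pred : ∀ r → ∃ λ a → a ▷ r) where

    private
      Twin : Fin k → Fin k → Set
      Twin a b = a ▷ b × b ▷ a

      -- Every position has a predecessor. As long as the step is strict, the well-founded `_⊏_`
      -- descends; where it is not, a position and its predecessor imply each other.
      twin-above : ∀ z → ∃ λ a → ∃ λ b → Twin a b × (a ≡ z ⊎ a ▷ z)
      twin-above z = go z (spo-wellFounded ⊏-spo z)
        where
        go : ∀ z → Acc _⊏_ z → ∃ λ a → ∃ λ b → Twin a b × (a ≡ z ⊎ a ▷ z)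
        go z (acc rec) with pred z
        ... | a , az with z ▷? a
        ... | yes za = z , a , (za , az) , inj₁ refl
        ... | no ¬za with go a (rec (az , ¬za))
        ... | a′ , b′ , tw , inj₁ refl = a′ , b′ , tw , inj₂ az
        ... | a′ , b′ , tw , inj₂ a′a  = a′ , b′ , tw , inj₂ (▷-trans (λ { refl → ¬za a′a }) a′a az)

      module TwoClasses {a b a′ b′ : Fin k} (ab : Twin a b) (a′b′ : Twin a′ b′) (a′≢a : a′ ≢ a) (a′≢b : a′ ≢ b)
        (b′≢a : b′ ≢ a) (b′≢b : b′ ≢ b) where

        needs : ∀ {c d} → c ▷ d → ∀ {ws D} → D ∈ₗ J → (∀ {p} → p ∉ D → p ∈ₗ ws) → d ∉ₗ ws → c ∈ D
        needs {c} cd {ws} {D} D∈ sub d∉ = decidable-stable (c ∈? D) (λ c∉ → d∉ (sub (All.lookup (proj₂ cd) D∈ c∉)))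

        four : List (Fin k)
        four = a ∷ b ∷ a′ ∷ b′ ∷ []

        -- The generator inside {a, a′, c} cannot contain a without b, nor a′ without b′, so it is
        -- {c}.
        single : ∀ {c} → c ∉ₗ four → Single c
        single {c} c∉ with cov (a ∷ a′ ∷ c ∷ []) (distinct₃ (a′≢a ∘ sym) (λ { refl → c∉ (there (there (here refl))) }) (λ { refl → c∉ (here refl) })) refl
        ... | D , D∈ , (p , p∉) , sub = D , D∈ , subst (_∉ D) (only p∉) p∉ , only
          where
          a∈ : a ∈ D
          a∈ = needs (proj₁ ab) D∈ sub λ { (here eq) → proj₁ (proj₁ ab) (sym eq) ; (there (here eq)) → a′≢b (sym eq)
                                         ; (there (there (here eq))) → c∉ (there (here (sym eq))) }
          a′∈ : a′ ∈ D
          a′∈ = needs (proj₁ a′b′) D∈ sub λ { (here eq) → b′≢a eq ; (there (here eq)) → proj₁ (proj₁ a′b′) (sym eq)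
                                            ; (there (there (here eq))) → c∉ (there (there (there (here (sym eq))))) }
          only : ∀ {p} → p ∉ D → p ≡ c
          only p∉ with sub p∉
          ... | here refl                 = ⊥-elim (p∉ a∈)
          ... | there (here refl)         = ⊥-elim (p∉ a′∈)
          ... | there (there (here eq))   = eq

      -- The generator inside {a, b, a′} cannot contain a′ without b′; being nonempty and closed
      -- under twins, it is {a, b}.
      pair-member : ∀ {a b a′ b′} → Twin a b → Twin a′ b′ → a′ ≢ a → a′ ≢ b → b′ ≢ a → b′ ≢ b →
        ∃ λ D → D ∈ₗ J × a ∉ D × b ∉ D × (∀ {p} → p ∉ D → p ∈ₗ a ∷ b ∷ a′ ∷ [])
      pair-member {a} {b} {a′} {b′} ab a′b′ a′≢a a′≢b b′≢a b′≢b
        with cov (a ∷ b ∷ a′ ∷ []) (distinct₃ (proj₁ (proj₁ ab)) (a′≢b ∘ sym) (a′≢a ∘ sym)) refl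
      ... | D , D∈ , (p , p∉) , sub = D , D∈ , proj₁ both , proj₂ both , sub
        where
        open TwoClasses ab a′b′ a′≢a a′≢b b′≢a b′≢b using (needs)
        a′∈ : a′ ∈ D
        a′∈ = needs (proj₁ a′b′) D∈ sub λ { (here eq) → b′≢a eq ; (there (here eq)) → b′≢b eq
                                          ; (there (there (here eq))) → proj₁ (proj₁ a′b′) (sym eq) }
        both : a ∉ D × b ∉ D
        both with sub p∉
        ... | here refl               = p∉ , All.lookup (proj₂ (proj₁ ab)) D∈ p∉
        ... | there (here refl)       = All.lookup (proj₂ (proj₂ ab)) D∈ p∉ , p∉
        ... | there (there (here refl)) = ⊥-elim (p∉ a′∈)

      -- As k ≥ 5, there is a fifth position x, which is a twin c or implied by one. If c lies
      -- outside both pairs, {c} is a generator although c implies c′; if c is one of the four, the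
      -- generator formed by its pair omits x.
      one-class : ∀ {a b a′ b′} → Twin a b → Twin a′ b′ → a′ ≢ a → a′ ≢ b → b′ ≢ a → b′ ≢ b → ⊥
      one-class {a} {b} {a′} {b′} ab a′b′ a′≢a a′≢b b′≢a b′≢b with outside-of (a ∷ b ∷ a′ ∷ b′ ∷ []) ≤-refl
      ... | x , x∉ with twin-above x
      ... | c , c′ , cc′ , cx = final (c ∈ₗ? four)
        where
        open TwoClasses ab a′b′ a′≢a a′≢b b′≢a b′≢b
        no-needs-a : ∀ {y} → y ∈ₗ a ∷ b ∷ [] → ¬ (y ▷ x)
        no-needs-a y∈ (_ , h) with pair-member ab a′b′ a′≢a a′≢b b′≢a b′≢b
        ... | D , D∈ , a∉ , b∉ , sub = x∉ (∈-++⁺ˡ {xs = a ∷ b ∷ a′ ∷ []} (sub (All.lookup h D∈ (out y∈))))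
          where
          out : ∀ {y} → y ∈ₗ a ∷ b ∷ [] → y ∉ D
          out (here refl) = a∉
          out (there (here refl)) = b∉
        no-needs-a′ : ∀ {y} → y ∈ₗ a′ ∷ b′ ∷ [] → ¬ (y ▷ x)
        no-needs-a′ y∈ (_ , h) with pair-member a′b′ ab (a′≢a ∘ sym) (b′≢a ∘ sym) (a′≢b ∘ sym) (b′≢b ∘ sym)
        ... | D , D∈ , a′∉ , b′∉ , sub = x∉ (re (sub (All.lookup h D∈ (out y∈))))
          where
          out : ∀ {y} → y ∈ₗ a′ ∷ b′ ∷ [] → y ∉ D
          out (here refl) = a′∉
          out (there (here refl)) = b′∉
          re : x ∈ₗ a′ ∷ b′ ∷ a ∷ [] → x ∈ₗ four
          re (here eq) = there (there (here eq))
          re (there (here eq)) = there (there (there (here eq)))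
          re (there (there (here eq))) = here eq
        nonsingle : ∀ {y y′} → y ▷ y′ → y ∉ₗ four → ⊥
        nonsingle (ne , h) y∉ = let (D , D∈ , y∉D , only) = single y∉ in ne (sym (only (All.lookup h D∈ y∉D)))
        final : Dec (c ∈ₗ four) → ⊥
        final (no c∉) = nonsingle (proj₁ cc′) c∉
        final (yes c∈) = [ (λ { refl → x∉ c∈ }) , inside-four c∈ ]′ cx
          where
          inside-four : c ∈ₗ four → c ▷ x → ⊥
          inside-four (here eq)                         = no-needs-a (here eq)
          inside-four (there (here eq))                 = no-needs-a (there (here eq))
          inside-four (there (there (here eq)))         = no-needs-a′ (here eq)
          inside-four (there (there (there (here eq)))) = no-needs-a′ (there (here eq))

    -- A twin pair a, b whose generators contain everything leaves all other positions as generators.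
    pair-pattern : ∃ λ a → ∃ λ b → a ≢ b × (∀ c → c ≢ a → c ≢ b → Single c)
    pair-pattern with outside-of [] z≤n
    ... | z₀ , _ with twin-above z₀
    ... | a , b , tw@((a≢b , aB) , (_ , bA)) , _ with FinP.any? (λ z → ¬? (z FinP.≟ a) ×-dec ¬? (a ▷? z))
    ... | no all = a , b , a≢b , λ c ca cb → sing c ca cb
      where
      sing : ∀ c → c ≢ a → c ≢ b → Single c
      sing c ca cb with cov (a ∷ b ∷ c ∷ []) (distinct₃ a≢b (cb ∘ sym) (ca ∘ sym)) refl
      ... | D , D∈ , (p , p∉) , sub = D , D∈ , subst (_∉ D) (only p∉) p∉ , only
        where
        a∈ : a ∈ D
        a∈ = decidable-stable (a ∈? D) (λ a∉ →
          let (z , z∉) = outside-of (a ∷ b ∷ c ∷ []) (n≤1+n 3)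
              a▷z = decidable-stable (a ▷? z) (λ h → all (z , (λ eq → z∉ (here eq)) , h))
          in z∉ (sub (All.lookup (proj₂ a▷z) D∈ a∉)))
        b∈ : b ∈ D
        b∈ = decidable-stable (b ∈? D) (λ b∉ → All.lookup bA D∈ b∉ a∈)
        only : ∀ {p} → p ∉ D → p ≡ c
        only p∉ with sub p∉
        ... | here refl               = ⊥-elim (p∉ a∈)
        ... | there (here refl)       = ⊥-elim (p∉ b∈)
        ... | there (there (here eq)) = eq
    -- A position z not implied by a leads to a second twin pair, disjoint from the first, which
    -- `one-class` excludes.
    ... | yes (z , z≢a , ¬az) with twin-above z
    ... | a′ , b′ , tw′@(a′b′ , b′a′) , a′z = ⊥-elim (one-class tw tw′ a′≢a a′≢b b′≢a b′≢b)
      where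
      a′≢a : a′ ≢ a
      a′≢a refl = [ z≢a ∘ sym , ¬az ]′ a′z
      ¬aa′ : ¬ (a ▷ a′)
      ¬aa′ h = [ (λ { refl → ¬az h }) , (λ r → ¬az (▷-trans (z≢a ∘ sym) h r)) ]′ a′z
      a′≢b : a′ ≢ b
      a′≢b refl = ¬aa′ (proj₁ tw)
      b′≢a : b′ ≢ a
      b′≢a refl = ¬aa′ b′a′
      b′≢b : b′ ≢ b
      b′≢b refl = ¬aa′ (▷-trans (a′≢a ∘ sym) (proj₁ tw) b′a′)

-- Sets through a fixed pair

erase : ∀ {n} → Subset n → List (Fin n) → Subset n
erase e r = fromList (rest e r)

∈-erase⁺ : ∀ {n} {e : Subset n} {r z} → z ∈ e → z ∉ₗ r → z ∈ erase e r
∈-erase⁺ z∈ z∉ = ∈-fromList⁺ (∈-rest⁺ z∈ z∉)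

∈-erase⁻ : ∀ {n} (e : Subset n) r {z} → z ∈ erase e r → z ∈ e × z ∉ₗ r
∈-erase⁻ e r z∈ = ∈-rest⁻ e r (∈-fromList⁻ (rest e r) z∈)

∣erase∣ : ∀ {n} {e : Subset n} {r} → Unique r → All (_∈ e) r → length r + ∣ erase e r ∣ ≡ ∣ e ∣
∣erase∣ {e = e} {r} ur sub = trans (cong (length r +_) (∣fromList∣ (rest-unique e r))) (length-rest e ur sub)

module Pairs {n : ℕ} (S : Subset n) {a b : Fin n} (a≢b : a ≢ b) (a∉ : a ∉ S) (b∉ : b ∉ S) (m : ℕ) where

  pair? : ∀ e → Dec (¬ Meets e S × a ∈ e × b ∈ e)
  pair? e = ¬? (Meets? e S) ×-dec ((a ∈? e) ×-dec (b ∈? e))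

  through : List (Subset n)
  through = filter pair? (ksubsets n (2 + m))

  private
    ab : List (Fin n)
    ab = a ∷ b ∷ []

    uab : Unique ab
    uab = (a≢b ∷ []) ∷ [] ∷ []

    S′ : Subset n
    S′ = fromList (a ∷ b ∷ elems S)

    ∣S′∣ : ∣ S′ ∣ ≡ 2 + ∣ S ∣
    ∣S′∣ = trans (∣fromList∣ (Unique-∷ (λ { (here eq) → a≢b eq ; (there p) → a∉ (∈-elems⁻ p) }) (Unique-∷ (b∉ ∘ ∈-elems⁻) (elems-unique S))))
      (cong (2 +_) (length-elems S))

    avoid? : ∀ g → Dec (¬ Meets g S′)
    avoid? g = ¬? (Meets? g S′)

    avoiding = filter avoid? (ksubsets n m)

    avoiding-in : ∀ {g} → g ∈ₗ avoiding → ∣ g ∣ ≡ m × a ∉ g × b ∉ g × (∀ {x} → x ∈ g → x ∉ S)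
    avoiding-in {g} g∈ = let (p , ¬me) = ∈-filter⁻ avoid? {xs = ksubsets n m} g∈ in ∈-ksubsets⁻ m p ,
      (λ a∈ → ¬me (a , a∈ , ∈-fromList⁺ {w = a ∷ b ∷ elems S} (here refl))) ,
      (λ b∈ → ¬me (b , b∈ , ∈-fromList⁺ {w = a ∷ b ∷ elems S} (there (here refl)))) ,
      (λ {x} x∈ x∈S → ¬me (x , x∈ , ∈-fromList⁺ {w = a ∷ b ∷ elems S} (there (there (∈-elems⁺ x∈S)))))

    through-in : ∀ {e} → e ∈ₗ through → ∣ e ∣ ≡ 2 + m × ¬ Meets e S × a ∈ e × b ∈ e
    through-in e∈ = let (p , h) = ∈-filter⁻ pair? {xs = ksubsets n (2 + m)} e∈ in ∈-ksubsets⁻ (2 + m) p , h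

  -- Erasing a and b maps these sets bijectively to the m-sets avoiding S ∪ {a, b}.
  length-through : length through ≡ (n ∸ ∣ S ∣ ∸ 2) C m
  length-through = trans (≤-antisym to from) (trans (#-avoiding m S′) (cong (_C m) (trans (cong (n ∸_) (trans ∣S′∣ (+-comm 2 ∣ S ∣))) (sym (∸-+-assoc n ∣ S ∣ 2)))))
    where
    to : length through ≤ length avoiding
    to = inj-length _≟S_ (λ e → erase e ab) (UniqueP.filter⁺ pair? (ksubsets-unique n (2 + m)))
      (λ {e} e∈ → let (sz , ¬me , a∈ , b∈) = through-in e∈ in
        ∈-filter⁺ avoid? (∈-ksubsets⁺ m (suc-injective (suc-injective (trans (∣erase∣ {e = e} uab (a∈ ∷ b∈ ∷ [])) sz))))
          (λ (x , x∈ , x∈S′) → let (x∈e , x∉) = ∈-erase⁻ e ab x∈ in case ∈-fromList⁻ (a ∷ b ∷ elems S) x∈S′ of λ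
            { (here eq) → x∉ (here eq) ; (there (here eq)) → x∉ (there (here eq)) ; (there (there p)) → ¬me (x , x∈e , ∈-elems⁻ p) }))
      (λ {e} {e′} e∈ e′∈ eq → let (_ , _ , a∈ , b∈) = through-in e∈ ; (_ , _ , a∈′ , b∈′) = through-in e′∈ in
        ⊆-antisym (inc e e′ eq a∈′ b∈′) (inc e′ e (sym eq) a∈ b∈))
      where
      inc : ∀ e e′ → erase e ab ≡ erase e′ ab → a ∈ e′ → b ∈ e′ → ∀ {x} → x ∈ e → x ∈ e′
      inc e e′ eq a∈ b∈ {x} x∈ with x ∈ₗ? ab
      ... | yes (here refl) = a∈
      ... | yes (there (here refl)) = b∈
      ... | no x∉ = proj₁ (∈-erase⁻ e′ ab (subst (x ∈_) eq (∈-erase⁺ x∈ x∉)))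
    from : length avoiding ≤ length through
    from = inj-length _≟S_ (λ g → fromList (a ∷ b ∷ elems g)) (UniqueP.filter⁺ avoid? (ksubsets-unique n m))
      (λ {g} g∈ → let (sz , a∉g , b∉g , off) = avoiding-in g∈ in
        ∈-filter⁺ pair? (∈-ksubsets⁺ (2 + m) (trans (∣fromList∣ (Unique-∷ (λ { (here eq) → a≢b eq ; (there p) → a∉g (∈-elems⁻ p) }) (Unique-∷ (b∉g ∘ ∈-elems⁻) (elems-unique g))))
            (cong (2 +_) (trans (length-elems g) sz))))
          ((λ (x , x∈ , x∈S) → case ∈-fromList⁻ (a ∷ b ∷ elems g) x∈ of λ
             { (here refl) → a∉ x∈S ; (there (here refl)) → b∉ x∈S ; (there (there p)) → off (∈-elems⁻ p) x∈S }) ,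
           ∈-fromList⁺ {w = a ∷ b ∷ elems g} (here refl) , ∈-fromList⁺ {w = a ∷ b ∷ elems g} (there (here refl))))
      (λ {g} {g′} g∈ g′∈ eq → ⊆-antisym (inc g g′ (avoiding-in g∈) eq) (inc g′ g (avoiding-in g′∈) (sym eq)))
      where
      inc : ∀ g g′ → ∣ g ∣ ≡ m × a ∉ g × b ∉ g × (∀ {x} → x ∈ g → x ∉ S) → fromList (a ∷ b ∷ elems g) ≡ fromList (a ∷ b ∷ elems g′) → ∀ {x} → x ∈ g → x ∈ g′
      inc g g′ (_ , a∉g , b∉g , _) eq {x} x∈ with ∈-fromList⁻ (a ∷ b ∷ elems g′) (subst (x ∈_) eq (∈-fromList⁺ {w = a ∷ b ∷ elems g} (there (there (∈-elems⁺ x∈)))))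
      ... | here refl = ⊥-elim (a∉g x∈)
      ... | there (here refl) = ⊥-elim (b∉g x∈)
      ... | there (there p) = ∈-elems⁻ p

-- Frankl's theorem for large families

abstract
  unpairedC : ℕ → ℕ
  unpairedC j = homC (5 + j) (5 + j) (length (subsets (5 + j)))

  unpairedC-def : ∀ j → unpairedC j ≡ homC (5 + j) (5 + j) (length (subsets (5 + j)))
  unpairedC-def j = refl

  -- In units of n^(k - 3): (k - 2)² for words with repetitions, and (k - 2)^(k - 2) words for each
  -- uncalled set; of these sets 2 + t come from a binomial difference and the rest from unpaired
  -- edges.
  pairC : ℕ → ℕ → ℕ
  pairC j t = (3 + j) * (3 + j) + (3 + j) ^ (3 + j) * (2 + t + unpairedC j)

  pairC-def : ∀ j t → (3 + j) * (3 + j) + (3 + j) ^ (3 + j) * (2 + t + unpairedC j) ≡ pairC j t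
  pairC-def j t = refl

module Frankl {j n : ℕ} (d : Fin n) (L : List (Subset n)) (uL : Unique L) (size : ∀ {e} → e ∈ₗ L → ∣ e ∣ ≡ 5 + j)
  (T : List (Fin n)) (uT : Unique T) (avoid : ∀ {e} → e ∈ₗ L → ∀ {x} → x ∈ e → x ∉ₗ T)
  (noSingleton : ∀ {e e′ w} → e ∈ₗ L → e′ ∈ₗ L → w ∈ e → w ∈ e′ → (∀ {z} → z ∈ e → z ∈ e′ → z ≡ w) → ⊥) where

  private
    k = 5 + j
    V = Fin n
    K = Ker L k

  open OrderedFamily {k} d k

  -- An edge through `D` that avoids the rest of e would meet e in x alone. Only the k vertices of e
  -- have to be avoided, so kernels are taken with q = k here.
  kernel-meets : ∀ {D e x} → K D → e ∈ₗ L → x ∈ₗ D → x ∈ e → (∀ {z} → z ∈ₗ D → z ∈ e → z ≡ x) → ⊥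
  kernel-meets {D} {e} {x} ker e∈ x∈D x∈e only =
    let (e′ , e′∈ , De′ , av) = ker (elems e) (≤-reflexive (trans (length-elems e) (size e∈)))
    in noSingleton e∈ e′∈ x∈e (All.lookup De′ x∈D) (λ z∈ z∈′ → only (av (∈-elems⁺ z∈) z∈′) z∈)

  Exchange : Subset n → V → Set
  Exchange e z = Any (λ e′ → (∀ x → x ∈ e → x ≢ z → x ∈ e′) × z ∉ e′) L

  -- The pattern of all position sets containing a fixed pair, expressed by vertices. The exchanges
  -- record that omitting a single other position still gives a kernel.
  Paired : Subset n → V → V → Set
  Paired e a b = a ≢ b × a ∈ e × b ∈ e × (∀ y → y ∈ e → K (a ∷ b ∷ y ∷ [])) ×
    (∀ z → z ∈ e → z ≢ a → z ≢ b → Exchange e z)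

  abstract
    paired? : ∀ e → Dec (∃ λ a → ∃ λ b → Paired e a b)
    paired? e = FinP.any? (λ a → FinP.any? (λ b → ¬? (a FinP.≟ b) ×-dec ((a ∈? e) ×-dec ((b ∈? e) ×-dec
      (FinP.all? (λ y → (y ∈? e) →-dec Ker? L k (a ∷ b ∷ y ∷ [])) ×-dec
       FinP.all? (λ z → (z ∈? e) →-dec (¬? (z FinP.≟ a) →-dec (¬? (z FinP.≟ b) →-dec
         any? (λ e′ → FinP.all? (λ x → (x ∈? e) →-dec (¬? (x FinP.≟ z) →-dec (x ∈? e′))) ×-dec ¬? (z ∈? e′)) L))))))))

  unpaired : List (Subset n)
  unpaired = filter (¬? ∘ paired?) L

  C₃ : ℕ
  C₃ = unpairedC j

  #-unpaired : length unpaired ≤ C₃ * n ^ (2 + j)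
  #-unpaired = subst (λ c → length unpaired ≤ c * n ^ (2 + j)) (sym (unpairedC-def j)) (decidable-stable (_ ≤? _) λ ¬h →
    let (F , J , (e₀ , e₀∈) , F⊆ , kerJ , cov) = cohomogeneous 3 unpaired (UniqueP.filter⁺ (¬? ∘ paired?) uL)
          (λ p r → ord-ext (size (in-L p)) (size (in-L r))) (≰⇒> ¬h)
    in absurd F J e₀ e₀∈ F⊆ kerJ cov)
    where
    in-L : ∀ {e} → e ∈ₗ unpaired → e ∈ₗ L
    in-L p = proj₁ (∈-filter⁻ (¬? ∘ paired?) {xs = L} p)
    absurd : ∀ F J e₀ → e₀ ∈ₗ F → (∀ {e} → e ∈ₗ F → e ∈ₗ unpaired) → (∀ {D} → D ∈ₗ J → KerIn F D) →
      (∀ ws → Unique ws → length ws ≡ 3 → ∃ λ D → D ∈ₗ J × Proper D × (∀ {p} → p ∉ D → p ∈ₗ ws)) → ⊥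
    absurd F J e₀ e₀∈ F⊆ kerJ cov = proj₂ (∈-filter⁻ (¬? ∘ paired?) {xs = L} (F⊆ e₀∈)) (found pair-pattern′)
      where
      open Twins (s≤s (s≤s (s≤s (s≤s (s≤s z≤n))))) J cov
      F⊆L : ∀ {e} → e ∈ₗ F → e ∈ₗ L
      F⊆L = in-L ∘ F⊆
      pred : ∀ r → ∃ λ a → a ▷ r
      pred r with FinP.any? (_▷? r)
      ... | yes h = h
      -- If no position implies r, every p ≠ r is omitted by a kernel containing r. Then {r} is a
      -- kernel, and two edges meet in one vertex.
      ... | no ¬h = ⊥-elim (single-kernel ker)
        where
        ker : KerIn F (fromList (r ∷ []))
        ker = KerIn-cover (fromList (r ∷ [])) λ p p∉ →
          let p≢r = λ eq → p∉ (∈-fromList⁺ {w = r ∷ []} (here eq))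
              (D , D∈ , h) = find (AllP.¬All⇒Any¬ (λ D → ¬? (p ∈? D) →-dec ¬? (r ∈? D)) J (λ all → ¬h (p , p≢r , all)))
              p∉D = λ p∈ → h (λ p∉D → ⊥-elim (p∉D p∈))
              r∈D = decidable-stable (r ∈? D) (λ r∉ → h (λ _ → r∉))
          in D , (λ x∈ → case ∈-fromList⁻ (r ∷ []) x∈ of λ { (here refl) → r∈D }) , p∉D , kerJ D∈
        single-kernel : KerIn F (fromList (r ∷ [])) → ⊥
        single-kernel ker = kernel-meets (KerIn⇒Ker F⊆L size (r ∷ []) ker e₀∈) (F⊆L e₀∈) (here refl) (ord-∈ (size (F⊆L e₀∈)) r)
          (λ { (here eq) _ → eq })
      pair-pattern′ = pair-pattern pred
      found : (∃ λ a → ∃ λ b → a ≢ b × (∀ c → c ≢ a → c ≢ b → Single c)) → ∃ λ a → ∃ λ b → Paired e₀ a b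
      found (a , b , a≢b , single) = ord e₀ a , ord e₀ b , a≢b ∘ ord-inj {e₀} sz , ord-∈ sz a , ord-∈ sz b , ker , exch
        where
        sz = size (F⊆L e₀∈)
        ker : ∀ y → y ∈ e₀ → K (ord e₀ a ∷ ord e₀ b ∷ y ∷ [])
        ker y y∈ with ord-onto sz y∈
        ... | p , refl = KerIn⇒Ker F⊆L size (a ∷ b ∷ p ∷ []) (KerIn-cover _ (λ r r∉ →
              let (D , D∈ , r∉D , only) = single r (λ eq → r∉ (∈-fromList⁺ {w = a ∷ b ∷ p ∷ []} (here eq))) (λ eq → r∉ (∈-fromList⁺ {w = a ∷ b ∷ p ∷ []} (there (here eq))))
              in D , (λ {x} x∈ → decidable-stable (x ∈? D) (λ x∉ → r∉ (subst (_∈ fromList (a ∷ b ∷ p ∷ [])) (only x∉) x∈))) , r∉D , kerJ D∈)) e₀∈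
        exch : ∀ z → z ∈ e₀ → z ≢ ord e₀ a → z ≢ ord e₀ b → Exchange e₀ z
        exch z z∈ za zb with ord-onto sz z∈
        ... | p , refl with single p (λ { refl → za refl }) (λ { refl → zb refl })
        ... | D , D∈ , p∉ , only with kerJ D∈ e₀∈ (ord e₀ p ∷ []) (s≤s z≤n)
        ... | e′ , e′∈ , ag , av = lose (F⊆L e′∈) (keep , gone)
          where
          keep : ∀ x → x ∈ e₀ → x ≢ ord e₀ p → x ∈ e′
          keep x x∈ x≢ with ord-onto sz x∈
          ... | r , refl = subst (_∈ e′) (sym (ag r (decidable-stable (r ∈? D) (λ r∉ → x≢ (cong (ord e₀) (only r∉)))))) (ord-∈ (size (F⊆L e′∈)) r)
          gone : ord e₀ p ∉ e′
          gone h with ord-onto (size (F⊆L e′∈)) h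
          ... | r , eq with r ∈? D
          ... | yes r∈ = p∉ (subst (_∈ D) (ord-inj {e₀} sz (trans (ag r r∈) eq)) r∈)
          ... | no r∉ = av r r∉ (here eq)

  paired : List (Subset n)
  paired = filter paired? L

  paired-in : ∀ {e} → e ∈ₗ paired → e ∈ₗ L × ∃ λ a → ∃ λ b → Paired e a b
  paired-in = ∈-filter⁻ paired? {xs = L}

  -- Otherwise a kernel meets an edge in one vertex. If e misses a′ and b′, the kernel is {a′, b′,
  -- y}; if it contains just one of them, it is {a′, b′}, obtained with a′ as third vertex; if it
  -- contains both and one is outside the pair of e, that one is exchanged away first.
  same-pair : ∀ {e e′ a b a′ b′ y} → e ∈ₗ L → e′ ∈ₗ L → Paired e a b → Paired e′ a′ b′ → y ∈ e → y ∈ e′ →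
    a′ ∈ₗ a ∷ b ∷ [] × b′ ∈ₗ a ∷ b ∷ []
  same-pair {e} {e′} {a} {b} {a′} {b′} {y} e∈ e′∈ (_ , _ , _ , _ , exch) (a′≢b′ , a′∈ , b′∈ , ker′ , _) y∈ y∈′ with a′ ∈? e | b′ ∈? e
  ... | yes a∈e | yes b∈e = decidable-stable (a′ ∈ₗ? (a ∷ b ∷ [])) (λ h → swap₁ (exch a′ a∈e (λ eq → h (here eq)) (λ eq → h (there (here eq))))) ,
                            decidable-stable (b′ ∈ₗ? (a ∷ b ∷ [])) (λ h → swap₂ (exch b′ b∈e (λ eq → h (here eq)) (λ eq → h (there (here eq)))))
    where
    swap₁ : Exchange e a′ → ⊥
    swap₁ h = let (e″ , e″∈ , keep , gone) = find h in kernel-meets (ker′ a′ a′∈) e″∈ (there (here refl)) (keep b′ b∈e (a′≢b′ ∘ sym))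
      (λ { (here refl) p → ⊥-elim (gone p) ; (there (here eq)) _ → eq ; (there (there (here refl))) p → ⊥-elim (gone p) })
    swap₂ : Exchange e b′ → ⊥
    swap₂ h = let (e″ , e″∈ , keep , gone) = find h in kernel-meets (ker′ a′ a′∈) e″∈ (here refl) (keep a′ a∈e a′≢b′)
      (λ { (here eq) _ → eq ; (there (here refl)) p → ⊥-elim (gone p) ; (there (there (here eq))) _ → eq })
  ... | yes a∈e | no b∉e = ⊥-elim (kernel-meets (ker′ a′ a′∈) e∈ (here refl) a∈e
          (λ { (here eq) _ → eq ; (there (here refl)) p → ⊥-elim (b∉e p) ; (there (there (here eq))) _ → eq }))
  ... | no a∉e | yes b∈e = ⊥-elim (kernel-meets (ker′ a′ a′∈) e∈ (there (here refl)) b∈e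
          (λ { (here refl) p → ⊥-elim (a∉e p) ; (there (here eq)) _ → eq ; (there (there (here refl))) p → ⊥-elim (a∉e p) }))
  ... | no a∉e | no b∉e = ⊥-elim (kernel-meets (ker′ y y∈′) e∈ (there (there (here refl))) y∈
          (λ { (here refl) p → ⊥-elim (a∉e p) ; (there (here refl)) p → ⊥-elim (b∉e p) ; (there (there (here eq))) _ → eq }))

  Called : Subset n → Set
  Called g = Any (λ e → g ⊆ₛ e × ∃ λ a → ∃ λ b → Paired e a b) L

  called? : ∀ g → Dec (Called g)
  called? g = any? (λ e → (g ⊆? e) ×-dec paired? e) L

  private
    gs = ksubsets n (3 + j)

    base : Subset n → Subset n
    base e with paired? e
    ... | yes (a , b , _) = erase e (a ∷ b ∷ [])
    ... | no _            = e

    base-spec : ∀ {e} → e ∈ₗ paired → ∃ λ a → ∃ λ b → Paired e a b × base e ≡ erase e (a ∷ b ∷ [])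
    base-spec {e} e∈ with paired? e | proj₂ (paired-in e∈)
    ... | yes (a , b , h) | _ = a , b , h , refl
    ... | no ¬h           | h = ⊥-elim (¬h h)

    base-size : ∀ {e a b} → e ∈ₗ L → Paired e a b → ∣ erase e (a ∷ b ∷ []) ∣ ≡ 3 + j
    base-size {e} e∈ (ab , a∈ , b∈ , _) = suc-injective (suc-injective (trans (∣erase∣ {e = e} ((ab ∷ []) ∷ [] ∷ []) (a∈ ∷ b∈ ∷ [])) (size e∈)))

    -- Equal bases are nonempty, so the edges share a vertex and by `same-pair` also the erased
    -- pair.
    base-inj : ∀ {e e′} → e ∈ₗ paired → e′ ∈ₗ paired → base e ≡ base e′ → e ≡ e′
    base-inj {e} {e′} e∈ e′∈ eq with base-spec e∈ | base-spec e′∈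
    ... | a , b , h , eqb | a′ , b′ , h′ , eqb′ = ⊆∧∣∣⇒≡ inc (≤-reflexive (trans (size e′∈L) (sym (size e∈L))))
      where
      e∈L = proj₁ (paired-in e∈)
      e′∈L = proj₁ (paired-in e′∈)
      eq′ : erase e (a ∷ b ∷ []) ≡ erase e′ (a′ ∷ b′ ∷ [])
      eq′ = trans (sym eqb) (trans eq eqb′)
      common : ∃ λ y → y ∈ erase e (a ∷ b ∷ []) × y ∉ₗ []
      common = extra {r = []} {erase e (a ∷ b ∷ [])} (subst (1 ≤_) (sym (base-size e∈L h)) (s≤s z≤n))
      y = proj₁ common
      y∈e : y ∈ e
      y∈e = proj₁ (∈-erase⁻ e (a ∷ b ∷ []) (proj₁ (proj₂ common)))
      y∈e′ : y ∈ e′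
      y∈e′ = proj₁ (∈-erase⁻ e′ (a′ ∷ b′ ∷ []) (subst (y ∈_) eq′ (proj₁ (proj₂ common))))
      pairs = same-pair e′∈L e∈L h′ h y∈e′ y∈e
      in-e′ : ∀ {x} → x ∈ₗ a′ ∷ b′ ∷ [] → x ∈ e′
      in-e′ (here refl) = proj₁ (proj₂ h′)
      in-e′ (there (here refl)) = proj₁ (proj₂ (proj₂ h′))
      inc : ∀ {x} → x ∈ e → x ∈ e′
      inc {x} x∈ with x ∈ₗ? (a ∷ b ∷ [])
      ... | yes (here refl) = in-e′ (proj₁ pairs)
      ... | yes (there (here refl)) = in-e′ (proj₂ pairs)
      ... | no x∉ = proj₁ (∈-erase⁻ e′ (a′ ∷ b′ ∷ []) (subst (x ∈_) eq′ (∈-erase⁺ x∈ x∉)))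

  paired-≤ : length paired ≤ # called? gs
  paired-≤ = inj-length _≟S_ base (UniqueP.filter⁺ paired? uL)
    (λ {e} e∈ → let (a , b , h , eq) = base-spec e∈ ; e∈L = proj₁ (paired-in e∈) in
      subst (_∈ₗ filter called? gs) (sym eq) (∈-filter⁺ called? (∈-ksubsets⁺ (3 + j) (base-size e∈L h))
        (lose e∈L ((λ x∈ → proj₁ (∈-erase⁻ e (a ∷ b ∷ []) x∈)) , a , b , h))))
    base-inj

  t κ₃ C₇ : ℕ
  t  = length T
  κ₃ = (3 + j) ^ (3 + j)
  C₇ = pairC j t

  N₂ : ℕ
  N₂ = (n ∸ t ∸ 2) C (3 + j)

  module Common (hL : N₂ ≤ length L) (h2t : 2 + t ≤ n) (hn₁ : 2 * ((2 + j) * (3 + (k + t) + (2 + j))) ≤ n) (hn₂ : C₇ < n)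
    (hn₃ : 2 * (C₇ ^ k * k ^ (2 + j)) < n) where

    private
      N = n ^ (2 + j)
    1≤n : 1 ≤ n
    1≤n = ≤-trans (s≤s z≤n) hn₂
    uncalled = # (¬? ∘ called?) gs

    -- Paired edges inject into called sets, and by `hL` the family has C(n, k - 2) members up to
    -- lower order, so only O(n^(k - 3)) of the (k - 2)-sets are uncalled.
    uncalled-≤ : uncalled ≤ (2 + t + C₃) * N
    uncalled-≤ = +-cancelˡ-≤ (# called? gs) _ _ (begin
      # called? gs + uncalled                   ≡⟨ trans (sym (#-¬ called? gs)) (length-ksubsets n (3 + j)) ⟩
      n C (3 + j)                               ≡⟨ cong (_C (3 + j)) (m+[n∸m]≡n h2t) ⟨
      (2 + t + (n ∸ (2 + t))) C (3 + j)         ≤⟨ C-upper (2 + t) (n ∸ (2 + t)) (2 + j) ⟩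
      (n ∸ (2 + t)) C (3 + j) + (2 + t) * (2 + t + (n ∸ (2 + t))) ^ (2 + j)
        ≡⟨ cong₂ (λ x y → x C (3 + j) + (2 + t) * y ^ (2 + j)) (trans (cong (n ∸_) (+-comm 2 t)) (sym (∸-+-assoc n t 2))) (m+[n∸m]≡n h2t) ⟩
      N₂ + (2 + t) * N                          ≤⟨ +-monoˡ-≤ ((2 + t) * N) hL ⟩
      length L + (2 + t) * N                    ≡⟨ cong (_+ (2 + t) * N) (#-¬ paired? L) ⟩
      length paired + length unpaired + (2 + t) * N  ≤⟨ +-monoˡ-≤ ((2 + t) * N) (+-mono-≤ paired-≤ #-unpaired) ⟩
      # called? gs + C₃ * N + (2 + t) * N       ≡⟨ arith (# called? gs) C₃ N (2 + t) ⟩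
      # called? gs + (2 + t + C₃) * N           ∎)
      where
      open ≤-Reasoning
      arith : ∀ x c N s → x + c * N + s * N ≡ x + (s + c) * N
      arith = solve-∀

    Hit : List V → Set
    Hit w = Fresh [] w × Called (fromList w)

    hit? : ∀ w → Dec (Hit w)
    hit? w = fresh? [] w ×-dec called? (fromList w)

    tups : List (List V)
    tups = vtuples (3 + j)

    U = # (¬? ∘ hit?) tups
    nonfresh = # (λ w → ¬? (fresh? [] w)) tups

    nonfresh-≤ : nonfresh ≤ (3 + j) * (3 + j) * N
    nonfresh-≤ = cancelˡ n 1≤n (≤-trans (#-nonfresh {n} [] (3 + j)) (≤-reflexive (arith ((3 + j) * (3 + j)) n N)))
      where
      arith : ∀ c n N → c * (n * N) ≡ n * (c * N)
      arith = solve-∀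

    U-≤ : U ≤ C₇ * N
    U-≤ = begin
      U                                                    ≤⟨ #-∪ _ (λ w → ¬? (fresh? [] w)) P? tups split ⟩
      nonfresh + # P? tups                                 ≤⟨ +-mono-≤ nonfresh-≤ (#-tuples-within P? (3 + j) (3 + j) (filter (¬? ∘ called?) gs)
          (λ f∈ → ≤-reflexive (∈-ksubsets⁻ (3 + j) (proj₁ (∈-filter⁻ (¬? ∘ called?) {xs = gs} f∈))))
          (λ {w} w∈ (fr , nc) → fromList w , ∈-filter⁺ (¬? ∘ called?) (∈-ksubsets⁺ (3 + j) (trans (∣fromList∣ (fresh⇒unique w fr)) (tuples-length {xs = allFin n} (3 + j) w∈))) nc ,
            All.tabulate ∈-fromList⁺)) ⟩
      (3 + j) * (3 + j) * N + uncalled * κ₃                ≤⟨ +-monoʳ-≤ ((3 + j) * (3 + j) * N) (*-monoˡ-≤ κ₃ uncalled-≤) ⟩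
      (3 + j) * (3 + j) * N + (2 + t + C₃) * N * κ₃        ≡⟨ trans (arith ((3 + j) * (3 + j)) N (2 + t + C₃) κ₃) (cong (_* N) (pairC-def j t)) ⟩
      C₇ * N                                               ∎
      where
      open ≤-Reasoning
      arith : ∀ a N b c → a * N + b * N * c ≡ (a + c * b) * N
      arith = solve-∀
      P? : ∀ w → Dec (Fresh [] w × ¬ Called (fromList w))
      P? w = fresh? [] w ×-dec ¬? (called? (fromList w))
      split : ∀ {w} → w ∈ₗ tups → ¬ Hit w → ¬ Fresh [] w ⊎ (Fresh [] w × ¬ Called (fromList w))
      split {w} _ h with fresh? [] w
      ... | no ¬f = inj₁ ¬f
      ... | yes f = inj₂ (f , λ c → h (f , c))

    U₁ : V → ℕ
    U₁ y = # (λ w → ¬? (hit? (y ∷ w))) (vtuples (2 + j))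

    anchor : ∃ λ y → U₁ y ≤ C₇ * n ^ (1 + j)
    anchor = let (y , _ , h) = average-∈ U₁ (allFin n) (∈-allFin d) in y , cancelˡ n 1≤n (begin
      n * U₁ y                     ≤⟨ subst₂ (λ i u → i * U₁ y ≤ u) (length-allFin n) (sym (#-cpw _ _∷_ (allFin n) (vtuples (2 + j)))) h ⟩
      U                            ≤⟨ U-≤ ⟩
      C₇ * (n * n ^ (1 + j))       ≡⟨ arith C₇ n (n ^ (1 + j)) ⟩
      n * (C₇ * n ^ (1 + j))       ∎)
      where
      open ≤-Reasoning
      arith : ∀ c n x → c * (n * x) ≡ n * (c * x)
      arith = solve-∀

    module _ (y : V) (hU : U₁ y ≤ C₇ * n ^ (1 + j)) where

      start : ∃ λ e → e ∈ₗ L × y ∈ e × ∃ λ a → ∃ λ b → Paired e a b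
      start with any? (λ w → hit? (y ∷ w)) (vtuples (2 + j))
      ... | yes p = let (w , _ , _ , c) = find p ; (e , e∈ , sub , h) = find c in e , e∈ , sub (∈-fromList⁺ {w = y ∷ w} (here refl)) , h
      ... | no ¬p = ⊥-elim (<⇒≱ hn₂ (cancelˡ (n ^ (1 + j)) (^-positive (1 + j) 1≤n) (≤-trans (≤-reflexive (*-comm (n ^ (1 + j)) n))
            (≤-trans (≤-reflexive (sym (length-vtuples {n} (2 + j)))) (≤-trans (#-all (λ w → ¬? (hit? (y ∷ w))) (vtuples (2 + j)) (λ w∈ h → ¬p (lose w∈ h)))
              (≤-trans hU (≤-reflexive (*-comm C₇ _))))))))

      module _ (e₀ : Subset n) (e₀∈ : e₀ ∈ₗ L) (y∈ : y ∈ e₀) (a b : V) (h₀ : Paired e₀ a b) where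

        a≢b = proj₁ h₀

        a∉T : a ∉ₗ T
        a∉T = avoid e₀∈ (proj₁ (proj₂ h₀))

        b∉T : b ∉ₗ T
        b∉T = avoid e₀∈ (proj₁ (proj₂ (proj₂ h₀)))

        off? : ∀ z → Dec (¬ K (a ∷ b ∷ z ∷ []))
        off? z = ¬? (Ker? L k (a ∷ b ∷ z ∷ []))

        offs : List V
        offs = filter off? (allFin n)

        -- A paired edge through y and z shares y with e₀, hence has the pair {a, b}, and {a, b, z}
        -- would be a kernel.
        spare : ∀ {z} → ¬ K (a ∷ b ∷ z ∷ []) → ∀ {w} → w ∈ₗ vtuples (1 + j) → ¬ Hit (y ∷ z ∷ w)
        spare {z} ¬ker {w} _ (fr , c) =
          let (e , e∈ , sub , a′ , b′ , h) = find c
              (p , p′) = same-pair e∈ e₀∈ h h₀ (sub (∈-fromList⁺ {w = y ∷ z ∷ w} (here refl))) y∈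
              (r , r′) = same-pair e₀∈ e∈ h₀ h y∈ (sub (∈-fromList⁺ {w = y ∷ z ∷ w} (here refl)))
              ker = proj₁ (proj₂ (proj₂ (proj₂ h))) z (sub (∈-fromList⁺ {w = y ∷ z ∷ w} (there (here refl))))
          in ¬ker (Ker-cong (ext r r′) (ext p p′) ker)
          where
          ext : ∀ {a b a′ b′ : V} → a′ ∈ₗ a ∷ b ∷ [] → b′ ∈ₗ a ∷ b ∷ [] → ∀ {x} → x ∈ₗ a′ ∷ b′ ∷ z ∷ [] → x ∈ₗ a ∷ b ∷ z ∷ []
          ext p p′ (here refl) = ∈-++⁺ˡ p
          ext p p′ (there (here refl)) = ∈-++⁺ˡ p′
          ext p p′ (there (there (here refl))) = there (there (here refl))

        -- Each such z spoils n^(k - 4) completions of y, of which only O(n^(k - 4)) are spoilt in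
        -- all; the bound is therefore independent of n.
        offs-≤ : length offs ≤ C₇
        offs-≤ = cancelˡ (n ^ (1 + j)) (^-positive (1 + j) 1≤n) (begin
          n ^ (1 + j) * length offs       ≡⟨ *-comm (n ^ (1 + j)) (length offs) ⟩
          length offs * n ^ (1 + j)       ≤⟨ ∑-≥-filter {f = f} off? (n ^ (1 + j)) (allFin n) (λ {z} bad →
                                               ≤-trans (≤-reflexive (sym (length-vtuples {n} (1 + j)))) (#-all _ (vtuples (1 + j)) (spare bad))) ⟩
          ∑ f (allFin n)                  ≡⟨ #-cpw (λ w → ¬? (hit? (y ∷ w))) _∷_ (allFin n) (vtuples (1 + j)) ⟨
          U₁ y                            ≤⟨ hU ⟩
          C₇ * n ^ (1 + j)                ≡⟨ *-comm C₇ _ ⟩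
          n ^ (1 + j) * C₇                ∎)
          where
          open ≤-Reasoning
          f = λ z → # (λ w → ¬? (hit? (y ∷ z ∷ w))) (vtuples (1 + j))

        ker-ab : ∀ {z} → z ∈ₗ a ∷ b ∷ [] → K (a ∷ b ∷ z ∷ [])
        ker-ab (here refl) = proj₁ (proj₂ (proj₂ (proj₂ h₀))) a (proj₁ (proj₂ h₀))
        ker-ab (there (here refl)) = proj₁ (proj₂ (proj₂ (proj₂ h₀))) b (proj₁ (proj₂ (proj₂ h₀)))

        both? : ∀ e → Dec (a ∈ e × b ∈ e)
        both? e = (a ∈? e) ×-dec (b ∈? e)

        -- If {a, b, z} were a kernel for some z in e, then e would meet either it or the kernel {a,
        -- b} in exactly one vertex.
        stray : ∀ {e} → e ∈ₗ L → ¬ (a ∈ e × b ∈ e) → ∀ {z} → z ∈ e → z ∈ₗ offs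
        stray {e} e∈ ¬ab {z} z∈ = ∈-filter⁺ off? (∈-allFin z) (λ ker → bad ker (a ∈? e) (b ∈? e))
          where
          bad : K (a ∷ b ∷ z ∷ []) → Dec (a ∈ e) → Dec (b ∈ e) → ⊥
          bad ker (yes a∈) (yes b∈) = ¬ab (a∈ , b∈)
          bad ker (yes a∈) (no b∉)  = kernel-meets (ker-ab (here refl)) e∈ (here refl) a∈
            (λ { (here eq) _ → eq ; (there (here refl)) p → ⊥-elim (b∉ p) ; (there (there (here eq))) _ → eq })
          bad ker (no a∉)  (yes b∈) = kernel-meets (ker-ab (there (here refl))) e∈ (there (here refl)) b∈
            (λ { (here refl) p → ⊥-elim (a∉ p) ; (there (here eq)) _ → eq ; (there (there (here eq))) _ → eq })
          bad ker (no a∉)  (no b∉)  = kernel-meets ker e∈ (there (there (here refl))) z∈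
            (λ { (here refl) p → ⊥-elim (a∉ p) ; (there (here refl)) p → ⊥-elim (b∉ p) ; (there (there (here eq))) _ → eq })

        S : Subset n
        S = fromList T

        ∣S∣ : ∣ S ∣ ≡ t
        ∣S∣ = ∣fromList∣ uT

        open Pairs S a≢b (a∉T ∘ ∈-fromList⁻ T) (b∉T ∘ ∈-fromList⁻ T) (3 + j)

        absent : List (Subset n)
        absent = filter (λ e → ¬? (e ∈E? L)) through

        -- `L` is at least as large as the family of all sets through the pair, so absent sets must
        -- be balanced by stray edges, which live on the boundedly many vertices of `offs`.
        absent-≤ : length absent ≤ C₇ ^ k
        absent-≤ = +-cancelˡ-≤ N₂ _ _ (begin
          N₂ + length absent                                                 ≤⟨ +-monoˡ-≤ (length absent) hL ⟩
          length L + length absent                                           ≡⟨ cong (_+ length absent) (#-¬ both? L) ⟩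
          # both? L + # (¬? ∘ both?) L + length absent                       ≤⟨ +-monoˡ-≤ (length absent) (+-mono-≤ inL strays) ⟩
          # (_∈E? L) through + C₇ ^ k + length absent                        ≡⟨ arith (# (_∈E? L) through) (C₇ ^ k) (length absent) ⟩
          # (_∈E? L) through + length absent + C₇ ^ k                        ≡⟨ cong (_+ C₇ ^ k) (trans (sym (#-¬ (_∈E? L) through)) (trans length-through (cong (λ i → (n ∸ i ∸ 2) C (3 + j)) ∣S∣))) ⟩
          N₂ + C₇ ^ k                                                        ∎)
          where
          open ≤-Reasoning
          arith : ∀ a b c → a + b + c ≡ a + c + b
          arith = solve-∀
          inL : # both? L ≤ # (_∈E? L) through
          inL = unique-⊆-length _≟S_ (UniqueP.filter⁺ both? uL) (λ e∈ → let (e∈L , ab) = ∈-filter⁻ both? {xs = L} e∈ in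
            ∈-filter⁺ (_∈E? L) (∈-filter⁺ pair? (∈-ksubsets⁺ k (size e∈L)) ((λ (x , x∈ , x∈S) → avoid e∈L x∈ (∈-fromList⁻ T x∈S)) , ab)) e∈L)
          strays : # (¬? ∘ both?) L ≤ C₇ ^ k
          strays = ≤-trans (inj-length (ListP.≡-dec FinP._≟_) elems (UniqueP.filter⁺ (¬? ∘ both?) uL)
              (λ {e} e∈ → let (e∈L , ¬ab) = ∈-filter⁻ (¬? ∘ both?) {xs = L} e∈ in
                subst (λ i → elems e ∈ₗ tuples offs i) (trans (length-elems e) (size e∈L)) (∈-tuples (elems e) (λ z∈ → stray e∈L ¬ab (∈-elems⁻ z∈))))
              (λ _ _ → elems-injective))
            (≤-trans (≤-reflexive (length-tuples offs k)) (^-monoˡ-≤ k offs-≤))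

        -- A failure makes a constant times n^(k - 3) sets through a, b, z absent, against a bound
        -- independent of n. No vertex is then left for stray edges.
        all-kernels : ∀ z → z ∉ₗ T → K (a ∷ b ∷ z ∷ [])
        all-kernels z z∉T = go (ker-or-cover L k (a ∷ b ∷ z ∷ []))
          where
          go : K (a ∷ b ∷ z ∷ []) ⊎ (∃ λ Z → length Z ≤ k × Covers L (a ∷ b ∷ z ∷ []) Z) → K (a ∷ b ∷ z ∷ [])
          go (inj₁ ker) = ker
          go (inj₂ (Z , le , cov)) = case z ∈ₗ? (a ∷ b ∷ []) of λ { (yes z∈) → ker-ab z∈ ; (no z∉) → ⊥-elim (many z∉) }
            where
            many : z ∉ₗ a ∷ b ∷ [] → ⊥
            many z∉ = <⇒≱ hn₃ (begin
              n                                        ≤⟨ ≤-trans (≤-reflexive (sym (*-identityʳ n))) (*-monoʳ-≤ n (^-positive (1 + j) 1≤n)) ⟩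
              n ^ (2 + j)                              ≤⟨ fresh-cover k (2 + j) (a ∷ b ∷ z ∷ (Z ++ T)) absent
                                                            (λ e∈ → ≤-reflexive (∈-ksubsets⁻ k (proj₁ (∈-filter⁻ pair? {xs = ksubsets n k} (proj₁ (∈-filter⁻ (λ e → ¬? (e ∈E? L)) {xs = through} e∈))))))
                                                            (λ {w} w∈ fr → fromList (a ∷ b ∷ z ∷ w) , in-absent w w∈ fr , All.tabulate (λ x∈ → ∈-fromList⁺ {w = a ∷ b ∷ z ∷ w} (there (there (there x∈)))))
                                                            (≤-trans (*-monoʳ-≤ 2 (*-monoʳ-≤ (2 + j) (+-monoˡ-≤ (2 + j) (+-monoʳ-≤ 3 (≤-trans (≤-reflexive (length-++ Z)) (+-monoˡ-≤ t le)))))) hn₁) 1≤n ⟩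
              2 * (length absent * k ^ (2 + j))        ≤⟨ *-monoʳ-≤ 2 (*-monoˡ-≤ (k ^ (2 + j)) absent-≤) ⟩
              2 * (C₇ ^ k * k ^ (2 + j))               ∎)
              where
              open ≤-Reasoning
              in-absent : ∀ w → w ∈ₗ vtuples (2 + j) → Fresh (a ∷ b ∷ z ∷ (Z ++ T)) w → fromList (a ∷ b ∷ z ∷ w) ∈ₗ absent
              in-absent w w∈ fr = ∈-filter⁺ (λ e → ¬? (e ∈E? L)) (∈-filter⁺ pair? (∈-ksubsets⁺ k sz) (avoidS , mem (here refl) , mem (there (here refl)))) not-in
                where
                off : ∀ {x} → x ∈ₗ w → x ∉ₗ a ∷ b ∷ z ∷ (Z ++ T)
                off = fresh⇒∉ w fr
                mem : ∀ {x} → x ∈ₗ a ∷ b ∷ z ∷ w → x ∈ fromList (a ∷ b ∷ z ∷ w)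
                mem = ∈-fromList⁺ {w = a ∷ b ∷ z ∷ w}
                u : Unique (a ∷ b ∷ z ∷ w)
                u = Unique-∷ (λ { (here eq) → a≢b eq ; (there (here eq)) → z∉ (here (sym eq)) ; (there (there p)) → off p (here refl) })
                    (Unique-∷ (λ { (here eq) → z∉ (there (here (sym eq))) ; (there p) → off p (there (here refl)) })
                    (Unique-∷ (λ p → off p (there (there (here refl)))) (fresh⇒unique w fr)))
                sz : ∣ fromList (a ∷ b ∷ z ∷ w) ∣ ≡ k
                sz = trans (∣fromList∣ u) (cong (3 +_) (tuples-length {xs = allFin n} (2 + j) w∈))
                avoidS : ¬ Meets (fromList (a ∷ b ∷ z ∷ w)) S
                avoidS (x , x∈ , x∈S) with ∈-fromList⁻ (a ∷ b ∷ z ∷ w) x∈ | ∈-fromList⁻ T x∈S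
                ... | here refl | x∈T = a∉T x∈T
                ... | there (here refl) | x∈T = b∉T x∈T
                ... | there (there (here refl)) | x∈T = z∉T x∈T
                ... | there (there (there p)) | x∈T = off p (there (there (there (∈-++⁺ʳ Z x∈T))))
                not-in : fromList (a ∷ b ∷ z ∷ w) ∉ₗ L
                not-in e∈ with cov e∈ (mem (here refl) ∷ mem (there (here refl)) ∷ mem (there (there (here refl))) ∷ [])
                ... | x , x∈Z , x∈e , x∉ with ∈-fromList⁻ (a ∷ b ∷ z ∷ w) x∈e
                ... | here eq = x∉ (here eq)
                ... | there (here eq) = x∉ (there (here eq))
                ... | there (there (here eq)) = x∉ (there (there (here eq)))
                ... | there (there (there p)) = off p (there (there (there (∈-++⁺ˡ x∈Z))))

        contains : ∀ {e} → e ∈ₗ L → a ∈ e × b ∈ e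
        contains {e} e∈ = decidable-stable (both? e) (λ ¬ab →
          let (z , z∈ , _) = extra {r = []} {e} (subst (1 ≤_) (sym (size e∈)) (s≤s z≤n))
          in proj₂ (∈-filter⁻ off? {xs = allFin n} (stray e∈ ¬ab z∈)) (all-kernels z (avoid e∈ z∈)))

    common-pair : ∃ λ a → ∃ λ b → a ≢ b × a ∉ₗ T × b ∉ₗ T × (∀ {e} → e ∈ₗ L → a ∈ e × b ∈ e)
    common-pair = let (y , hU) = anchor
                      (e₀ , e₀∈ , y∈ , a , b , h₀) = start y hU
                  in a , b , proj₁ h₀ , a∉T y hU e₀ e₀∈ y∈ a b h₀ , b∉T y hU e₀ e₀∈ y∈ a b h₀ , contains y hU e₀ e₀∈ y∈ a b h₀

-- The extremal families contain no long cycles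

next-injective : ∀ {ℓ} {i j : Fin ℓ} → next i ≡ next j → i ≡ j
next-injective {suc m} {i} {j} eq with next-cases i | next-cases j
... | inj₁ p | inj₁ r = FinP.toℕ-injective (suc-injective (trans (sym p) (trans (cong toℕ eq) r)))
... | inj₁ p | inj₂ (_ , r) = case trans (sym p) (cong toℕ (trans eq r)) of λ ()
... | inj₂ (_ , p) | inj₁ r = case trans (sym r) (cong toℕ (trans (sym eq) p)) of λ ()
... | inj₂ (p , _) | inj₂ (r , _) = FinP.toℕ-injective (trans p (sym r))

next²≢ : ∀ {m} (i : Fin (3 + m)) → next (next i) ≢ i
next²≢ i eq with next-cases i | next-cases (next i)
... | inj₁ p | inj₁ r = m≢1+n+m _ (trans (sym (cong toℕ eq)) (trans r (cong suc p)))
... | inj₁ p | inj₂ (r , z) = case trans (sym r) (trans p (cong suc (trans (sym (cong toℕ eq)) (cong toℕ z)))) of λ ()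
... | inj₂ (p , z) | inj₁ r = case trans (sym (trans (sym (cong toℕ eq)) (trans r (cong suc (cong toℕ z))))) p of λ ()
... | inj₂ (p , z) | inj₂ (r , _) = case trans (sym r) (cong toℕ z) of λ ()

module InCycle {k n ℓ : ℕ} (G : KGraph k n) (cyc : ContainsCycle ℓ G) where

  private
    F = proj₁ cyc
    v = proj₁ (proj₂ cyc)
    v∈F : ∀ {i j} → v j ∈ F i → j ≡ i ⊎ j ≡ next i
    v∈F {i} {j} = Equivalence.to (proj₁ (proj₂ (proj₂ (proj₂ (proj₂ cyc)))) i j)
    common : ∀ {i j} → i ≢ j → ∀ {x} → x ∈ F i → x ∈ F j → ∃ λ m → x ≡ v m
    common {i} {j} ne {x} = proj₂ (proj₂ (proj₂ (proj₂ (proj₂ cyc)))) i j ne x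

  edge-of : Fin ℓ → Subset n
  edge-of = F

  edge-of-∈ : ∀ i → edge-of i ∈ₗ edges G
  edge-of-∈ = proj₁ (proj₂ (proj₂ cyc))

  #-at-vertex : ∀ x → # (λ i → x ∈? F i) (allFin ℓ) ≤ 2
  #-at-vertex x = go (filter (λ i → x ∈? F i) (allFin ℓ)) refl (UniqueP.filter⁺ (λ i → x ∈? F i) (UniqueP.allFin⁺ ℓ))
      (λ i∈ → proj₂ (∈-filter⁻ (λ i → x ∈? F i) {xs = allFin ℓ} i∈))
    where
    go : ∀ is → filter (λ i → x ∈? F i) (allFin ℓ) ≡ is → Unique is → (∀ {i} → i ∈ₗ is → x ∈ F i) → length (filter (λ i → x ∈? F i) (allFin ℓ)) ≤ 2
    go [] eq u h = ≤-trans (≤-reflexive (cong length eq)) z≤n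
    go (i ∷ []) eq u h = ≤-trans (≤-reflexive (cong length eq)) (s≤s z≤n)
    go (i ∷ j ∷ _) eq ((ij ∷ _) ∷ _) h with common ij (h (here refl)) (h (there (here refl)))
    -- A vertex common to two edges is some `v m`, which lies only in edge m and in the edge before
    -- it.
    ... | m , refl = ≤-trans (#-∪ (λ i → v m ∈? F i) (m FinP.≟_) (λ i → m FinP.≟ next i) (allFin ℓ) (λ _ → v∈F))
          (+-mono-≤ (all-equal⇒length≤1 (UniqueP.filter⁺ (m FinP.≟_) (UniqueP.allFin⁺ ℓ))
                      (λ p r → trans (sym (proj₂ (∈-filter⁻ (m FinP.≟_) {xs = allFin ℓ} p))) (proj₂ (∈-filter⁻ (m FinP.≟_) {xs = allFin ℓ} r))))
                    (all-equal⇒length≤1 (UniqueP.filter⁺ (λ i → m FinP.≟ next i) (UniqueP.allFin⁺ ℓ))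
                      (λ p r → next-injective (trans (sym (proj₂ (∈-filter⁻ (λ i → m FinP.≟ next i) {xs = allFin ℓ} p))) (proj₂ (∈-filter⁻ (λ i → m FinP.≟ next i) {xs = allFin ℓ} r))))))

  #-edges-meeting : ∀ S → # (λ i → Meets? (F i) S) (allFin ℓ) ≤ ∣ S ∣ * 2
  #-edges-meeting S = subst (λ s → # (λ i → Meets? (F i) S) (allFin ℓ) ≤ s * 2) (length-elems S)
    (union-bound-const (λ x i → x ∈? F i) 2 (filter (λ i → Meets? (F i) S) (allFin ℓ)) (elems S)
      (λ i∈ → let (x , x∈ , x∈S) = proj₂ (∈-filter⁻ (λ i → Meets? (F i) S) {xs = allFin ℓ} i∈) in x , ∈-elems⁺ x∈S , x∈)
      (λ {x} _ → ≤-trans (#-filter-≤ (λ i → x ∈? F i) (λ i → Meets? (F i) S) (allFin ℓ)) (#-at-vertex x)))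

  -- Two vertices common to different edges would both be joints of these edges, and in a cycle of
  -- length at least 3 two edges have at most one joint.
  pair-in-one-edge : ∀ {m} → ℓ ≡ 3 + m → ∀ {a b} → a ≢ b → ∀ {i j} → a ∈ F i → b ∈ F i → a ∈ F j → b ∈ F j → i ≡ j
  pair-in-one-edge refl {a} {b} a≢b {i} {j} ai bi aj bj with i FinP.≟ j
  ... | yes eq = eq
  ... | no ne with common ne ai aj | common ne bi bj
  ... | m₁ , refl | m₂ , refl = ⊥-elim (clash (v∈F ai) (v∈F aj) (v∈F bi) (v∈F bj))
    where
    clash : m₁ ≡ i ⊎ m₁ ≡ next i → m₁ ≡ j ⊎ m₁ ≡ next j → m₂ ≡ i ⊎ m₂ ≡ next i → m₂ ≡ j ⊎ m₂ ≡ next j → ⊥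
    clash (inj₁ p) (inj₁ r) _ _ = ne (trans (sym p) r)
    clash (inj₂ p) (inj₂ r) _ _ = ne (next-injective (trans (sym p) r))
    clash _ _ (inj₁ p) (inj₁ r) = ne (trans (sym p) r)
    clash _ _ (inj₂ p) (inj₂ r) = ne (next-injective (trans (sym p) r))
    clash (inj₁ p) _ (inj₁ r) _ = a≢b (cong v (trans p (sym r)))
    clash _ (inj₁ p) _ (inj₁ r) = a≢b (cong v (trans p (sym r)))
    clash (inj₁ p) (inj₂ p′) (inj₂ r) (inj₁ r′) = next²≢ j (trans (cong next (trans (sym p′) p)) (trans (sym r) r′))
    clash (inj₂ p) (inj₁ p′) (inj₁ r) (inj₂ r′) = next²≢ i (trans (cong next (trans (sym p) p′)) (trans (sym r′) r))

module Constructions {k n : ℕ} (S : Subset n) where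

  star : KGraph k n
  star = record { edges = filter (λ e → Meets? e S) (ksubsets n k)
                ; unique = UniqueP.filter⁺ (λ e → Meets? e S) (ksubsets-unique n k)
                ; uniform = All.tabulate (λ e∈ → ∈-ksubsets⁻ k (proj₁ (∈-filter⁻ (λ e → Meets? e S) {xs = ksubsets n k} e∈))) }

  -- Each vertex of S lies in at most two edges of a cycle, so S meets at most 2∣S∣ of them.
  star-free : ¬ ContainsCycle (2 * ∣ S ∣ + 1) star
  star-free cyc = <⇒≱ (≤-reflexive (sym (trans (+-comm (2 * ∣ S ∣) 1) (cong suc (*-comm 2 ∣ S ∣)))))
    (≤-trans (≤-reflexive (sym (length-allFin (2 * ∣ S ∣ + 1)))) (≤-trans
      (#-all (λ i → Meets? (edge-of i) S) (allFin (2 * ∣ S ∣ + 1)) (λ {i} _ → proj₂ (∈-filter⁻ (λ e → Meets? e S) {xs = ksubsets n k} (edge-of-∈ i))))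
      (#-edges-meeting S)))
    where open InCycle star cyc

  family2? : ∀ a b e → Dec (Family2 S a b e)
  family2? a b e = Meets? e S ⊎-dec (¬? (Meets? e S) ×-dec ((a ∈? e) ×-dec (b ∈? e)))

  star⁺ : Fin n → Fin n → KGraph k n
  star⁺ a b = record { edges = filter (family2? a b) (ksubsets n k)
                     ; unique = UniqueP.filter⁺ (family2? a b) (ksubsets-unique n k)
                     ; uniform = All.tabulate (λ e∈ → ∈-ksubsets⁻ k (proj₁ (∈-filter⁻ (family2? a b) {xs = ksubsets n k} e∈))) }

  -- S meets at most 2∣S∣ edges of the cycle, and at most one edge contains both a and b.
  star⁺-free : ∀ {a b} → a ≢ b → 1 ≤ ∣ S ∣ → ¬ ContainsCycle (2 * ∣ S ∣ + 2) (star⁺ a b)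
  star⁺-free {a} {b} a≢b 1≤s cyc = <⇒≱ (≤-reflexive (sym (arith ∣ S ∣)))
    (≤-trans (≤-reflexive (trans (sym (length-allFin ℓ)) (#-¬ (λ i → Meets? (edge-of i) S) (allFin ℓ))))
      (+-mono-≤ (#-edges-meeting S) (all-equal⇒length≤1 (UniqueP.filter⁺ (λ i → ¬? (Meets? (edge-of i) S)) (UniqueP.allFin⁺ ℓ))
        (λ {i} {j} p r → let (ai , bi) = pair p ; (aj , bj) = pair r in pair-in-one-edge ℓ≡ a≢b ai bi aj bj))))
    where
    open InCycle (star⁺ a b) cyc
    ℓ = 2 * ∣ S ∣ + 2
    arith : ∀ s → 2 * s + 2 ≡ suc (s * 2 + 1)
    arith = solve-∀
    ℓ≡ : ℓ ≡ 3 + (2 * ∣ S ∣ + 2 ∸ 3)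
    ℓ≡ = sym (m+[n∸m]≡n (≤-trans (n≤1+n 3) (+-monoˡ-≤ 2 (*-monoʳ-≤ 2 1≤s))))
    pair : ∀ {i} → i ∈ₗ filter (λ i → ¬? (Meets? (edge-of i) S)) (allFin ℓ) → a ∈ edge-of i × b ∈ edge-of i
    pair {i} p with proj₂ (∈-filter⁻ (family2? a b) {xs = ksubsets n k} (edge-of-∈ i))
    ... | inj₁ me = ⊥-elim (proj₂ (∈-filter⁻ (λ i → ¬? (Meets? (edge-of i) S)) {xs = allFin ℓ} p) me)
    ... | inj₂ (_ , ab) = ab

#-⊎ : ∀ {A : Set} {P Q : A → Set} (P? : Decidable P) (Q? : Decidable Q) xs → (∀ {x} → P x → ¬ Q x) →
  # (λ x → P? x ⊎-dec Q? x) xs ≡ # P? xs + # Q? xs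
#-⊎ P? Q? [] h = refl
#-⊎ P? Q? (x ∷ xs) h with P? x | Q? x | #-⊎ P? Q? xs h
... | yes p | yes q | r = ⊥-elim (h p q)
... | yes p | no _  | r = cong suc r
... | no _  | yes _ | r = trans (cong suc r) (sym (+-suc _ _))
... | no _  | no _  | r = r

length-star⁺ : ∀ {m n} (S : Subset n) {a b} → a ≢ b → a ∉ S → b ∉ S →
  length (edges (Constructions.star⁺ {2 + m} S a b)) ≡ n C (2 + m) ∸ (n ∸ ∣ S ∣) C (2 + m) + (n ∸ ∣ S ∣ ∸ 2) C m
length-star⁺ {m} {n} S {a} {b} a≢b a∉ b∉ = trans
  (#-⊎ (λ e → Meets? e S) pair? (ksubsets n (2 + m)) (λ me h → proj₁ h me))
  (cong₂ _+_ (#-meeting (2 + m) S) length-through)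
  where open Pairs S a≢b a∉ b∉ m

-- Choice of the constants

abstract
  -- The q of the kernels used for cycles: 2t + (2k + 2) bounds the prescribed vertices, (2t + 2)·k
  -- the vertices of the edges.
  avoidC : ℕ → ℕ → ℕ
  avoidC j t = 2 * t + (2 * (5 + j) + 2) + (2 * t + 2) * (5 + j)

  avoidC-≥ : ∀ j t → 2 * t + (2 * (5 + j) + 2) + (2 * t + 2) * (5 + j) ≤ avoidC j t
  avoidC-≥ j t = ≤-refl

  -- The first summand makes the missing sets at least twice as many as the low edges, the second
  -- leaves a positive proportion of typed words.
  ratioC : ℕ → ℕ → ℕ
  ratioC j t = suc (2 * suc (avoidC j t * typeC j (avoidC j t) * (2 * (5 + j) ^ (4 + j))) + typeC j (avoidC j t))

  ratioC-≥ : ∀ j t → 2 * suc (avoidC j t * typeC j (avoidC j t) * (2 * (5 + j) ^ (4 + j))) ≤ ratioC j t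
  ratioC-≥ j t = m≤n⇒m≤1+n (m≤m+n _ (typeC j (avoidC j t)))

  ratioC-> : ∀ j t → typeC j (avoidC j t) < ratioC j t
  ratioC-> j t = s≤s (m≤n+m (typeC j (avoidC j t)) (2 * suc (avoidC j t * typeC j (avoidC j t) * (2 * (5 + j) ^ (4 + j)))))

  ratioC-positive : ∀ j t → 1 ≤ ratioC j t
  ratioC-positive j t = s≤s z≤n

-- `h₁` to `h₄` serve domination, `h₅` the count of missing sets, `h₇` to `h₉` the common pair; `h₆`
-- makes room for S, a and b.
record Large (j t n : ℕ) : Set where
  private
    q = avoidC j t
    M = ratioC j t
  field
    h₁ : M * (centralC j q + t * t) ≤ n
    h₂ : M * (centreC q M * richC j q t M) ≤ n
    h₃ : M * ((4 + j) * (4 + j)) ≤ n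
    h₄ : M * (centreC q M ^ t * goodC (5 + j) t) < n
    h₅ : 2 * ((3 + j) * (2 + q + (3 + j))) ≤ n
    h₆ : 2 + t ≤ n
    h₇ : 2 * ((2 + j) * (3 + (5 + j + t) + (2 + j))) ≤ n
    h₈ : pairC j t < n
    h₉ : 2 * (pairC j t ^ (5 + j) * (5 + j) ^ (2 + j)) < n

∈⇒≤∑ : ∀ {x xs} → x ∈ₗ xs → x ≤ ∑ id xs
∈⇒≤∑ {xs = _ ∷ xs} (here refl) = m≤m+n _ (∑ id xs)
∈⇒≤∑ {xs = y ∷ xs} (there x∈)  = ≤-trans (∈⇒≤∑ x∈) (m≤n+m _ y)

eventually-large : ∀ j t → ∃ λ n₀ → ∀ n → n₀ ≤ n → Large j t n
eventually-large j t = ∑ id bounds , λ n le → record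
  { h₁ = ≤-trans (∈⇒≤∑ {xs = bounds} (here refl)) le
  ; h₂ = ≤-trans (∈⇒≤∑ {xs = bounds} (there (here refl))) le
  ; h₃ = ≤-trans (∈⇒≤∑ {xs = bounds} (there (there (here refl)))) le
  ; h₄ = ≤-trans (∈⇒≤∑ {xs = bounds} (there (there (there (here refl))))) le
  ; h₅ = ≤-trans (∈⇒≤∑ {xs = bounds} (there (there (there (there (here refl)))))) le
  ; h₆ = ≤-trans (∈⇒≤∑ {xs = bounds} (there (there (there (there (there (here refl))))))) le
  ; h₇ = ≤-trans (∈⇒≤∑ {xs = bounds} (there (there (there (there (there (there (here refl)))))))) le
  ; h₈ = ≤-trans (∈⇒≤∑ {xs = bounds} (there (there (there (there (there (there (there (here refl))))))))) le
  ; h₉ = ≤-trans (∈⇒≤∑ {xs = bounds} (there (there (there (there (there (there (there (there (here refl)))))))))) le }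
  where
  q = avoidC j t
  M = ratioC j t
  bounds : List ℕ
  bounds = M * (centralC j q + t * t) ∷ M * (centreC q M * richC j q t M) ∷ M * ((4 + j) * (4 + j)) ∷
    suc (M * (centreC q M ^ t * goodC (5 + j) t)) ∷ 2 * ((3 + j) * (2 + q + (3 + j))) ∷ 2 + t ∷
    2 * ((2 + j) * (3 + (5 + j + t) + (2 + j))) ∷ suc (pairC j t) ∷ suc (2 * (pairC j t ^ (5 + j) * (5 + j) ^ (2 + j))) ∷ []

division : ∀ n M → 1 ≤ M → ∃ λ d → d * M ≤ n × n ≤ suc d * M
division n (suc M) _ = n / suc M , m/n*n≤m n (suc M) ,
  ≤-trans (≤-reflexive (m≡m%n+[m/n]*n n (suc M))) (+-monoˡ-≤ (n / suc M * suc M) (<⇒≤ (m%n<n n (suc M))))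

-- Assembling the extremal numbers and families

module Extremality {j n t : ℕ} (1≤t : 1 ≤ t) (lg : Large j t n) where

  open Large lg

  private
    k = 5 + j
    q = avoidC j t
    M = ratioC j t

  N₁ N₂ : ℕ
  N₁ = n C k ∸ (n ∸ t) C k
  N₂ = (n ∸ t ∸ 2) C (3 + j)

  1≤n : 1 ≤ n
  1≤n = ≤-trans (s≤s z≤n) h₆

  t≤n : t ≤ n
  t≤n = ≤-trans (m≤n+m t 2) h₆

  dense : t * ((n ∸ t) C (4 + j)) ≤ N₁
  dense = m+n≤o⇒m≤o∸n _ (subst (λ i → t * ((n ∸ t) C (4 + j)) + (n ∸ t) C k ≤ i C k) (m+[n∸m]≡n t≤n) (C-lower t (n ∸ t) (4 + j)))

  module Family (G : KGraph k n) (m : ℕ) (parity : 3 + m ≡ 2 * t + 1 ⊎ 3 + m ≡ 2 * t + 2) (free : ¬ ContainsCycle (3 + m) G)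
    (many : N₁ ≤ length (edges G)) where

    large₂ : 2 * t + (2 * k + 2) + (2 * t + 2) * k ≤ q
    large₂ = avoidC-≥ j t

    short : 3 + m ≤ 2 * t + 2
    short = [ (λ eq → ≤-trans (≤-reflexive eq) (+-monoʳ-≤ (2 * t) (n≤1+n 1))) , ≤-reflexive ]′ parity

    large₁ : (3 + m) + (3 + m) * k ≤ q
    large₁ = ≤-trans (+-mono-≤ (≤-trans short (+-monoʳ-≤ (2 * t) (m≤n+m 2 (2 * k)))) (*-monoˡ-≤ k short)) large₂

    open Attach G q (3 + m) t 1≤t parity large₂ free using (t₀; goods; good?)
    open Domination G q m (fromℕ< 1≤n) large₁ free t 1≤t parity large₂ using (dominating)

    dominated : ∃ λ T → length T ≡ t × Unique T × t₀ ≤ length (goods T) ×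
      M * length (filter (¬? ∘ good? T) (allFin n)) ≤ typeC j q * n
    dominated = let (dd , lo , hi) = division n M (ratioC-positive j t) in
      dominating M dd lo hi t≤n (≤-trans dense many) h₁ h₂ h₃ h₄ (ratioC-> j t)

    module At (T : List (Fin n)) (lT : length T ≡ t) (uT : Unique T) (big : t₀ ≤ length (goods T))
      (few : M * length (filter (¬? ∘ good? T) (allFin n)) ≤ typeC j q * n) where

      open Comparison G q m large₁ free t 1≤t parity large₂ T lT uT big 1≤n h₅ public

      low-small : 2 * length low ≤ length missing
      low-small = 2*low≤missing M (typeC j q) few (ratioC-≥ j t)

      empty : ∀ {A : Set} {xs : List A} → length xs ≡ 0 → ∀ {x} → x ∉ₗ xs
      empty {xs = []} _ ()

      -- Here a counts gained edges and b missing sets: the loss is at least twice the gain, while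
      -- the assumed number of edges makes it at most the gain.
      both-zero : ∀ {a b} → 2 * a ≤ b → b ≤ a → a ≡ 0 × b ≡ 0
      both-zero {zero}  {b} _ h = refl , n≤0⇒n≡0 h
      both-zero {suc a} {b} h h′ = ⊥-elim (<⇒≱ (≤-trans (s≤s (≤-reflexive (+-comm 0 (suc a)))) (≤-trans (s≤s (m≤n+m _ a)) h)) h′)

      present : length missing ≡ 0 → ∀ {e} → ∣ e ∣ ≡ k → Meets e S → e ∈ₗ edges G
      present none {e} sz me = decidable-stable (e ∈E? edges G) (λ e∉ →
        empty none (∈-filter⁺ (λ e → ¬? (e ∈E? edges G)) (∈-filter⁺ (λ e → Meets? e S) (∈-ksubsets⁺ k sz) me) e∉))

      odd : 3 + m ≡ 2 * t + 1 → HasEdgeSet G (Family1 S) × length (edges G) ≤ N₁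
      odd eq = (λ e → mk⇔ (to e) (λ (sz , me) → present (proj₂ zeros) sz me)) ,
          subst₂ _≤_ (+-identityʳ _) (trans (+-identityʳ _) length-meeting)
            (subst₂ (λ x y → length (edges G) + x ≤ length meeting + y) (proj₂ zeros) (proj₁ zeros) edges+missing)
        where
        outer-low : length outer ≤ length low
        outer-low = unique-⊆-length _≟S_ outer-unique (λ e∈ → ∈-filter⁺ low? e∈ (odd-low eq e∈))
        zeros : length outer ≡ 0 × length missing ≡ 0
        zeros = both-zero (≤-trans (*-monoʳ-≤ 2 outer-low) low-small)
          (+-cancelˡ-≤ (length meeting) _ _ (≤-trans (+-monoˡ-≤ (length missing) (≤-trans (≤-reflexive length-meeting) many)) edges+missing))
        to : ∀ e → e ∈ₗ edges G → ∣ e ∣ ≡ k × Meets e S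
        to e e∈ = Cycles.edge-size G q e∈ , decidable-stable (Meets? e S) (λ ¬me → empty (proj₁ zeros) (∈-filter⁺ (λ e → ¬? (Meets? e S)) e∈ ¬me))

      module Even (eq : 3 + m ≡ 2 * t + 2) (many⁺ : N₁ + N₂ ≤ length (edges G)) where

        high : List (Subset n)
        high = filter (¬? ∘ low?) outer

        high-in : ∀ {e} → e ∈ₗ high → e ∈ₗ outer × ¬ (length (goodIn e) ≤ 1)
        high-in = ∈-filter⁻ (¬? ∘ low?) {xs = outer}

        high-unique : Unique high
        high-unique = UniqueP.filter⁺ (¬? ∘ low?) outer-unique

        module Fr = Frankl {j} (fromℕ< 1≤n) high high-unique (λ e∈ → outer-size (proj₁ (high-in e∈))) T uT
          (λ e∈ → outer-∉ (proj₁ (high-in e∈)))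
          (λ e∈ e′∈ → even-meet eq (proj₁ (high-in e∈)) (proj₂ (high-in e∈)) (proj₁ (high-in e′∈)) (proj₂ (high-in e′∈)))

        pair : N₂ ≤ length high → ∃ λ a → ∃ λ b → a ≢ b × a ∉ₗ T × b ∉ₗ T × (∀ {e} → e ∈ₗ high → a ∈ e × b ∈ e)
        pair h = Fr.Common.common-pair (subst (λ s → (n ∸ s ∸ 2) C (3 + j) ≤ length high) (sym lT) h)
          (subst (λ s → 2 + s ≤ n) (sym lT) h₆)
          (subst (λ s → 2 * ((2 + j) * (3 + (k + s) + (2 + j))) ≤ n) (sym lT) h₇)
          (subst (λ s → pairC j s < n) (sym lT) h₈)
          (subst (λ s → 2 * (pairC j s ^ k * k ^ (2 + j)) < n) (sym lT) h₉)

        module _ {a b : Fin n} (a≢b : a ≢ b) (a∉ : a ∉ₗ T) (b∉ : b ∉ₗ T) (all : ∀ {e} → e ∈ₗ high → a ∈ e × b ∈ e) where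

          open Pairs S a≢b (a∉ ∘ ∈-fromList⁻ T) (b∉ ∘ ∈-fromList⁻ T) (3 + j)

          high⊆ : ∀ {e} → e ∈ₗ high → e ∈ₗ through
          high⊆ e∈ = ∈-filter⁺ pair? (∈-ksubsets⁺ k (outer-size (proj₁ (high-in e∈)))) (proj₂ (outer-in (proj₁ (high-in e∈))) , all e∈)

          through-≡ : length through ≡ N₂
          through-≡ = trans length-through (cong (λ s → (n ∸ s ∸ 2) C (3 + j)) ∣S∣)

          high-≤ : length high ≤ N₂
          high-≤ = ≤-trans (unique-⊆-length _≟S_ high-unique high⊆) (≤-reflexive through-≡)

          through⊆ : N₂ ≤ length high → ∀ {e} → e ∈ₗ through → e ∈ₗ high
          through⊆ h = unique-⊇ _≟S_ high-unique (≤-trans (≤-reflexive through-≡) h) high⊆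

        -- The common pair is available only once `high` has N₂ members, and it then bounds `high`
        -- by N₂; below that size nothing is to be shown.
        at-most : length high ≤ N₂
        at-most = [ id , (λ h → let (a , b , a≢b , a∉ , b∉ , all) = pair h in high-≤ a≢b a∉ b∉ all) ]′ (≤-total (length high) N₂)

        balance : length missing + N₂ ≤ length low + length high
        balance = +-cancelˡ-≤ N₁ _ _ (begin
          N₁ + (length missing + N₂)                  ≡⟨ arith N₁ (length missing) N₂ ⟩
          N₁ + N₂ + length missing                    ≤⟨ +-monoˡ-≤ (length missing) many⁺ ⟩
          length (edges G) + length missing           ≤⟨ edges+missing ⟩
          length meeting + length outer               ≡⟨ cong₂ _+_ length-meeting (#-¬ low? outer) ⟩
          N₁ + (length low + length high)             ∎)
          where
          open ≤-Reasoning
          arith : ∀ a b c → a + (b + c) ≡ a + c + b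
          arith = solve-∀

        zeros : length low ≡ 0 × length missing ≡ 0
        zeros = both-zero low-small (+-cancelʳ-≤ N₂ _ _ (≤-trans balance (+-monoʳ-≤ (length low) at-most)))

        at-least : N₂ ≤ length high
        at-least = subst (λ x → N₂ ≤ x + length high) (proj₁ zeros) (≤-trans (m≤n+m N₂ (length missing)) balance)

        total : length (edges G) ≤ N₁ + N₂
        total = begin
          length (edges G)                            ≤⟨ m≤m+n _ (length missing) ⟩
          length (edges G) + length missing           ≤⟨ edges+missing ⟩
          length meeting + length outer               ≡⟨ cong₂ _+_ length-meeting (trans (#-¬ low? outer) (cong (_+ length high) (proj₁ zeros))) ⟩
          N₁ + length high                            ≤⟨ +-monoʳ-≤ N₁ at-most ⟩
          N₁ + N₂                                     ∎
          where open ≤-Reasoning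

        even : ∃ λ a → ∃ λ b → a ∉ S × b ∉ S × a ≢ b × HasEdgeSet G (Family2 S a b)
        even = let (a , b , a≢b , a∉ , b∉ , all) = pair at-least in
          a , b , a∉ ∘ ∈-fromList⁻ T , b∉ ∘ ∈-fromList⁻ T , a≢b , edge-set a≢b a∉ b∉ all
          where
          edge-set : ∀ {a b} (a≢b : a ≢ b) (a∉ : a ∉ₗ T) (b∉ : b ∉ₗ T) → (∀ {e} → e ∈ₗ high → a ∈ e × b ∈ e) → HasEdgeSet G (Family2 S a b)
          edge-set {a} {b} a≢b a∉ b∉ all e = mk⇔ to from
            where
            open Pairs S a≢b (a∉ ∘ ∈-fromList⁻ T) (b∉ ∘ ∈-fromList⁻ T) (3 + j)
            to : e ∈ₗ edges G → ∣ e ∣ ≡ k × Family2 S a b e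
            to e∈ = Cycles.edge-size G q e∈ , (case Meets? e S of λ
              { (yes me) → inj₁ me
              ; (no ¬me) → let e∈o = ∈-filter⁺ (λ e → ¬? (Meets? e S)) e∈ ¬me in
                  inj₂ (¬me , all (∈-filter⁺ (¬? ∘ low?) e∈o (λ lo → empty (proj₁ zeros) (∈-filter⁺ low? e∈o lo)))) })
            from : ∣ e ∣ ≡ k × Family2 S a b e → e ∈ₗ edges G
            from (sz , inj₁ me) = present (proj₂ zeros) sz me
            from (sz , inj₂ h)  = proj₁ (outer-in (proj₁ (high-in (through⊆ a≢b a∉ b∉ all at-least
              (∈-filter⁺ pair? (∈-ksubsets⁺ k sz) h)))))

  private
    odd-length : ∃ λ m → 3 + m ≡ 2 * t + 1
    odd-length = 2 * t + 1 ∸ 3 , m+[n∸m]≡n (+-monoˡ-≤ 1 (*-monoʳ-≤ 2 1≤t))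

    even-length : ∃ λ m → 3 + m ≡ 2 * t + 2
    even-length = 2 * t + 2 ∸ 3 , m+[n∸m]≡n (≤-trans (n≤1+n 3) (+-monoˡ-≤ 2 (*-monoʳ-≤ 2 1≤t)))

  odd-extremal : ∀ (G : KGraph k n) → ¬ ContainsCycle (2 * t + 1) G → N₁ ≤ length (edges G) →
    (∃ λ S → ∣ S ∣ ≡ t × HasEdgeSet G (Family1 S)) × length (edges G) ≤ N₁
  odd-extremal G free many =
    let (m , eq) = odd-length
        free′ = λ c → free (subst (λ i → ContainsCycle i G) eq c)
        (T , lT , uT , big , few) = Family.dominated G m (inj₁ eq) free′ many
        (has , le) = Family.At.odd G m (inj₁ eq) free′ many T lT uT big few eq
    in (Family.At.S G m (inj₁ eq) free′ many T lT uT big few , Family.At.∣S∣ G m (inj₁ eq) free′ many T lT uT big few , has) , le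

  even-extremal : ∀ (G : KGraph k n) → ¬ ContainsCycle (2 * t + 2) G → N₁ + N₂ ≤ length (edges G) →
    (∃ λ S → ∃ λ a → ∃ λ b → ∣ S ∣ ≡ t × a ∉ S × b ∉ S × a ≢ b × HasEdgeSet G (Family2 S a b)) × length (edges G) ≤ N₁ + N₂
  even-extremal G free many =
    let (m , eq) = even-length
        free′ = λ c → free (subst (λ i → ContainsCycle i G) eq c)
        many′ = ≤-trans (m≤m+n N₁ N₂) many
        (T , lT , uT , big , few) = Family.dominated G m (inj₂ eq) free′ many′
        (a , b , h) = Family.At.Even.even G m (inj₂ eq) free′ many′ T lT uT big few eq many
    in (Family.At.S G m (inj₂ eq) free′ many′ T lT uT big few , a , b , Family.At.∣S∣ G m (inj₂ eq) free′ many′ T lT uT big few , h) ,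
       Family.At.Even.total G m (inj₂ eq) free′ many′ T lT uT big few eq many

  private
    T₀ : List (Fin n)
    T₀ = take t (allFin n)

    S₀ : Subset n
    S₀ = fromList T₀

    length-T₀ : length T₀ ≡ t
    length-T₀ = trans (length-take t (allFin n)) (m≤n⇒m⊓n≡m (subst (t ≤_) (sym (length-allFin n)) t≤n))

    ∣S₀∣ : ∣ S₀ ∣ ≡ t
    ∣S₀∣ = trans (∣fromList∣ (UniqueP.take⁺ t (UniqueP.allFin⁺ n))) length-T₀

    new-vertex : ∀ w → length w < n → ∃ λ x → x ∉ₗ w
    new-vertex w lt = let (x , _ , x∉) = fresh-pick FinP._≟_ w id (UniqueP.allFin⁺ n) (λ _ _ → id) (subst (length w <_) (sym (length-allFin n)) lt) in x , x∉

  odd-example : Σ (KGraph k n) λ G → ¬ ContainsCycle (2 * t + 1) G × length (edges G) ≡ N₁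
  odd-example = Constructions.star {k} S₀ ,
    subst (λ s → ¬ ContainsCycle (2 * s + 1) (Constructions.star {k} S₀)) ∣S₀∣ (Constructions.star-free {k} S₀) ,
    trans (#-meeting k S₀) (cong (λ s → n C k ∸ (n ∸ s) C k) ∣S₀∣)

  even-example : Σ (KGraph k n) λ G → ¬ ContainsCycle (2 * t + 2) G × length (edges G) ≡ N₁ + N₂
  even-example =
    let (a , a∉) = new-vertex T₀ (subst (_< n) (sym length-T₀) (≤-trans (n≤1+n (suc t)) h₆))
        (b , b∉) = new-vertex (a ∷ T₀) (subst (λ s → suc (suc s) ≤ n) (sym length-T₀) h₆)
        a≢b = λ eq → b∉ (here (sym eq))
    in Constructions.star⁺ {k} S₀ a b ,
       subst (λ s → ¬ ContainsCycle (2 * s + 2) (Constructions.star⁺ {k} S₀ a b)) ∣S₀∣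
         (Constructions.star⁺-free {k} S₀ a≢b (subst (1 ≤_) (sym ∣S₀∣) 1≤t)) ,
       trans (length-star⁺ {3 + j} S₀ a≢b (a∉ ∘ ∈-fromList⁻ T₀) (λ p → b∉ (there (∈-fromList⁻ T₀ p))))
         (cong (λ s → n C k ∸ (n ∸ s) C k + (n ∸ s ∸ 2) C (3 + j)) ∣S₀∣)

theorem6p1 : (k t : ℕ) → 5 ≤ k → 1 ≤ t →
    ∃ λ n₀ → ∀ n → n₀ ≤ n →
    (IsEx k n (2 * t + 1) (n C k ∸ (n ∸ t) C k) ×
    (∀ (G : KGraph k n) → Extremal (2 * t + 1) (n C k ∸ (n ∸ t) C k) G →
    Σ (Subset n) λ S → ∣ S ∣ ≡ t × HasEdgeSet G (Family1 S)))
    ×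
    (IsEx k n (2 * t + 2) (n C k ∸ (n ∸ t) C k + (n ∸ t ∸ 2) C (k ∸ 2)) ×
    (∀ (G : KGraph k n) →
    Extremal (2 * t + 2) (n C k ∸ (n ∸ t) C k + (n ∸ t ∸ 2) C (k ∸ 2)) G →
    Σ (Subset n) λ S → Σ (Fin n) λ a → Σ (Fin n) λ b →
    ∣ S ∣ ≡ t × a ∉ S × b ∉ S × a ≢ b × HasEdgeSet G (Family2 S a b)))
theorem6p1 (suc (suc (suc (suc (suc j))))) t (s≤s (s≤s (s≤s (s≤s (s≤s z≤n))))) 1≤t =
  let (n₀ , large) = eventually-large j t in n₀ , λ n n₀≤n →
  let open Extremality {j} {n} 1≤t (large n n₀≤n)
      -- The structure is known only for graphs with at least N edges; the others satisfy the bound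
      -- anyway.
      upper : ∀ {N len} → (N ≤ len → len ≤ N) → len ≤ N
      upper = λ {N} {len} h → [ id , h ]′ (≤-total len N)
  in (((λ G free → upper (λ le → proj₂ (odd-extremal G free le))) , odd-example) ,
      (λ G (free , eq) → proj₁ (odd-extremal G free (≤-reflexive (sym eq))))) ,
     (((λ G free → upper (λ le → proj₂ (even-extremal G free le))) , even-example) ,
      (λ G (free , eq) → proj₁ (even-extremal G free (≤-reflexive (sym eq)))))
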